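{- Every finite simple graph $G$ that contains neither $P_6$ nor $C_4$ as an induced subgraph satisfies $\chi(G)\le\frac{3}{2}\omega(G)$.
   Context: $P_6$ is the path on $6$ vertices, $C_4$ the cycle on $4$ vertices; $\chi$ is the chromatic number and $\omega$ the clique number. -}

module Defs where

open import Data.Nat using (ℕ; suc; _≤_; _*_)
open import Data.Bool using (Bool; true; false; T)
open import Data.Fin using (Fin; zero; suc; toℕ)
open import Data.Nat.Base using (∣_-_∣; _≡ᵇ_)
open import Data.Product using (Σ; ∃; _×_; _,_)
open import Relation.Nullary using (¬_)
open import Relation.Binary.PropositionalEquality using (_≡_; _≢_)
open import Function.Definitions using (Injective)
import Data.Nat.Properties

record Graph (n : ℕ) : Set where
  field
    adj     : Fin n → Fin n → Bool
    sym     : ∀ i j → adj i j ≡ adj j i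
    irrefl  : ∀ i → adj i i ≡ false
open Graph public

IsInducedSubgraph : ∀ {k n} → Graph k → Graph n → Set
IsInducedSubgraph {k} {n} H G =
  Σ (Fin k → Fin n) λ f →
    Injective _≡_ _≡_ f × (∀ i j → adj G (f i) (f j) ≡ adj H i j)

p6adj : Fin 6 → Fin 6 → Bool
p6adj i j = ∣ toℕ i - toℕ j ∣ ≡ᵇ 1

c4adj : Fin 4 → Fin 4 → Bool
c4adj i j with ∣ toℕ i - toℕ j ∣
... | 1 = true
... | 3 = true
... | _ = false

P6 : Graph 6
P6 = record { adj = p6adj ; sym = p6sym ; irrefl = p6irr }
  where
  p6sym : ∀ i j → p6adj i j ≡ p6adj j i
  p6sym i j rewrite Data.Nat.Properties.∣-∣-comm (toℕ i) (toℕ j) = _≡_.refl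
  p6irr : ∀ i → p6adj i i ≡ false
  p6irr i rewrite Data.Nat.Properties.∣n-n∣≡0 (toℕ i) = _≡_.refl

C4 : Graph 4
C4 = record { adj = c4adj ; sym = c4sym ; irrefl = c4irr }
  where
  c4sym : ∀ i j → c4adj i j ≡ c4adj j i
  c4sym i j rewrite Data.Nat.Properties.∣-∣-comm (toℕ i) (toℕ j) = _≡_.refl
  c4irr : ∀ i → c4adj i i ≡ false
  c4irr i rewrite Data.Nat.Properties.∣n-n∣≡0 (toℕ i) = _≡_.refl

IsClique : ∀ {n k} → Graph n → (Fin k → Fin n) → Set
IsClique G f = Injective _≡_ _≡_ f × (∀ i j → i ≢ j → T (adj G (f i) (f j)))

HasClique : ∀ {n} → Graph n → ℕ → Set
HasClique {n} G k = Σ (Fin k → Fin n) λ f → IsClique G f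

CliqueNumber : ∀ {n} → Graph n → ℕ → Set
CliqueNumber G w = HasClique G w × (∀ k → HasClique G k → k ≤ w)

ProperColoring : ∀ {n} → Graph n → (m : ℕ) → (Fin n → Fin m) → Set
ProperColoring G m c = ∀ i j → T (adj G i j) → c i ≢ c j

Colorable : ∀ {n} → Graph n → ℕ → Set
Colorable {n} G m = Σ (Fin n → Fin m) λ c → ProperColoring G m c

{-# OPTIONS --safe #-}
-- Let G be a counterexample with the fewest vertices and w its clique number. Then every vertex has degree at least
-- ⌊3w/2⌋, and G has neither a clique cutset nor a universal vertex. If the closed neighbourhoods of two vertices are covered,
-- with multiplicity, by three cliques, then one of the two vertices has degree below 3w/2. Fixing an induced copy of a
-- small graph F and sorting the other vertices by their adjacencies to it, all but a few sorts create a P6, a C4 or a graph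
-- excluded before; what is left is either such a pair of vertices, a clique cutset, a universal vertex, or G is obtained
-- from F by replacing vertices by cliques, in which case deleting F, which is 3-colourable, lowers the clique number by two.
-- This excludes in turn some graphs containing a C6 (ending with the Petersen graph and its subgraphs), then C6 itself,
-- some graphs containing a C5, and C5. A graph without holes has a clique cutset or is complete.
module Submission where

open import Defs hiding (sym)
open import Data.Bool using (Bool; true; false; T; not; _∧_; _∨_; if_then_else_)
open import Data.Empty using (⊥; ⊥-elim)
open import Data.Fin using (Fin; zero; suc; toℕ; fromℕ<)
open import Data.Fin.Properties using (_≟_; any?; all?; injective⇒≤; suc-injective; toℕ<n; toℕ-injective; toℕ-fromℕ<)
open import Data.List using (List; []; _∷_; _++_; _∷ʳ_; length; drop; take)
open import Data.List.Membership.Propositional using (_∈_; find; lose)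
open import Data.List.Membership.Propositional.Properties using (∈-++⁺ˡ; ∈-++⁺ʳ)
open import Data.List.Properties using (length-++)
open import Data.List.Relation.Unary.All using (All; []; _∷_)
open import Data.List.Relation.Unary.Any as Any using (Any; here; there)
open import Data.Maybe using (Maybe; just; nothing)
open import Data.Nat using (ℕ; zero; suc; _+_; _*_; _∸_; _/_; _%_; _≤_; _<_; _≡ᵇ_; _≤ᵇ_; _<ᵇ_; z≤n; s≤s; ⌊_/2⌋)
open import Data.Nat.Induction using (<-wellFounded)
open import Data.Nat.Properties as ℕₚ using (≤-refl; ≤-trans; ≤-reflexive; ≤-pred; n≤1+n; +-mono-≤; <-irrefl; m≤m+n)
open import Data.Product using (Σ; _×_; _,_; proj₁; proj₂)
open import Data.Sum using (_⊎_; inj₁; inj₂)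
open import Data.Unit using (⊤; tt)
open import Function using (_∘_; case_of_)
open import Function.Definitions using (Injective)
open import Induction.WellFounded using (Acc; acc)
open import Relation.Binary.PropositionalEquality using (_≡_; _≢_; refl; sym; trans; cong; cong₂; subst; subst₂)
open import Relation.Nullary using (¬_; Dec; yes; no; does)
open import Relation.Nullary.Decidable using (_×-dec_; _→-dec_; _⊎-dec_; ¬?; toWitness; map′; dec-true; dec-false)
import Algebra.Properties.CommutativeSemigroup ℕₚ.+-commutativeSemigroup as +-Semigroup
import Data.Bool.Properties as 𝔹
import Data.Maybe.Properties as Maybeₚ

-- Counting

-- The excluded graphs are not refuted. Given colourings of all smaller graphs, each exclusion turns
-- an occurrence into the colouring `Goal` itself, so a case analysis can end in nothing but `Goal`.
-- Where data are wanted (a clique, a covering, a partition into clones), a finite search for a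
-- failure comes first, and a failure yields `Goal`.
--
-- The obstacle is the number of cases: all ways to attach a vertex to a graph on up to ten
-- vertices, and all pairs of such ways. They are stored as derivation trees, run by a Boolean
-- checker whose soundness is proved once, and accepted by `refl`.
--
-- Three cliques fit the bound because two closed neighbourhoods then have at most 3w members
-- together; the smaller has at most 3w/2, which leaves its centre a free colour. Blow-ups meet the
-- ratio exactly, three colours for two units of the clique number.
--
-- Adjacencies to a fixed copy cannot tell a vertex of the copy from its clones. Where this matters,
-- the copy is chosen with extremal degree sum, so that a private neighbour of one of them forces
-- one of the other.

bit : Bool → ℕ
bit true  = 1
bit false = 0

∑ : ∀ {n} → (Fin n → ℕ) → ℕ
∑ {zero}  f = 0
∑ {suc n} f = f zero + ∑ (f ∘ suc)

∑-mono : ∀ {n} {f g : Fin n → ℕ} → (∀ i → f i ≤ g i) → ∑ f ≤ ∑ g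
∑-mono {zero}  f≤g = z≤n
∑-mono {suc n} f≤g = +-mono-≤ (f≤g zero) (∑-mono (f≤g ∘ suc))

∑-+ : ∀ {n} (f g : Fin n → ℕ) → ∑ (λ i → f i + g i) ≡ ∑ f + ∑ g
∑-+ {zero}  f g = refl
∑-+ {suc n} f g rewrite ∑-+ (f ∘ suc) (g ∘ suc) = +-Semigroup.interchange (f zero) (g zero) _ _

∑-mono-< : ∀ {n} {f g : Fin n → ℕ} → (∀ i → f i ≤ g i) → ∀ j → f j < g j → ∑ f < ∑ g
∑-mono-< f≤g zero    fj<gj = +-mono-≤ fj<gj (∑-mono (f≤g ∘ suc))
∑-mono-< f≤g (suc j) fj<gj = ℕₚ.+-mono-≤-< (f≤g zero) (∑-mono-< (f≤g ∘ suc) j fj<gj)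

count : ∀ {n} → (Fin n → Bool) → ℕ
count P = ∑ (bit ∘ P)

bit-mono : ∀ {a b} → (a ≡ true → b ≡ true) → bit a ≤ bit b
bit-mono {false} _ = z≤n
bit-mono {true}  a⇒b rewrite a⇒b refl = ≤-refl

count-mono-< : ∀ {n} {P Q : Fin n → Bool} → (∀ i → P i ≡ true → Q i ≡ true) →
  ∀ j → P j ≡ false → Q j ≡ true → count P < count Q
count-mono-< {P = P} {Q} P⊆Q j j∉P j∈Q =
  ∑-mono-< (λ i → bit-mono (P⊆Q i)) j (subst₂ (λ a b → bit a < bit b) (sym j∉P) (sym j∈Q) ≤-refl)

count-all : ∀ n → count {n} (λ _ → true) ≡ n
count-all zero    = refl
count-all (suc n) = cong suc (count-all n)

count<n : ∀ {n} (P : Fin n → Bool) x → P x ≡ false → count P < n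
count<n {n} P x x∉P = subst (count P <_) (count-all n) (count-mono-< {P = P} (λ _ _ → refl) x x∉P refl)

-- The passage between a vertex set and a graph on `Fin k`: `elem` carries the induced subgraph, and
-- `index` brings its colouring back.
record Listing {n} (P : Fin n → Bool) (k : ℕ) : Set where
  field
    elem     : Fin k → Fin n
    elem-inj : Injective _≡_ _≡_ elem
    elem-∈   : ∀ i → P (elem i) ≡ true
    index    : ∀ v → P v ≡ true → Fin k
    elem-index : ∀ v v∈P → elem (index v v∈P) ≡ v

listing : ∀ {n} (P : Fin n → Bool) → Listing P (count P)
listing {zero} P = record { elem = λ () ; elem-inj = λ { {()} } ; elem-∈ = λ () ; index = λ () ; elem-index = λ () }
listing {suc n} P with P zero in eq | listing (P ∘ suc)
... | true | L = record
  { elem = λ { zero → zero ; (suc i) → suc (elem i) }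
  ; elem-inj = λ { {zero} {zero} _ → refl ; {suc i} {suc j} e → cong suc (elem-inj (suc-injective e)) }
  ; elem-∈ = λ { zero → eq ; (suc i) → elem-∈ i }
  ; index = λ { zero _ → zero ; (suc v) p → suc (index v p) }
  ; elem-index = λ { zero _ → refl ; (suc v) p → cong suc (elem-index v p) } }
  where
  open Listing L
... | false | L = record
  { elem = suc ∘ elem
  ; elem-inj = λ e → elem-inj (suc-injective e)
  ; elem-∈ = elem-∈
  ; index = λ { zero p → case trans (sym eq) p of λ () ; (suc v) p → index v p }
  ; elem-index = λ { zero p → case trans (sym eq) p of λ () ; (suc v) p → cong suc (elem-index v p) } }
  where
  open Listing L

injective⇒≤count : ∀ {m n} {P : Fin n → Bool} (f : Fin m → Fin n) → Injective _≡_ _≡_ f →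
  (∀ i → P (f i) ≡ true) → m ≤ count P
injective⇒≤count {P = P} f f-inj f∈P = injective⇒≤ {f = λ i → index (f i) (f∈P i)} λ {i} {j} e →
  f-inj (trans (sym (elem-index _ (f∈P i))) (trans (cong elem e) (elem-index _ (f∈P j))))
  where open Listing (listing P)

_==_ : ∀ {n} → Fin n → Fin n → Bool
u == v = does (u ≟ v)

==-refl : ∀ {n} (u : Fin n) → (u == u) ≡ true
==-refl u = dec-true (u ≟ u) refl

==⇒≡ : ∀ {n} {u v : Fin n} → (u == v) ≡ true → u ≡ v
==⇒≡ {u = u} {v} e with u ≟ v
... | yes p = p

≢⇒== : ∀ {n} {u v : Fin n} → u ≢ v → (u == v) ≡ false
≢⇒== {u = u} {v} = dec-false (u ≟ v)

-- Colourings

half3 : ℕ → ℕ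
half3 w = ⌊ 3 * w /2⌋

half-lower : ∀ k → ⌊ k /2⌋ + ⌊ k /2⌋ ≤ k
half-lower zero          = z≤n
half-lower (suc zero)    = z≤n
half-lower (suc (suc k)) rewrite ℕₚ.+-suc ⌊ k /2⌋ ⌊ k /2⌋ = s≤s (s≤s (half-lower k))

half-upper : ∀ k → k ≤ suc (⌊ k /2⌋ + ⌊ k /2⌋)
half-upper zero          = z≤n
half-upper (suc zero)    = ≤-refl
half-upper (suc (suc k)) rewrite ℕₚ.+-suc ⌊ k /2⌋ ⌊ k /2⌋ = s≤s (s≤s (half-upper k))

half3-1 : ∀ w → 1 + half3 w ≤ half3 (1 + w)
half3-1 w = ≤-trans (s≤s (ℕₚ.⌊n/2⌋-mono (n≤1+n (3 * w))))
  (≤-reflexive (cong ⌊_/2⌋ (sym (ℕₚ.*-distribˡ-+ 3 1 w))))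

-- The exact exchange rate of the theorem, spent when a blown-up base is deleted.
half3-2 : ∀ w → 3 + half3 w ≤ half3 (2 + w)
half3-2 w = ≤-reflexive (cong ⌊_/2⌋ (sym (ℕₚ.*-distribˡ-+ 3 2 w)))

-- An upper bound passes to induced subgraphs unchanged, whereas their exact clique numbers would
-- have to be computed.
Bound : ∀ {n} → Graph n → ℕ → Set
Bound G w = ∀ k → HasClique G k → k ≤ w

Free : ∀ {n} → Graph n → Set
Free G = (¬ IsInducedSubgraph P6 G) × (¬ IsInducedSubgraph C4 G)

Smaller : ℕ → Set
Smaller n = ∀ {k} (H : Graph k) → k < n → Free H → ∀ w → Bound H w → Colorable H (half3 w)

induced : ∀ {k n} → Graph n → (Fin k → Fin n) → Graph k
induced G e = record
  { adj = λ i j → adj G (e i) (e j)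
  ; sym = λ i j → Graph.sym G (e i) (e j)
  ; irrefl = λ i → irrefl G (e i) }

induced-free : ∀ {k n} {G : Graph n} {e : Fin k → Fin n} → Injective _≡_ _≡_ e → Free G → Free (induced G e)
induced-free {e = e} e-inj (noP6 , noC4) =
  (λ { (f , f-inj , f-adj) → noP6 (e ∘ f , f-inj ∘ e-inj , f-adj) }) ,
  (λ { (f , f-inj , f-adj) → noC4 (e ∘ f , f-inj ∘ e-inj , f-adj) })

≡true⇒T : ∀ {b} → b ≡ true → T b
≡true⇒T refl = tt

T⇒≡true : ∀ {b} → T b → b ≡ true
T⇒≡true {true} _ = refl

true≢false : ∀ {b} {A : Set} → b ≡ true → b ≡ false → A
true≢false refl ()

∨-true : ∀ a {b} → a ∨ b ≡ true → (a ≡ true) ⊎ (b ≡ true)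
∨-true true  _ = inj₁ refl
∨-true false e = inj₂ e

∨-introʳ : ∀ a {b} → b ≡ true → a ∨ b ≡ true
∨-introʳ true  _ = refl
∨-introʳ false e = e

∧-true : ∀ a {b} → a ∧ b ≡ true → (a ≡ true) × (b ≡ true)
∧-true true e = refl , e

∧-intro : ∀ {a b} → a ≡ true → b ≡ true → a ∧ b ≡ true
∧-intro refl refl = refl

not-true : ∀ {a} → not a ≡ true → a ≡ false
not-true {false} _ = refl

bool? : ∀ b → (b ≡ true) ⊎ (b ≡ false)
bool? true  = inj₁ refl
bool? false = inj₂ refl

swap : ℕ → ℕ → ℕ → ℕ
swap a b x with x ℕₚ.≟ a
... | yes _ = b
... | no _ with x ℕₚ.≟ b
...   | yes _ = a
...   | no _ = x

swap-left : ∀ a b → swap a b a ≡ b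
swap-left a b with a ℕₚ.≟ a
... | yes _ = refl
... | no a≢a = ⊥-elim (a≢a refl)

swap-right : ∀ a b → swap a b b ≡ a
swap-right a b with b ℕₚ.≟ a
... | yes b≡a = b≡a
... | no _ with b ℕₚ.≟ b
...   | yes _ = refl
...   | no b≢b = ⊥-elim (b≢b refl)

swap-other : ∀ {a b x} → x ≢ a → x ≢ b → swap a b x ≡ x
swap-other {a} {b} {x} x≢a x≢b with x ℕₚ.≟ a
... | yes x≡a = ⊥-elim (x≢a x≡a)
... | no _ with x ℕₚ.≟ b
...   | yes x≡b = ⊥-elim (x≢b x≡b)
...   | no _ = refl

swap-involutive : ∀ a b x → swap a b (swap a b x) ≡ x
swap-involutive a b x with x ℕₚ.≟ a
... | yes refl = swap-right a b
... | no x≢a with x ℕₚ.≟ b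
...   | yes refl = swap-left a b
...   | no x≢b = swap-other x≢a x≢b

swap-< : ∀ {m a b x} → a < m → b < m → x < m → swap a b x < m
swap-< {a = a} {b} {x} a<m b<m x<m with x ℕₚ.≟ a
... | yes _ = b<m
... | no _ with x ℕₚ.≟ b
...   | yes _ = a<m
...   | no _ = x<m

module Notation {n : ℕ} (G : Graph n) where

  V : Set
  V = Fin n

  _~_ : V → V → Bool
  _~_ = adj G

  ~-sym : ∀ {u v b} → u ~ v ≡ b → v ~ u ≡ b
  ~-sym {u} {v} e = trans (Graph.sym G v u) e

  ~⇒≢ : ∀ {u v} → u ~ v ≡ true → u ≢ v
  ~⇒≢ {u} e refl = true≢false e (irrefl G u)

-- Reductions for a graph all of whose smaller induced subgraphs are colourable

module Critical {n : ℕ} (G : Graph n) (w : ℕ) (bound : Bound G w) (free : Free G) (IH : Smaller n) where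

  open Notation G

  -- Colours are natural numbers, bounded only on `P`: values elsewhere are arbitrary, and
  -- colourings of different parts can be shifted and glued without casts.
  PColor : (V → Bool) → ℕ → Set
  PColor P m = Σ (V → ℕ) λ c → (∀ v → P v ≡ true → c v < m) ×
    (∀ u v → P u ≡ true → P v ≡ true → u ~ v ≡ true → c u ≢ c v)

  m : ℕ
  m = half3 w

  Goal : Set
  Goal = PColor (λ _ → true) m

  CliqueIn : (V → Bool) → ℕ → Set
  CliqueIn P k = Σ (Fin k → V) λ f → (∀ i → P (f i) ≡ true) × IsClique G f

  -- The last component makes the step repeatable: a second vertex complete to `f` and adjacent to
  -- `u` can be added to the result.
  clique-cons : ∀ {k} (f : Fin k → V) → IsClique G f → ∀ u → (∀ i → u ~ f i ≡ true) →
    Σ (Fin (suc k) → V) λ g → IsClique G g × (∀ x → (∀ i → x ~ f i ≡ true) → x ~ u ≡ true → ∀ i → x ~ g i ≡ true)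
  clique-cons {k} f (f-inj , f-adj) u u~f = g , (g-inj , g-adj) , λ { x x~f x~u zero → x~u ; x x~f x~u (suc i) → x~f i }
    where
    g : Fin (suc k) → V
    g zero = u
    g (suc i) = f i
    g-inj : Injective _≡_ _≡_ g
    g-inj {zero} {zero} _ = refl
    g-inj {zero} {suc j} e = ⊥-elim (~⇒≢ (u~f j) e)
    g-inj {suc i} {zero} e = ⊥-elim (~⇒≢ (u~f i) (sym e))
    g-inj {suc i} {suc j} e = cong suc (f-inj e)
    g-adj : ∀ i j → i ≢ j → T (g i ~ g j)
    g-adj zero zero i≢j = ⊥-elim (i≢j refl)
    g-adj zero (suc j) _ = ≡true⇒T (u~f j)
    g-adj (suc i) zero _ = ≡true⇒T (~-sym (u~f i))
    g-adj (suc i) (suc j) i≢j = f-adj i j (i≢j ∘ cong suc)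

  -- The only access to the induction hypothesis; the vertex `x` outside `P` makes the induced
  -- subgraph smaller.
  pcol : (P : V → Bool) (x : V) → P x ≡ false → ∀ w' → (∀ k → CliqueIn P k → k ≤ w') → PColor P (half3 w')
  pcol P x x∉P w' bd = c , c<m , c-proper
    where
    open Listing (listing P)
    H-col : Colorable (induced G elem) (half3 w')
    H-col = IH (induced G elem) (count<n P x x∉P) (induced-free {G = G} elem-inj free) w'
      λ { k (f , f-inj , f-adj) → bd k (elem ∘ f , (λ i → elem-∈ (f i)) , f-inj ∘ elem-inj , f-adj) }
    c′ : Fin (count P) → Fin (half3 w')
    c′ = proj₁ H-col
    -- The value of `P v` enters with its equation, so that indices obtained from different proofs
    -- of membership can be compared.
    colour : ∀ v b → P v ≡ b → ℕ
    colour v true  v∈P = toℕ (c′ (index v v∈P))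
    colour v false _   = 0
    c : V → ℕ
    c v = colour v (P v) refl
    colour-eq : ∀ v b (e : P v ≡ b) (v∈P : P v ≡ true) → colour v b e ≡ toℕ (c′ (index v v∈P))
    colour-eq v true e v∈P = cong (toℕ ∘ c′) (elem-inj (trans (elem-index v e) (sym (elem-index v v∈P))))
    colour-eq v false e v∈P = true≢false v∈P e
    c<m : ∀ v → P v ≡ true → c v < half3 w'
    c<m v v∈P = subst (_< half3 w') (sym (colour-eq v (P v) refl v∈P)) (toℕ<n _)
    c-proper : ∀ u v → P u ≡ true → P v ≡ true → u ~ v ≡ true → c u ≢ c v
    c-proper u v u∈P v∈P u~v cu≡cv = proj₂ H-col (index u u∈P) (index v v∈P)
      (≡true⇒T (subst₂ (λ a b → a ~ b ≡ true) (sym (elem-index u u∈P)) (sym (elem-index v v∈P)) u~v))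
      (toℕ-injective (trans (sym (colour-eq u (P u) refl u∈P)) (trans cu≡cv (colour-eq v (P v) refl v∈P))))

  closed : V → V → Bool
  closed v u = (u == v) ∨ (v ~ u)

  cdeg : V → ℕ
  cdeg v = count (closed v)

  -- After colouring everything but `v`, some colour is free at `v`. Otherwise one neighbour for
  -- each of the `m` colours gives `m` distinct neighbours, and with `v` itself the closed
  -- neighbourhood exceeds `m`.
  small-vertex : ∀ v → cdeg v ≤ m → Goal
  small-vertex v cdeg≤m = go (pcol P v (cong not (==-refl v)) w λ { k (f , _ , cl) → bound k (f , cl) })
    where
    P : V → Bool
    P u = not (u == v)
    ∈P : ∀ {u} → u ≢ v → P u ≡ true
    ∈P u≢v = cong not (≢⇒== u≢v)
    dec→ : ∀ b {A : Set} → Dec A → Dec (b ≡ true → ¬ A)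
    dec→ false _ = yes λ ()
    dec→ true (yes a) = no λ f → f refl a
    dec→ true (no ¬a) = yes λ _ → ¬a
    go : PColor P m → Goal
    go (c , c<m , c-proper) with any? {P = λ (a : Fin m) → ∀ u → v ~ u ≡ true → c u ≢ toℕ a}
                                      (λ a → all? λ u → dec→ (v ~ u) (c u ℕₚ.≟ toℕ a))
    ... | yes (a , a-free) = d , d<m , d-proper
      where
      d : V → ℕ
      d u = if u == v then toℕ a else c u
      d<m : ∀ u → true ≡ true → d u < m
      d<m u _ with u ≟ v
      ... | yes _ = toℕ<n a
      ... | no u≢v = c<m u (∈P u≢v)
      d-proper : ∀ x y → true ≡ true → true ≡ true → x ~ y ≡ true → d x ≢ d y
      d-proper x y _ _ x~y with x ≟ v | y ≟ v
      ... | yes refl | yes refl = ⊥-elim (~⇒≢ x~y refl)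
      ... | yes refl | no y≢v = a-free y x~y ∘ sym
      ... | no x≢v | yes refl = a-free x (~-sym x~y)
      ... | no x≢v | no y≢v = c-proper x y (∈P x≢v) (∈P y≢v) x~y
    ... | no ¬free = ⊥-elim (<-irrefl refl (≤-trans (s≤s m≤deg) (≤-trans deg<cdeg cdeg≤m)))
      where
      used : ∀ a → Σ V λ u → (v ~ u ≡ true) × (c u ≡ toℕ a)
      used a with any? (λ u → (v ~ u 𝔹.≟ true) ×-dec (c u ℕₚ.≟ toℕ a))
      ... | yes p = p
      ... | no ¬p = ⊥-elim (¬free (a , λ u v~u cu≡a → ¬p (u , v~u , cu≡a)))
      m≤deg : m ≤ count (v ~_)
      m≤deg = injective⇒≤count (proj₁ ∘ used)
        (λ {a} {b} e → toℕ-injective (trans (sym (proj₂ (proj₂ (used a)))) (trans (cong c e) (proj₂ (proj₂ (used b))))))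
        (λ a → proj₁ (proj₂ (used a)))
      deg<cdeg : count (v ~_) < cdeg v
      deg<cdeg = count-mono-< (λ u → ∨-introʳ (u == v)) v (irrefl G v) (cong (_∨ (v ~ v)) (==-refl v))

  -- `X` takes the first `r` colours, and the colouring of the rest is shifted past them.
  peel : ∀ r w' (X : V → Bool) x → X x ≡ true → PColor X r → (∀ k → CliqueIn (not ∘ X) k → k ≤ w') →
    r + half3 w' ≤ m → Goal
  peel r w' X x x∈X (cX , cX<r , cX-proper) bd r+≤m = go (pcol (not ∘ X) x (cong not x∈X) w' bd)
    where
    go : PColor (not ∘ X) (half3 w') → Goal
    go (c , c<m , c-proper) = d , d<m , d-proper
      where
      d : V → ℕ
      d v = if X v then cX v else r + c v
      d<m : ∀ v → true ≡ true → d v < m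
      d<m v _ with X v in eq
      ... | true = ≤-trans (cX<r v eq) (≤-trans (m≤m+n r _) r+≤m)
      ... | false = ≤-trans (ℕₚ.+-monoʳ-< r (c<m v (cong not eq))) r+≤m
      far : ∀ {u v} → X u ≡ true → cX u ≢ r + c v
      far {u} u∈X e = <-irrefl e (≤-trans (cX<r u u∈X) (m≤m+n r _))
      d-proper : ∀ u v → true ≡ true → true ≡ true → u ~ v ≡ true → d u ≢ d v
      d-proper u v _ _ u~v with X u in equ | X v in eqv
      ... | true | true = cX-proper u v equ eqv u~v
      ... | true | false = far equ
      ... | false | true = far eqv ∘ sym
      ... | false | false = c-proper u v (cong not equ) (cong not eqv) u~v ∘ ℕₚ.+-cancelˡ-≡ r _ _

  -- Every clique avoiding `u` extends by `u`, so deleting `u` lowers the clique bound by one at the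
  -- price of one colour.
  universal : ∀ u → (∀ v → v ≢ u → u ~ v ≡ true) → Goal
  universal u uni = go w refl
    where
    ext : ∀ k → CliqueIn (not ∘ (_== u)) k → suc k ≤ w
    ext k (f , f∈ , cl) with clique-cons f cl u (λ i → uni (f i) λ e → true≢false (==-refl u) (subst (λ z → (z == u) ≡ false) e (not-true (f∈ i))))
    ... | g , gcl , _ = bound (suc k) (g , gcl)
    -- The parameter `w` is split through an equation; it is not zero because `u` alone is a clique.
    go : ∀ w' → w ≡ w' → Goal
    go zero e = case subst (1 ≤_) e (ext 0 ((λ ()) , (λ ()) , (λ { {()} }) , λ ())) of λ ()
    go (suc w') refl = peel 1 w' (_== u) u (==-refl u) ((λ _ → 0) , (λ _ _ → s≤s z≤n) ,
      λ { a b a≡u b≡u a~b _ → ~⇒≢ a~b (trans (==⇒≡ a≡u) (sym (==⇒≡ b≡u))) })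
      (λ k q → ≤-pred (ext k q)) (half3-1 w')

  -- Permuting the colours of the second colouring one clique vertex at a time makes the two agree on X.
  align : ∀ {k} (X P Q : V → Bool) → (∀ v → X v ≡ true → P v ≡ true) → (∀ v → X v ≡ true → Q v ≡ true) →
    (∀ u v → X u ≡ true → X v ≡ true → u ≢ v → u ~ v ≡ true) → (c : PColor P k) → PColor Q k →
    ∀ t → Σ (PColor Q k) λ d → ∀ v → toℕ v < t → X v ≡ true → proj₁ d v ≡ proj₁ c v
  align X P Q X⊆P X⊆Q X-clique c d₀ zero = d₀ , λ _ ()
  align {k} X P Q X⊆P X⊆Q X-clique c@(cf , cf< , cf-proper) d₀ (suc t)
    with align X P Q X⊆P X⊆Q X-clique c d₀ t | any? (λ v → (toℕ v ℕₚ.≟ t) ×-dec (X v 𝔹.≟ true))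
  ... | d , agree | no ¬v = d , λ v v<st v∈X → case ℕₚ.m≤n⇒m<n∨m≡n (≤-pred v<st) of λ
    { (inj₁ v<t) → agree v v<t v∈X ; (inj₂ v≡t) → ⊥-elim (¬v (v , v≡t , v∈X)) }
  ... | (df , df< , df-proper) , agree | yes (x , x≡t , x∈X) =
    (σ ∘ df , (λ v v∈Q → swap-< (df< x (X⊆Q x x∈X)) (cf< x (X⊆P x x∈X)) (df< v v∈Q)) ,
      λ u v u∈Q v∈Q u~v e → df-proper u v u∈Q v∈Q u~v
        (trans (sym (swap-involutive (df x) (cf x) (df u))) (trans (cong σ e) (swap-involutive (df x) (cf x) (df v))))) ,
    agree′
    where
    σ = swap (df x) (cf x)
    agree′ : ∀ v → toℕ v < suc t → X v ≡ true → σ (df v) ≡ cf v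
    agree′ v v<st v∈X with ℕₚ.m≤n⇒m<n∨m≡n (≤-pred v<st)
    ... | inj₂ v≡t rewrite toℕ-injective {i = v} {j = x} (trans v≡t (sym x≡t)) = swap-left (df x) (cf x)
    -- A vertex aligned earlier is adjacent to `x` and has the same colour in both colourings, so
    -- its colour is neither of the two being exchanged.
    ... | inj₁ v<t = trans (swap-other (df-proper v x (X⊆Q v v∈X) (X⊆Q x x∈X) v~x)
        (subst (_≢ cf x) (sym (agree v v<t v∈X)) (cf-proper v x (X⊆P v v∈X) (X⊆P x x∈X) v~x))) (agree v v<t v∈X)
      where
      v~x : v ~ x ≡ true
      v~x = X-clique v x v∈X x∈X λ { refl → <-irrefl x≡t v<t }

  -- The union of `D` and `X` misses `q` and the complement of `D` misses `d`, so both have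
  -- `m`-colourings. Aligned on their intersection `X`, these glue, since every edge leaving `D`
  -- ends in `X`.
  clique-cutset : (D X : V → Bool) → (∀ u v → X u ≡ true → X v ≡ true → u ≢ v → u ~ v ≡ true) →
    (∀ u v → D u ≡ true → D v ≡ false → X v ≡ false → u ~ v ≡ true → ⊥) → (∀ v → X v ≡ true → D v ≡ false) →
    ∀ d → D d ≡ true → ∀ q → D q ≡ false → X q ≡ false → Goal
  clique-cutset D X X-clique D-sep X∩D d d∈D q q∉D q∉X =
    go c (align X P Q X⊆P X⊆Q X-clique c (pcol Q d (cong not d∈D) w λ { k (f , _ , cl) → bound k (f , cl) }) n)
    where
    P Q : V → Bool
    P v = D v ∨ X v
    Q v = not (D v)
    c : PColor P m
    c = pcol P q (subst₂ (λ a b → a ∨ b ≡ false) (sym q∉D) (sym q∉X) refl) w λ { k (f , _ , cl) → bound k (f , cl) }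
    X⊆P : ∀ v → X v ≡ true → P v ≡ true
    X⊆P v = ∨-introʳ (D v)
    X⊆Q : ∀ v → X v ≡ true → Q v ≡ true
    X⊆Q v v∈X = cong not (X∩D v v∈X)
    go : (c : PColor P m) → (Σ (PColor Q m) λ d → ∀ v → toℕ v < n → X v ≡ true → proj₁ d v ≡ proj₁ c v) → Goal
    go (cf , cf<m , cf-proper) ((df , df<m , df-proper) , agree) = e , e<m , e-proper
      where
      e : V → ℕ
      e v = if D v then cf v else df v
      e<m : ∀ v → true ≡ true → e v < m
      e<m v _ with D v in eq
      ... | true = cf<m v (cong (_∨ X v) eq)
      ... | false = df<m v (cong not eq)
      cross : ∀ u v → D u ≡ true → D v ≡ false → u ~ v ≡ true → cf u ≢ df v
      cross u v u∈D v∉D u~v eq with bool? (X v)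
      ... | inj₂ v∉X = D-sep u v u∈D v∉D v∉X u~v
      ... | inj₁ v∈X = cf-proper u v (cong (_∨ X u) u∈D) (X⊆P v v∈X) u~v
        (trans eq (agree v (toℕ<n v) v∈X))
      e-proper : ∀ u v → true ≡ true → true ≡ true → u ~ v ≡ true → e u ≢ e v
      e-proper u v _ _ u~v with D u in equ | D v in eqv
      ... | true | true = cf-proper u v (cong (_∨ X u) equ) (cong (_∨ X v) eqv) u~v
      ... | true | false = cross u v equ eqv u~v
      ... | false | true = cross v u eqv equ (~-sym u~v) ∘ sym
      ... | false | false = df-proper u v (cong not equ) (cong not eqv) u~v

-- Labelled graphs

-- The adjacencies of a vertex to the earlier vertices 0, 1, 2, …; a row may stop early, leaving the rest undecided.
Row : Set
Row = List Bool

-- The rows of all vertices, the newest vertex first; a vertex is named by the number of older ones.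
Pat : Set
Pat = List Row

WF : Pat → Set
WF []      = ⊤
WF (r ∷ p) = (length r ≤ length p) × WF p

infixl 9 _!_
_!_ : ∀ {A : Set} → List A → ℕ → Maybe A
[]       ! _     = nothing
(a ∷ as) ! zero  = just a
(a ∷ as) ! suc i = as ! i

-- The first argument is meant to be the number of rows, hence one more than the name of the newest
-- vertex. The diagonal of a well-formed pattern is then undecided.
lookupᴷ : ℕ → Pat → ℕ → ℕ → Maybe Bool
lookupᴷ (suc k) (r ∷ p) i j = if i ≡ᵇ k then r ! j else if j ≡ᵇ k then r ! i else lookupᴷ k p i j
lookupᴷ _ _ _ _ = nothing

is : Bool → Maybe Bool → Bool
is true  (just true)  = true
is false (just false) = true
is _     _            = false

same : Maybe Bool → Maybe Bool → Bool
same (just a) b = is a b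
same nothing  _ = false

allBelow : ℕ → (ℕ → Bool) → Bool
allBelow zero    f = true
allBelow (suc k) f = f k ∧ allBelow k f

-- A map of vertices is packed into one numeral, the image of vertex 0 being its last hexadecimal
-- digit.
digit : ℕ → ℕ → ℕ
digit s zero    = s % 16
digit s (suc i) = digit (s / 16) i

embedsRow : (ℕ → ℕ → Maybe Bool) → (ℕ → ℕ) → ℕ → ℕ → Row → Bool
embedsRow K σ a j []      = true
embedsRow K σ a j (b ∷ r) = is b (K a (σ j)) ∧ embedsRow K σ a (suc j) r

-- Distinctness of images comes with the adjacencies: a decided entry is interpreted by `Rel`, which
-- includes it.
embeds : (ℕ → ℕ → Maybe Bool) → (ℕ → ℕ) → Pat → Bool
embeds K σ []      = true
embeds K σ (r ∷ F) = embedsRow K σ (σ (length F)) 0 r ∧ embeds K σ F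

-- A derivation tree deciding one by one the adjacencies of the newest vertex to the older ones.
-- emb f s: vertex i of the f-th excluded graph is sent to the i-th hexadecimal digit of s.
-- or t u: the next adjacency is absent (t) or present (u).
-- end: the adjacencies found so far are admissible.
-- nope: they contradict the adjacencies with which the vertex was introduced.
-- ext q x y t: x could replace the base vertex q, and y tells them apart, so extremality of the base yields a new
-- vertex that tells them apart the other way round.
data Prf : Set where
  emb      : ℕ → ℕ → Prf
  or       : Prf → Prf → Prf
  end nope : Prf
  ext      : ℕ → ℕ → ℕ → Prf → Prf

-- Running derivation trees

module Checker (Γ : List Pat) (B : Pat) (mode : Maybe Bool) where

  hit : Maybe Pat → (ℕ → ℕ → Maybe Bool) → (ℕ → ℕ) → Bool
  hit nothing  _ _ = false
  hit (just F) K σ = embeds K σ F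

  -- Mode `just true` stands for a copy of the base with least degree sum, `just false` for one with
  -- greatest. In the resulting pair (s , t), the closed neighbourhood of t is at most as large as
  -- that of s.
  orient : Bool → ℕ → ℕ → ℕ × ℕ
  orient true  q x = x , q
  orient false q x = q , x

  extOK : ℕ → (ℕ → ℕ → Maybe Bool) → ℕ → ℕ → ℕ → ℕ × ℕ → Bool
  extOK k K q x y (s , t) =
    (q <ᵇ length B) ∧ is true (K x q) ∧ allBelow (length B) (λ i → (i ≡ᵇ q) ∨ same (K x i) (K q i)) ∧
    is true (K y t) ∧ is false (K y s) ∧
    -- No vertex known so far can be adjacent to s and lie outside the closed neighbourhood of t, so
    -- the vertex supplied by extremality is new.
    allBelow k (λ j → (j ≡ᵇ s) ∨ (j ≡ᵇ t) ∨ is false (K s j) ∨ is true (K t j))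

  guard : ∀ {A : Set} → Bool → Maybe A → Maybe A
  guard true  a = a
  guard false _ = nothing

  join : Maybe (List Row) → Maybe (List Row) → Maybe (List Row)
  join (just a) (just b) = just (a ++ b)
  join _        _        = nothing

  none : Maybe (List Row) → Maybe (List Row)
  none (just []) = just []
  none _         = nothing

  refuted : Maybe (ℕ × ℕ) → Row → Bool
  refuted nothing        row = false
  refuted (just (s , t)) row = is false (row ! s) ∨ is true (row ! t)

  -- The result is the list of rows the tree leaves open, or `nothing` if some leaf is unjustified.
  -- The first argument holds the pair (s , t) for a vertex introduced by extremality, known to see
  -- s and miss t.
  ends : Maybe (ℕ × ℕ) → Pat → Row → Prf → Maybe (List Row)
  endsExt : Maybe Bool → Pat → ℕ → ℕ → ℕ → Prf → Maybe (List Row)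
  ends fc p row (emb f s)     = guard (hit (Γ ! f) (lookupᴷ (suc (length p)) (row ∷ p)) (digit s)) (just [])
  ends fc p row (or t₀ t₁)    =
    guard (length row <ᵇ length p) (join (ends fc p (row ∷ʳ false) t₀) (ends fc p (row ∷ʳ true) t₁))
  ends fc p row end           = just (row ∷ [])
  ends fc p row nope          = guard (refuted fc row) (just [])
  ends fc p row (ext q x y t) = guard (length row ≡ᵇ length p) (endsExt mode (row ∷ p) q x y t)
  endsExt nothing  p q x y t = nothing
  endsExt (just μ) p q x y t =
    -- By `none`, every row of the new vertex must be refuted; an extremality step closes a branch
    -- and never leaves rows open.
    guard (extOK (length p) (lookupᴷ (length p) p) q x y (orient μ q x)) (none (ends (just (orient μ q x)) p [] t))

<ᵇ⇒< : ∀ {i k} → (i <ᵇ k) ≡ true → i < k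
<ᵇ⇒< {i} {k} e = ℕₚ.<ᵇ⇒< i k (≡true⇒T e)

≡ᵇ⇒≡ : ∀ {i k} → (i ≡ᵇ k) ≡ true → i ≡ k
≡ᵇ⇒≡ {i} {k} e = ℕₚ.≡ᵇ⇒≡ i k (≡true⇒T e)

≡ᵇ-refl : ∀ i → (i ≡ᵇ i) ≡ true
≡ᵇ-refl i = T⇒≡true (ℕₚ.≡⇒≡ᵇ i i refl)

<⇒≢ᵇ : ∀ {i k} → i < k → (i ≡ᵇ k) ≡ false
<⇒≢ᵇ {i} {k} i<k with i ≡ᵇ k in eq
... | false = refl
... | true = ⊥-elim (ℕₚ.<⇒≢ i<k (≡ᵇ⇒≡ eq))

allBelow-sound : ∀ {k f} → allBelow k f ≡ true → ∀ i → i < k → f i ≡ true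
allBelow-sound {suc k} {f} e i i<sk with ∧-true (f k) e | ℕₚ.m≤n⇒m<n∨m≡n (≤-pred i<sk)
... | fk , rest | inj₁ i<k = allBelow-sound rest i i<k
... | fk , rest | inj₂ refl = fk

is-sound : ∀ {b o} → is b o ≡ true → o ≡ just b
is-sound {true}  {just true}  _ = refl
is-sound {false} {just false} _ = refl

same-sound : ∀ {o o′} → same o o′ ≡ true → Σ Bool λ b → (o ≡ just b) × (o′ ≡ just b)
same-sound {just a} e = a , refl , is-sound e

!-< : ∀ {A : Set} (as : List A) {i a} → as ! i ≡ just a → i < length as
!-< (a ∷ as) {zero}  _ = s≤s z≤n
!-< (a ∷ as) {suc i} e = s≤s (!-< as e)

length-∷ʳ : ∀ {A : Set} (as : List A) a → length (as ∷ʳ a) ≡ suc (length as)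
length-∷ʳ as a = trans (length-++ as) (ℕₚ.+-comm (length as) 1)

-- Copies of labelled graphs, and soundness of derivation trees

module Realisation {n : ℕ} (G : Graph n) (Goal : Set) where

  open Notation G

  -- Distinctness is included because a vertex is non-adjacent to itself; non-adjacency alone would
  -- allow a copy to collapse.
  record Rel (b : Bool) (x y : V) : Set where
    constructor _,_
    field
      rel-≢ : x ≢ y
      rel-~ : x ~ y ≡ b
  open Rel public

  Rel-sym : ∀ {b x y} → Rel b x y → Rel b y x
  Rel-sym (x≢y , e) = x≢y ∘ sym , ~-sym e

  Fits : (ℕ → V) → ℕ → Row → V → Set
  Fits ρ j []      x = ⊤
  Fits ρ j (b ∷ r) x = Rel b x (ρ j) × Fits ρ (suc j) r x

  -- The assignment is total, and only its values below `length p` matter, so a copy grows by `upd`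
  -- without a change of type.
  Real : Pat → (ℕ → V) → Set
  Real []      ρ = ⊤
  Real (r ∷ p) ρ = (length r ≤ length p) × Fits ρ 0 r (ρ (length p)) × Real p ρ

  Impossible : Pat → Set
  Impossible F = ∀ ρ → Real F ρ → Goal

  Fits-! : ∀ {ρ j r x i b} → Fits ρ j r x → r ! i ≡ just b → Rel b x (ρ (i + j))
  Fits-! {r = b ∷ r} {i = zero}  (f , _)  refl = f
  Fits-! {ρ} {j} {_ ∷ r} {x} {suc i} {b} (_ , fs) e =
    subst (λ z → Rel b x (ρ z)) (ℕₚ.+-suc i j) (Fits-! {r = r} fs e)

  Fits-!₀ : ∀ {ρ r x i b} → Fits ρ 0 r x → r ! i ≡ just b → Rel b x (ρ i)
  Fits-!₀ {ρ} {r} {x} {i} {b} fs e = subst (λ z → Rel b x (ρ z)) (ℕₚ.+-identityʳ i) (Fits-! {r = r} fs e)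

  Fits-cong : ∀ {ρ ρ′ j r x} → (∀ i → i < j + length r → ρ i ≡ ρ′ i) → Fits ρ j r x → Fits ρ′ j r x
  Fits-cong {r = []} _ _ = tt
  Fits-cong {ρ} {ρ′} {j} {b ∷ r} {x} eq (f , fs) =
    subst (Rel b x) (eq j (ℕₚ.m<m+n j (s≤s z≤n))) f ,
    Fits-cong {r = r} (λ i i< → eq i (subst (i <_) (sym (ℕₚ.+-suc j (length r))) i<)) fs

  Fits-∷ʳ : ∀ {ρ j x b} r → Fits ρ j r x → Rel b x (ρ (length r + j)) → Fits ρ j (r ∷ʳ b) x
  Fits-∷ʳ [] _ f = f , tt
  Fits-∷ʳ {ρ} {j} {x} {b} (_ ∷ r) (g , fs) f =
    g , Fits-∷ʳ r fs (subst (λ z → Rel b x (ρ z)) (sym (ℕₚ.+-suc (length r) j)) f)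

  Real-cong : ∀ {ρ ρ′} p → (∀ i → i < length p → ρ i ≡ ρ′ i) → Real p ρ → Real p ρ′
  Real-cong [] _ _ = tt
  Real-cong {ρ} {ρ′} (r ∷ p) eq (len , fs , rl) = len ,
    subst (Fits ρ′ 0 r) (eq (length p) ≤-refl)
      (Fits-cong {r = r} (λ i i< → eq i (≤-trans i< (≤-trans len (n≤1+n _)))) fs) ,
    Real-cong p (λ i i< → eq i (≤-trans i< (n≤1+n _))) rl

  lookupᴷ-sound : ∀ {ρ} p {k i j b} → k ≡ length p → Real p ρ → lookupᴷ k p i j ≡ just b → Rel b (ρ i) (ρ j)
  lookupᴷ-sound [] {suc k} _ _ ()
  lookupᴷ-sound [] {zero} _ _ ()
  lookupᴷ-sound {ρ} (r ∷ p) {suc k} {i} {j} k≡ (_ , fs , rl) e with i ≡ᵇ k in eqi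
  ... | true = subst (λ z → Rel _ (ρ z) (ρ j)) (sym (trans (≡ᵇ⇒≡ {i} eqi) (ℕₚ.suc-injective k≡))) (Fits-!₀ {r = r} fs e)
  ... | false with j ≡ᵇ k in eqj
  ...   | true = Rel-sym (subst (λ z → Rel _ (ρ z) (ρ i)) (sym (trans (≡ᵇ⇒≡ {j} eqj) (ℕₚ.suc-injective k≡))) (Fits-!₀ {r = r} fs e))
  ...   | false = lookupᴷ-sound p (ℕₚ.suc-injective k≡) rl e

  embedsRow-sound : ∀ {ρ K σ a} j r → (∀ {i l b} → K i l ≡ just b → Rel b (ρ i) (ρ l)) →
    embedsRow K σ a j r ≡ true → Fits (ρ ∘ σ) j r (ρ a)
  embedsRow-sound j [] _ _ = tt
  embedsRow-sound {K = K} {σ} {a} j (b ∷ r) K-sound e with ∧-true (is b (K a (σ j))) e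
  ... | e₁ , e₂ = K-sound (is-sound e₁) , embedsRow-sound (suc j) r K-sound e₂

  embeds-sound : ∀ {ρ K σ} F → WF F → (∀ {i l b} → K i l ≡ just b → Rel b (ρ i) (ρ l)) →
    embeds K σ F ≡ true → Real F (ρ ∘ σ)
  embeds-sound [] _ _ _ = tt
  embeds-sound {K = K} {σ} (r ∷ F) (len , wf) K-sound e with ∧-true (embedsRow K σ (σ (length F)) 0 r) e
  ... | e₁ , e₂ = len , embedsRow-sound 0 r K-sound e₁ , embeds-sound F wf K-sound e₂

  upd : (ℕ → V) → ℕ → V → ℕ → V
  upd ρ k x i = if i ≡ᵇ k then x else ρ i

  upd-here : ∀ ρ k x → upd ρ k x k ≡ x
  upd-here ρ k x rewrite ≡ᵇ-refl k = refl

  upd-below : ∀ ρ x {k i} → i < k → ρ i ≡ upd ρ k x i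
  upd-below ρ x i<k rewrite <⇒≢ᵇ i<k = refl

  extend : ∀ {ρ p r x} → Real p ρ → length r ≤ length p → Fits ρ 0 r x → Real (r ∷ p) (upd ρ (length p) x)
  extend {ρ} {p} {r} {x} rl len fs = len ,
    subst (Fits _ 0 r) (sym (upd-here ρ (length p) x)) (Fits-cong {r = r} (λ i i< → upd-below ρ x (≤-trans i< len)) fs) ,
    Real-cong p (λ i → upd-below ρ x) rl

  Fresh : ℕ → (ℕ → V) → V → Set
  Fresh k ρ x = ∀ i → i < k → x ≢ ρ i

  fresh? : ∀ k ρ x → (Σ ℕ λ i → (i < k) × (x ≡ ρ i)) ⊎ Fresh k ρ x
  fresh? zero ρ x = inj₂ λ _ ()
  fresh? (suc k) ρ x with x ≟ ρ k | fresh? k ρ x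
  ... | yes e | _ = inj₁ (k , ≤-refl , e)
  ... | no _ | inj₁ (i , i<k , e) = inj₁ (i , ≤-trans i<k (n≤1+n _) , e)
  ... | no x≢ | inj₂ fr = inj₂ λ i i<sk e → case ℕₚ.m≤n⇒m<n∨m≡n (≤-pred i<sk) of λ
    { (inj₁ i<k) → fr i i<k e ; (inj₂ refl) → x≢ e }

  Excluded : Pat → Set
  Excluded F = WF F × Impossible F

  module Sound (Γ : List Pat) (Γ-excl : All Excluded Γ) (B : Pat) (mode : Maybe Bool) (ρ₀ : ℕ → V) where

    open Checker Γ B mode

    low high : Bool → V → V → V
    low  true  p x = x
    low  false p x = p
    high true  p x = p
    high false p x = x

    -- What extremality of the copy offers to a tree. It is stated with a continuation because
    -- either the vertex `z` exists or a better copy has already led to `Goal`. For an arbitrary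
    -- copy it is trivial, so one soundness proof serves all modes.
    Oracle : Maybe Bool → Set
    Oracle nothing  = ⊤
    Oracle (just μ) = ∀ q x y → q < length B → (∀ i → i < length B → i ≢ q → Σ Bool λ b → Rel b x (ρ₀ i) × Rel b (ρ₀ q) (ρ₀ i)) →
      x ~ ρ₀ q ≡ true → y ~ high μ (ρ₀ q) x ≡ true → y ~ low μ (ρ₀ q) x ≡ false → y ≢ low μ (ρ₀ q) x →
      (∀ z → z ~ low μ (ρ₀ q) x ≡ true → z ~ high μ (ρ₀ q) x ≡ false → z ≢ high μ (ρ₀ q) x → Goal) → Goal

    Forced : Maybe (ℕ × ℕ) → (ℕ → V) → V → Set
    Forced nothing        ρ x = ⊤
    Forced (just (s , t)) ρ x = (x ~ ρ s ≡ true) × (x ~ ρ t ≡ false)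

    guard-sound : ∀ {A : Set} {b} {o : Maybe A} {a} → guard b o ≡ just a → (b ≡ true) × (o ≡ just a)
    guard-sound {b = true} e = refl , e

    join-sound : ∀ {o o′ E} → join o o′ ≡ just E → Σ (List Row) λ a → Σ (List Row) λ b → (o ≡ just a) × (o′ ≡ just b) × (E ≡ a ++ b)
    join-sound {just a} {just b} refl = a , b , refl , refl , refl

    none-sound : ∀ {o E} → none o ≡ just E → o ≡ just []
    none-sound {just []} refl = refl

    hit-sound : ∀ ρ {K σ} Δ f → All Excluded Δ → (∀ {i l b} → K i l ≡ just b → Rel b (ρ i) (ρ l)) →
      hit (Δ ! f) K σ ≡ true → Goal
    hit-sound ρ (F ∷ Δ) zero ((wf , bad) ∷ _) K-sound e = bad _ (embeds-sound {ρ} F wf K-sound e)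
    hit-sound ρ (F ∷ Δ) (suc f) (_ ∷ Δ-excl) K-sound e = hit-sound ρ Δ f Δ-excl K-sound e

    low-orient : ∀ μ (ρ : ℕ → V) {q x : ℕ} → ρ q ≡ ρ₀ q → low μ (ρ₀ q) (ρ x) ≡ ρ (proj₁ (orient μ q x))
    low-orient true  ρ e = refl
    low-orient false ρ e = sym e

    high-orient : ∀ μ (ρ : ℕ → V) {q x : ℕ} → ρ q ≡ ρ₀ q → high μ (ρ₀ q) (ρ x) ≡ ρ (proj₂ (orient μ q x))
    high-orient true  ρ e = sym e
    high-orient false ρ e = refl

    Agree : (ℕ → V) → Set
    Agree ρ = ∀ i → i < length B → ρ i ≡ ρ₀ i

    -- Induction along the tree, following the actual adjacencies of `x`: either a leaf yields
    -- `Goal`, or the branch ends in a row of `E` that `x` fits.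
    ends-sound : ∀ {fc ρ row E} p t → ends fc p row t ≡ just E → Oracle mode → length B ≤ length p → Agree ρ →
      Real p ρ → ∀ x → Fresh (length p) ρ x → Forced fc ρ x → length row ≤ length p → Fits ρ 0 row x →
      (∀ e → e ∈ E → Fits ρ 0 e x → Goal) → Goal
    endsExt-sound : ∀ {ρ E} μ p q x y t → endsExt μ p q x y t ≡ just E → Oracle μ → Oracle mode → length B ≤ length p → Agree ρ →
      Real p ρ → Goal
    ends-sound {ρ = ρ} {row} p (emb f s) eq O _ _ rl x fr fc len fs k with guard-sound eq
    ... | h , _ = hit-sound (upd ρ (length p) x) Γ f Γ-excl (λ {i} {l} → lookupᴷ-sound (row ∷ p) {i = i} {l} refl (extend {r = row} rl len fs)) h
    ends-sound {ρ = ρ} {row} p (or t₀ t₁) eq O B≤p ag rl x fr fc len fs k with guard-sound {b = length row <ᵇ length p} eq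
    ... | lt , eq′ with join-sound {ends _ p (row ∷ʳ false) t₀} eq′
    ...   | a , c , eqa , eqc , refl = step (bool? (x ~ ρ (length row)))
      where
      row<p : length row < length p
      row<p = <ᵇ⇒< lt
      x≢ : x ≢ ρ (length row)
      x≢ = fr (length row) row<p
      len′ : ∀ b → length (row ∷ʳ b) ≤ length p
      len′ b = subst (_≤ length p) (sym (length-∷ʳ row b)) row<p
      fs′ : ∀ b → x ~ ρ (length row) ≡ b → Fits ρ 0 (row ∷ʳ b) x
      fs′ b e = Fits-∷ʳ row fs (subst (λ z → Rel b x (ρ z)) (sym (ℕₚ.+-identityʳ (length row))) (x≢ , e))
      step : (x ~ ρ (length row) ≡ true) ⊎ (x ~ ρ (length row) ≡ false) → Goal
      step (inj₂ e) = ends-sound p t₀ eqa O B≤p ag rl x fr fc (len′ false) (fs′ false e) λ e′ e′∈ → k e′ (∈-++⁺ˡ e′∈)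
      step (inj₁ e) = ends-sound p t₁ eqc O B≤p ag rl x fr fc (len′ true) (fs′ true e) λ e′ e′∈ → k e′ (∈-++⁺ʳ a e′∈)
    ends-sound {row = row} p end refl O _ _ rl x fr fc len fs k = k row (here refl) fs
    ends-sound {nothing} p nope ()
    ends-sound {just (s , t)} {row = row} p nope eq O _ _ rl x fr (x~s , x≁t) len fs k
      with ∨-true (is false (row ! s)) (proj₁ (guard-sound {b = refuted (just (s , t)) row} eq))
    ... | inj₁ e = true≢false x~s (rel-~ (Fits-!₀ {r = row} fs (is-sound e)))
    ... | inj₂ e = true≢false (rel-~ (Fits-!₀ {r = row} fs (is-sound e))) x≁t
    ends-sound {ρ = ρ} {row} p (ext q x′ y t) eq O B≤p ag rl x fr fc len fs k =
      endsExt-sound mode (row ∷ p) q x′ y t (proj₂ (guard-sound {b = length row ≡ᵇ length p} eq)) O O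
        (≤-trans B≤p (n≤1+n _)) (λ i i<B → trans (sym (upd-below ρ x (≤-trans i<B B≤p))) (ag i i<B)) (extend {r = row} rl len fs)
    endsExt-sound {ρ} {E} (just μ) p q x y t eq O O′ B≤p ag rl
      with guard-sound {b = extOK (length p) (lookupᴷ (length p) p) q x y (orient μ q x)} eq
    ... | ok , eq′ = go (∧-true (q <ᵇ length B) ok)
      where
      K : ℕ → ℕ → Maybe Bool
      K = lookupᴷ (length p) p
      K-sound : ∀ {i j b} → K i j ≡ just b → Rel b (ρ i) (ρ j)
      K-sound {i} {j} = lookupᴷ-sound p {i = i} {j} refl rl
      s t′ : ℕ
      s = proj₁ (orient μ q x)
      t′ = proj₂ (orient μ q x)
      low-eq : q < length B → low μ (ρ₀ q) (ρ x) ≡ ρ s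
      low-eq q<B = low-orient μ ρ (ag q q<B)
      high-eq : q < length B → high μ (ρ₀ q) (ρ x) ≡ ρ t′
      high-eq q<B = high-orient μ ρ (ag q q<B)
      go : (q <ᵇ length B) ≡ true × _ → Goal
      go (q<ᵇB , ok₁) with ∧-true (is true (K x q)) ok₁
      ... | x~q , ok₂ with ∧-true (allBelow (length B) (λ i → (i ≡ᵇ q) ∨ same (K x i) (K q i))) ok₂
      ... | twin , ok₃ with ∧-true (is true (K y t′)) ok₃
      ... | y~t , ok₄ with ∧-true (is false (K y s)) ok₄
      ... | y≁s , ok₅ =
        O q (ρ x) (ρ y) q<B
          (λ i i<B i≢q → case ∨-true (i ≡ᵇ q) (allBelow-sound twin i i<B) of λ
            { (inj₁ e) → ⊥-elim (i≢q (≡ᵇ⇒≡ e))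
            ; (inj₂ e) → let b , e₁ , e₂ = same-sound e in
                b , subst (Rel b (ρ x)) (ag i i<B) (K-sound e₁) , subst₂ (Rel b) (ag q q<B) (ag i i<B) (K-sound e₂) })
          (subst (λ z → ρ x ~ z ≡ true) (ag q q<B) (rel-~ (K-sound (is-sound x~q))))
          (subst (λ z → ρ y ~ z ≡ true) (sym (high-eq q<B)) (rel-~ (K-sound (is-sound y~t))))
          (subst (λ z → ρ y ~ z ≡ false) (sym (low-eq q<B)) (rel-~ (K-sound (is-sound y≁s))))
          (subst (ρ y ≢_) (sym (low-eq q<B)) (rel-≢ (K-sound (is-sound y≁s))))
          λ z z~s z≁t z≢t → new z (subst (λ u → z ~ u ≡ true) (low-eq q<B) z~s)
            (subst (λ u → z ~ u ≡ false) (high-eq q<B) z≁t) (subst (z ≢_) (high-eq q<B) z≢t)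
        where
        q<B : q < length B
        q<B = <ᵇ⇒< q<ᵇB
        new : ∀ z → z ~ ρ s ≡ true → z ~ ρ t′ ≡ false → z ≢ ρ t′ → Goal
        new z z~s z≁t z≢t = ends-sound p t (none-sound eq′) O′ B≤p ag rl z fr (z~s , z≁t) z≤n tt λ _ ()
          where
          fr : Fresh (length p) ρ z
          fr j j<p refl with ∨-true (j ≡ᵇ s) (allBelow-sound ok₅ j j<p)
          ... | inj₁ e = ~⇒≢ z~s (cong ρ (≡ᵇ⇒≡ e))
          ... | inj₂ e₁ with ∨-true (j ≡ᵇ t′) e₁
          ...   | inj₁ e = z≢t (cong ρ (≡ᵇ⇒≡ {j} e))
          ...   | inj₂ e₂ with ∨-true (is false (K s j)) e₂
          ...     | inj₁ e = true≢false z~s (~-sym (rel-~ (K-sound (is-sound e))))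
          ...     | inj₂ e = true≢false (~-sym (rel-~ (K-sound (is-sound e)))) z≁t

-- Boolean checks of complete certificates

does-true : ∀ {A : Set} (d : Dec A) → does d ≡ true → A
does-true (yes a) _ = a

every : ∀ {A : Set} → (A → Bool) → List A → Bool
every f []       = true
every f (a ∷ as) = f a ∧ every f as

every-sound : ∀ {A : Set} {f : A → Bool} {as a} → every f as ≡ true → a ∈ as → f a ≡ true
every-sound {f = f} {a ∷ as} e (here refl) = proj₁ (∧-true (f a) e)
every-sound {f = f} {a ∷ as} e (there a∈)  = every-sound (proj₂ (∧-true (f a) e)) a∈

member : ℕ → List ℕ → Bool
member i []       = false
member i (j ∷ js) = (i ≡ᵇ j) ∨ member i js

member-sound : ∀ {i} js → member i js ≡ true → i ∈ js
member-sound {i} (j ∷ js) e with ∨-true (i ≡ᵇ j) e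
... | inj₁ e′ = here (≡ᵇ⇒≡ e′)
... | inj₂ e′ = there (member-sound js e′)

eqRow : Row → Row → Bool
eqRow []          []          = true
eqRow (true ∷ r)  (true ∷ s)  = eqRow r s
eqRow (false ∷ r) (false ∷ s) = eqRow r s
eqRow _           _           = false

eqRow-sound : ∀ r s → eqRow r s ≡ true → r ≡ s
eqRow-sound []          []          _ = refl
eqRow-sound (true ∷ r)  (true ∷ s)  e = cong (true ∷_) (eqRow-sound r s e)
eqRow-sound (false ∷ r) (false ∷ s) e = cong (false ∷_) (eqRow-sound r s e)

memberRow : Row → List Row → Bool
memberRow e []       = false
memberRow e (r ∷ rs) = eqRow e r ∨ memberRow e rs

memberRow-sound : ∀ {e} rs → memberRow e rs ≡ true → e ∈ rs
memberRow-sound {e} (r ∷ rs) q with ∨-true (eqRow e r) q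
... | inj₁ q′ = here (eqRow-sound e r q′)
... | inj₂ q′ = there (memberRow-sound rs q′)

consMaybe : Maybe Row → List Row → List Row
consMaybe (just r) rs = r ∷ rs
consMaybe nothing  rs = rs

pick : List Row → List ℕ → List Row
pick E []       = []
pick E (k ∷ ks) = consMaybe (E ! k) (pick E ks)

sift : (Row → Bool) → List Row → List Row
sift f []       = []
sift f (r ∷ rs) = if f r then r ∷ sift f rs else sift f rs

sift-∈ : ∀ {f e} rs → e ∈ rs → f e ≡ true → e ∈ sift f rs
sift-∈ (r ∷ rs) (here refl) fe rewrite fe = here refl
sift-∈ {f} (r ∷ rs) (there e∈) fe with f r
... | true  = there (sift-∈ rs e∈ fe)
... | false = sift-∈ rs e∈ fe

zipId : List Row → List ℕ → List (Row × ℕ)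
zipId []      _        = []
zipId (e ∷ E) []       = (e , 0) ∷ zipId E []
zipId (e ∷ E) (i ∷ is) = (e , i) ∷ zipId E is

zipId-∈ : ∀ {e} E is → e ∈ E → Σ ℕ λ i → (e , i) ∈ zipId E is
zipId-∈ (e ∷ E) []       (here refl) = 0 , here refl
zipId-∈ (e ∷ E) (i ∷ is) (here refl) = i , here refl
zipId-∈ (e ∷ E) []       (there e∈)  = let j , j∈ = zipId-∈ E [] e∈ in j , there j∈
zipId-∈ (e ∷ E) (i ∷ is) (there e∈)  = let j , j∈ = zipId-∈ E is e∈ in j , there j∈

isNone : Maybe (List Row) → Bool
isNone (just []) = true
isNone _         = false

isNone-sound : ∀ {o} → isNone o ≡ true → o ≡ just []
isNone-sound {just []} _ = refl

-- The added vertex becomes vertex 0 and all names move up by one. Path vertices added this way head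
-- every later row, so a tree can start with their adjacencies fixed, and `drop` recovers the row
-- over the old vertices.
oldest : Row → Pat → Pat
oldest r []      = [] ∷ []
oldest r (s ∷ p) = (is true (r ! length p) ∷ s) ∷ oldest r p

-- Base vertices, then positions in the list of open rows, then a triangular table refuting
-- non-adjacency for any two of these rows, each row with itself included.
data Clique : Set where
  clique : List ℕ → List ℕ → List (List Prf) → Clique

rowsOf : List Row → Clique → List Row
rowsOf E (clique _ rs _) = pick E rs

basesOf : Clique → List ℕ
basesOf (clique bs _ _) = bs

-- An undecided adjacency counts as present; this also covers the vertices 0 and 1 themselves.
needs : (ℕ → Maybe Bool) → ℕ
needs f = bit (not (is false (f 0))) + bit (not (is false (f 1)))

module Checks (Γ : List Pat) (B : Pat) (mode : Maybe Bool) where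

  open Checker Γ B mode public

  b : ℕ
  b = length B

  K : ℕ → ℕ → Maybe Bool
  K = lookupᴷ b B

  -- The first vertex joins the pattern; the second then starts with the row `e′` extended by its
  -- adjacency to the first, and the tree must leave nothing open.
  pairPrf : Pat → Bool → Row → Row → Prf → Bool
  pairPrf p β e e′ t = (length e ≡ᵇ length p) ∧ (length e′ ≡ᵇ length p) ∧ isNone (ends nothing (e ∷ p) (e′ ∷ʳ β) t)

  rowPairs : Pat → Bool → Row → List Row → List Prf → Bool
  rowPairs p β e []        []       = true
  rowPairs p β e (e′ ∷ es) (t ∷ ts) = pairPrf p β e e′ t ∧ rowPairs p β e es ts
  rowPairs p β e _         _        = false

  triangle : Pat → Bool → List Row → List (List Prf) → Bool
  triangle p β []       []         = true
  triangle p β (e ∷ es) (ts ∷ tss) = rowPairs p β e (e ∷ es) ts ∧ triangle p β es tss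
  triangle p β _        _          = false

  rectangle : Pat → Bool → List Row → List Row → List (List Prf) → Bool
  rectangle p β []       ys []         = true
  rectangle p β (e ∷ es) ys (ts ∷ tss) = rowPairs p β e ys ts ∧ rectangle p β es ys tss
  rectangle p β _        _  _          = false

  cliqueOK : List Row → Clique → Bool
  cliqueOK E (clique bs rs ts) =
    every (λ i → every (λ j → (i ≡ᵇ j) ∨ is true (K i j)) bs ∧ every (λ e → is true (e ! i)) (pick E rs)) bs ∧
    triangle B false (pick E rs) ts

  within : Maybe (List Row) → (List Row → Bool) → Bool
  within (just E) f = f E
  within nothing  f = false

  -- The pair of vertices is always 0 and 1. A row may stop after two absent adjacencies, since such
  -- a vertex lies in neither closed neighbourhood and has demand zero.
  pairCheck : Prf → Clique → Clique → Clique → Bool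
  pairCheck t c₁ c₂ c₃ = within (ends nothing B [] t) λ E →
    cliqueOK E c₁ ∧ cliqueOK E c₂ ∧ cliqueOK E c₃ ∧
    allBelow b (λ i → needs (K i) ≤ᵇ
      (bit (member i (basesOf c₁)) + (bit (member i (basesOf c₂)) + bit (member i (basesOf c₃))))) ∧
    every (λ e → needs (e !_) ≤ᵇ
      (bit (memberRow e (rowsOf E c₁)) + (bit (memberRow e (rowsOf E c₂)) + bit (memberRow e (rowsOf E c₃))))) E

  uniCheck : Prf → Bool
  uniCheck t = within (ends nothing B [] t) λ E →
    every (λ e → is true (e ! 0)) E ∧ allBelow b (λ i → (i ≡ᵇ 0) ∨ is true (K i 0))

  twinOK : Row × ℕ → Bool
  twinOK (e , i) = (i <ᵇ b) ∧ allBelow b (λ j → if j ≡ᵇ i then is true (e ! j) else same (e ! j) (K i j))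

  compat : ℕ → ℕ → Bool
  compat i j = (i ≡ᵇ j) ∨ is true (K i j)

  twinRow : Row → ℕ → List (Row × ℕ) → List Prf → Bool
  twinPrf : Bool → Row → ℕ → Row → List (Row × ℕ) → List Prf → Bool
  twinRow e i []              ts = true
  twinRow e i ((e′ , j) ∷ es) ts = twinPrf (compat i j) e i e′ es ts
  twinPrf true  e i e′ es ts       = twinRow e i es ts
  twinPrf false e i e′ es (t ∷ ts) = pairPrf B true e e′ t ∧ twinRow e i es ts
  twinPrf false e i e′ es []       = false

  twinPairs : List (Row × ℕ) → List (List Prf) → Bool
  twinPairs []             _          = true
  twinPairs ((e , i) ∷ es) (ts ∷ tss) = twinRow e i ((e , i) ∷ es) ts ∧ twinPairs es tss
  twinPairs _              _          = false

  -- `ids` gives the base vertex cloned by each open row, and `tss` refutes edges between clones of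
  -- distinct non-adjacent base vertices. The digits of `col` form a proper 3-colouring of the base;
  -- those of `nb` choose a neighbour in the base for each base vertex.
  blowupCheck : Prf → List ℕ → ℕ → ℕ → List (List Prf) → Bool
  blowupCheck t ids col nb tss = within (ends nothing B [] t) λ E →
    every twinOK (zipId E ids) ∧ twinPairs (zipId E ids) tss ∧ (0 <ᵇ b) ∧
    allBelow b (λ i → (digit nb i <ᵇ b) ∧ is true (K i (digit nb i))) ∧
    allBelow b (λ i → (digit col i <ᵇ 3) ∧
      allBelow b (λ j → (i ≡ᵇ j) ∨ is false (K i j) ∨ not (digit col i ≡ᵇ digit col j)))

  outside : ℕ → Row → List Row → Row → Bool
  outside a r X e = not (eqRow (take a e) r) ∧ not (memberRow e X)

  inside : ℕ → Row → Row → Bool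
  inside a r e = eqRow (take a e) r

  -- The first `a` base vertices form a frame, and the later ones have row `r` over it. The region
  -- consists of all vertices with row `r` over the frame. Whatever is outside the region and
  -- outside the clique `c` is shown to have no neighbour in the region, while `q` is a frame vertex
  -- without neighbours there.
  sepCheck : ℕ → Row → ℕ → Prf → Clique → List (List Prf) → Bool
  sepCheck a r q t c tss = within (ends nothing B [] t) λ E →
    (length r ≡ᵇ a) ∧ (a <ᵇ b) ∧ allBelow b (λ i → (i <ᵇ a) ∨ allBelow a (λ j → same (K i j) (r ! j))) ∧
    every (λ e → length e ≡ᵇ b) E ∧ cliqueOK E c ∧
    allBelow a (λ i → member i (basesOf c) ∨ is false (r ! i)) ∧ (q <ᵇ a) ∧ is false (r ! q) ∧
    every (λ e → allBelow b (λ i → (i <ᵇ a) ∨ is false (e ! i))) (sift (outside a r (rowsOf E c)) E) ∧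
    rectangle B true (sift (inside a r) E) (sift (outside a r (rowsOf E c)) E) tss

keep : Row → Row → Bool
keep r e = not (eqRow e r)

module RegionCheck (Γ : List Pat) (A : Pat) (r : Row) where

  open Checks Γ [] nothing using (ends; within; triangle; rectangle)

  a : ℕ
  a = length A

  Kᴬ : ℕ → ℕ → Maybe Bool
  Kᴬ = lookupᴷ a A

  -- A with a path of one, two, three vertices of row r added, the path becoming the vertices 0, 1, 2.
  p₁ p₂ p₃ : Pat
  p₁ = oldest r A
  p₂ = oldest (true ∷ r) p₁
  p₃ = oldest (true ∷ false ∷ r) p₂

  keep₁ keep₂ keep₃ : Row → Bool
  keep₁ e = keep r (drop 1 e)
  keep₂ e = keep₁ (drop 1 e)
  keep₃ e = keep₂ (drop 1 e)

  -- Two neighbours of vertex 0 outside the region. If one lies in `A`, its bit in `r` is present,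
  -- and the first test makes it adjacent to every other outside neighbour; the table treats two
  -- vertices outside `A`.
  check₁ : Prf → List (List Prf) → Bool
  check₁ t tss = within (ends nothing p₁ (true ∷ []) t) λ E →
    every (λ e → allBelow a λ i → is false (r ! i) ∨ is true (e ! suc i)) (sift keep₁ E) ∧
    triangle p₁ false (sift keep₁ E) tss

  -- The ends of a path with interior 0, 1, one tree for each end. Neither end lies in `A`, since a
  -- vertex of `A` sees all of the region or none of it.
  check₂ : Prf → Prf → List (List Prf) → Bool
  check₂ t u tss = within (ends nothing p₂ (true ∷ false ∷ []) t) λ E →
    within (ends nothing p₂ (false ∷ true ∷ []) u) λ E′ → rectangle p₂ false (sift keep₂ E) (sift keep₂ E′) tss

  check₃ : Prf → Prf → List (List Prf) → Bool
  check₃ t u tss = within (ends nothing p₃ (true ∷ false ∷ false ∷ []) t) λ E →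
    within (ends nothing p₃ (false ∷ false ∷ true ∷ []) u) λ E′ → rectangle p₃ false (sift keep₃ E) (sift keep₃ E′) tss

  -- The neighbours of the region inside `A` form a clique, which settles two ends in `A`; the
  -- vertex `q` without neighbours in the region ensures that something remains beyond the cutset.
  check₀ : ℕ → Bool
  check₀ q = (length r ≡ᵇ a) ∧ (q <ᵇ a) ∧ is false (r ! q) ∧
    allBelow a (λ i → allBelow a λ j → (i ≡ᵇ j) ∨ is false (r ! i) ∨ is false (r ! j) ∨ is true (Kᴬ i j))

eqRow-refl : ∀ r → eqRow r r ≡ true
eqRow-refl []          = refl
eqRow-refl (true ∷ r)  = eqRow-refl r
eqRow-refl (false ∷ r) = eqRow-refl r

is-true-just : ∀ β → is true (just β) ≡ β
is-true-just true  = refl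
is-true-just false = refl

length-oldest : ∀ r p → length (oldest r p) ≡ suc (length p)
length-oldest r []      = refl
length-oldest r (_ ∷ p) = cong suc (length-oldest r p)

sumBelow : ℕ → (ℕ → ℕ) → ℕ
sumBelow zero    f = 0
sumBelow (suc k) f = f k + sumBelow k f

sumBelow-cong : ∀ k {f g} → (∀ i → i < k → f i ≡ g i) → sumBelow k f ≡ sumBelow k g
sumBelow-cong zero    eq = refl
sumBelow-cong (suc k) eq = cong₂ _+_ (eq k ≤-refl) (sumBelow-cong k λ i i<k → eq i (≤-trans i<k (n≤1+n k)))

sumBelow-< : ∀ k {f g} q → q < k → f q < g q → (∀ i → i < k → i ≢ q → f i ≡ g i) → sumBelow k f < sumBelow k g
sumBelow-< (suc k) {f} {g} q q<sk fq<gq eq with ℕₚ.m≤n⇒m<n∨m≡n (≤-pred q<sk)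
... | inj₂ refl = ℕₚ.+-mono-<-≤ fq<gq (≤-reflexive (sumBelow-cong k λ i i<k → eq i (≤-trans i<k (n≤1+n k)) (ℕₚ.<⇒≢ i<k)))
... | inj₁ q<k = ℕₚ.+-mono-≤-< (≤-reflexive (eq k ≤-refl (ℕₚ.>⇒≢ q<k)))
  (sumBelow-< k q q<k fq<gq λ i i<k → eq i (≤-trans i<k (n≤1+n k)))

bits : ℕ → ℕ → Row
bits zero    m = []
bits (suc k) m = (1 ≤ᵇ m % 2) ∷ bits k (m / 2)

-- graph lists, for every vertex in turn, the set of its earlier neighbours as a binary numeral.
graph : List ℕ → Pat
graph = go []
  where
  go : Pat → List ℕ → Pat
  go p []       = p
  go p (m ∷ ms) = go (bits (length p) m ∷ p) ms

wfᵇ : Pat → Bool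
wfᵇ []      = true
wfᵇ (r ∷ p) = (length r ≤ᵇ length p) ∧ wfᵇ p

path₆ : Pat
path₆ = graph (0 ∷ 1 ∷ 2 ∷ 4 ∷ 8 ∷ 16 ∷ [])

square : Pat
square = graph (0 ∷ 1 ∷ 2 ∷ 5 ∷ [])

-- The exclusion rules

module Rules {n : ℕ} (G : Graph n) (w : ℕ) (bound : Bound G w) (free : Free G) (IH : Smaller n) where

  open Notation G public
  open Critical G w bound free IH public
  open Realisation G Goal public

  Spells : ∀ {k} → Pat → Graph k → Set
  Spells {k} p H = ∀ i j → i ≢ j → lookupᴷ k p (toℕ i) (toℕ j) ≡ just (adj H i j)

  spells? : ∀ {k} p (H : Graph k) → Dec (Spells p H)
  spells? {k} p H = all? λ i → all? λ j → ¬? (i ≟ j) →-dec Maybeₚ.≡-dec 𝔹._≟_ (lookupᴷ k p (toℕ i) (toℕ j)) (just (adj H i j))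

  realised : ∀ {ρ} p (H : Graph (length p)) → Spells p H → Real p ρ → IsInducedSubgraph H G
  realised {ρ} p H sp rl = ρ ∘ toℕ , inj , ad
    where
    rel : ∀ i j → i ≢ j → Rel (adj H i j) (ρ (toℕ i)) (ρ (toℕ j))
    rel i j i≢j = lookupᴷ-sound p {i = toℕ i} {toℕ j} refl rl (sp i j i≢j)
    inj : ∀ {i j} → ρ (toℕ i) ≡ ρ (toℕ j) → i ≡ j
    inj {i} {j} e with i ≟ j
    ... | yes i≡j = i≡j
    ... | no i≢j = ⊥-elim (rel-≢ (rel i j i≢j) e)
    ad : ∀ i j → ρ (toℕ i) ~ ρ (toℕ j) ≡ adj H i j
    ad i j with i ≟ j
    ... | yes refl = trans (irrefl G _) (sym (irrefl H i))
    ... | no i≢j = rel-~ (rel i j i≢j)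

  impossible-path₆ : Impossible path₆
  impossible-path₆ ρ rl = ⊥-elim (proj₁ free (realised {ρ} path₆ P6 (toWitness {a? = spells? path₆ P6} _) rl))

  impossible-square : Impossible square
  impossible-square ρ rl = ⊥-elim (proj₂ free (realised {ρ} square C4 (toWitness {a? = spells? square C4} _) rl))

  -- Shortest paths through a vertex set, components and clique cutsets

  nbrIn? : ∀ (S : V → Bool) z → Dec (Σ V λ u → (S u ≡ true) × (u ~ z ≡ true))
  nbrIn? S z = any? λ u → (S u 𝔹.≟ true) ×-dec (u ~ z 𝔹.≟ true)

  hasNbr : (V → Bool) → V → Bool
  hasNbr S z = does (nbrIn? S z)

  hasNbr-intro : ∀ {S u z} → S u ≡ true → u ~ z ≡ true → hasNbr S z ≡ true
  hasNbr-intro {S} {u} {z} u∈S u~z = dec-true (nbrIn? S z) (u , u∈S , u~z)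

  hasNbr-elim : ∀ {S z} → hasNbr S z ≡ true → Σ V λ u → (S u ≡ true) × (u ~ z ≡ true)
  hasNbr-elim {S} {z} = does-true (nbrIn? S z)

  -- For non-adjacent `x` and `y`, the induced paths between them with interior in `P`. Three
  -- interior vertices are the limit, since a fourth would complete a P6.
  data Path (P : V → Bool) (x y : V) : Set where
    path₁ : ∀ a → P a ≡ true → x ~ a ≡ true → y ~ a ≡ true → Path P x y
    path₂ : ∀ a b → P a ≡ true → P b ≡ true → x ~ a ≡ true → x ~ b ≡ false → y ~ a ≡ false → y ~ b ≡ true →
      a ~ b ≡ true → Path P x y
    path₃ : ∀ a b c → P a ≡ true → P b ≡ true → P c ≡ true →
      x ~ a ≡ true → x ~ b ≡ false → x ~ c ≡ false → y ~ a ≡ false → y ~ b ≡ false → y ~ c ≡ true →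
      a ~ b ≡ true → b ~ c ≡ true → a ~ c ≡ false → a ≢ c → Path P x y

  module Layers (P : V → Bool) (x y : V) (y∉P : P y ≡ false) (x≢y : x ≢ y) (x≁y : x ~ y ≡ false) where

    -- Breadth-first search: the vertices reached from `x` in at most `t` steps, all of them after
    -- `x` inside `P`.
    R : ℕ → V → Bool
    R zero    z = z == x
    R (suc t) z = R t z ∨ (P z ∧ hasNbr (R t) z)

    R-up : ∀ {t z} → R t z ≡ true → R (suc t) z ≡ true
    R-up e rewrite e = refl

    R-step : ∀ t {u z} → P z ≡ true → R t u ≡ true → u ~ z ≡ true → R (suc t) z ≡ true
    R-step t {u} {z} z∈P u∈R u~z = ∨-introʳ (R t z) (∧-intro z∈P (hasNbr-intro {R t} u∈R u~z))

    Layer : ℕ → V → Set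
    Layer zero    z = z ≡ x
    Layer (suc t) z = (R (suc t) z ≡ true) × (R t z ≡ false) × (P z ≡ true)

    layer-R : ∀ t {z} → Layer t z → R t z ≡ true
    layer-R zero    refl = ==-refl x
    layer-R (suc t) l    = proj₁ l

    enter : ∀ t {z} → R (suc t) z ≡ true → R t z ≡ false → Layer (suc t) z
    enter t {z} e z∉R with ∨-true (R t z) e
    ... | inj₁ z∈R = true≢false z∈R z∉R
    ... | inj₂ e′ = e , z∉R , proj₁ (∧-true (P z) e′)

    back : ∀ t {z} → Layer (suc t) z → Σ V λ u → Layer t u × (u ~ z ≡ true)
    back t {z} (e , z∉R , z∈P) with ∨-true (R t z) e
    ... | inj₁ z∈R = true≢false z∈R z∉R
    ... | inj₂ e′ with hasNbr-elim {R t} (proj₂ (∧-true (P z) e′))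
    ...   | u , u∈R , u~z = u , layer t u∈R z∉R , u~z
      where
      layer : ∀ t → R t u ≡ true → R t z ≡ false → Layer t u
      layer zero u∈ _ = ==⇒≡ u∈
      layer (suc t) u∈ z∉ with bool? (R t u)
      ... | inj₂ u∉ = enter t u∈ u∉
      ... | inj₁ u∈′ = true≢false (R-step t z∈P u∈′ u~z) z∉

    apart : ∀ t {u z} → R t u ≡ true → P z ≡ true → R (suc t) z ≡ false → u ~ z ≡ false
    apart t {u} {z} u∈R z∈P z∉R with bool? (u ~ z)
    ... | inj₂ e = e
    ... | inj₁ u~z = true≢false (R-step t z∈P u∈R u~z) z∉R

    below : ∀ t {z} → R (suc t) z ≡ false → R t z ≡ false
    below t {z} e with R t z
    ... | false = refl

    nonNbr : ∀ {S u} → S u ≡ true → hasNbr S y ≡ false → u ~ y ≡ false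
    nonNbr {S} {u} u∈S e with bool? (u ~ y)
    ... | inj₂ e′ = e′
    ... | inj₁ u~y = true≢false (hasNbr-intro {S} u∈S u~y) e

    ∈≢∉ : ∀ {S : V → Bool} {u z} → S u ≡ true → S z ≡ false → u ≢ z
    ∈≢∉ u∈S z∉S refl = true≢false u∈S z∉S

    P≢y : ∀ {z} → P z ≡ true → z ≢ y
    P≢y z∈P = ∈≢∉ {P} z∈P y∉P

    -- Vertices of layers whose indices differ by at least two are non-adjacent, so a chain through the layers is induced.
    finish : (Path P x y → Goal) → ∀ t z → Layer (suc t) z → z ~ y ≡ true → hasNbr (R t) y ≡ false → Goal
    finish k zero z lz@(_ , _ , z∈P) z~y _ with back 0 lz
    ... | a , refl , a~z = k (path₁ z z∈P a~z (~-sym z~y))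
    finish k (suc zero) z lz@(_ , z∉ , z∈P) z~y y∉N with back 1 lz
    ... | a , la@(a∈ , _ , a∈P) , a~z with back 0 la
    ...   | b , refl , b~a = k (path₂ a z a∈P z∈P b~a (apart 0 (==-refl x) z∈P z∉) (~-sym (nonNbr {R 1} a∈ y∉N)) (~-sym z~y) a~z)
    finish k (suc (suc zero)) z lz@(_ , z∉ , z∈P) z~y y∉N with back 2 lz
    ... | a , la@(a∈ , a∉ , a∈P) , a~z with back 1 la
    ...   | b , lb@(b∈ , b∉ , b∈P) , b~a with back 0 lb
    ...     | c , refl , c~b = k (path₃ b a z b∈P a∈P z∈P c~b (apart 0 (==-refl x) a∈P a∉)
        (apart 0 (==-refl x) z∈P (below 1 z∉)) (~-sym (nonNbr {R 2} (R-up {1} b∈) y∉N)) (~-sym (nonNbr {R 2} a∈ y∉N)) (~-sym z~y)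
        b~a a~z (apart 1 b∈ z∈P z∉) (∈≢∉ {R 2} (R-up {1} b∈) z∉))
    -- Going back four layers from `z` reaches `d`, which is `x` itself when `t` is zero; d c b a z
    -- y is an induced P6.
    finish k (suc (suc (suc t))) z lz@(_ , z∉ , z∈P) z~y y∉N with back (3 + t) lz
    ... | a , la@(a∈ , a∉ , a∈P) , a~z with back (2 + t) la
    ...   | b , lb@(b∈ , b∉ , b∈P) , b~a with back (1 + t) lb
    ...     | c , lc@(c∈ , c∉ , c∈P) , c~b with back t lc
    ...       | d , ld , d~c = impossible-path₆ ρ
        ( ≤-refl , ((y≢d , ~-sym y≁d) , (P≢y c∈P ∘ sym , ~-sym (nonNbr {R (3 + t)} (up₂ c∈) y∉N)) ,
            (P≢y b∈P ∘ sym , ~-sym (nonNbr {R (3 + t)} (R-up {2 + t} b∈) y∉N)) ,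
            (P≢y a∈P ∘ sym , ~-sym (nonNbr {R (3 + t)} a∈ y∉N)) , (P≢y z∈P ∘ sym , ~-sym z~y) , tt)
        , ≤-refl , (z≢ (up₃ d∈) (apart t d∈ z∈P (below (1 + t) (below (2 + t) z∉))) ,
            z≢ (up₂ c∈) (apart (1 + t) c∈ z∈P (below (2 + t) z∉)) ,
            z≢ (R-up {2 + t} b∈) (apart (2 + t) b∈ z∈P z∉) , (~⇒≢ a~z ∘ sym , ~-sym a~z) , tt)
        , ≤-refl , (far (2 + t) (up₂′ d∈) a∉ (apart t d∈ a∈P (below (1 + t) a∉)) , far (2 + t) (R-up {1 + t} c∈) a∉ (apart (1 + t) c∈ a∈P a∉) ,
            (~⇒≢ b~a ∘ sym , ~-sym b~a) , tt)
        , ≤-refl , (far (1 + t) (R-up {t} d∈) b∉ (apart t d∈ b∈P b∉) , (~⇒≢ c~b ∘ sym , ~-sym c~b) , tt)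
        , ≤-refl , ((~⇒≢ d~c ∘ sym , ~-sym d~c) , tt)
        , ≤-refl , tt , tt)
      where
      ρ : ℕ → V
      ρ 0 = d
      ρ 1 = c
      ρ 2 = b
      ρ 3 = a
      ρ 4 = z
      ρ _ = y
      d∈ : R t d ≡ true
      d∈ = layer-R t ld
      up₂ : ∀ {u} → R (1 + t) u ≡ true → R (3 + t) u ≡ true
      up₂ {u} e = R-up {2 + t} {u} (R-up {1 + t} {u} e)
      up₂′ : ∀ {u} → R t u ≡ true → R (2 + t) u ≡ true
      up₂′ {u} e = R-up {1 + t} {u} (R-up {t} {u} e)
      up₃ : ∀ {u} → R t u ≡ true → R (3 + t) u ≡ true
      up₃ {u} e = R-up {2 + t} {u} (up₂′ e)
      y≁d : d ~ y ≡ false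
      y≁d = nonNbr {R (3 + t)} (up₃ d∈) y∉N
      y≢d : y ≢ d
      y≢d = layer≢y t ld ∘ sym
        where
        layer≢y : ∀ t {u} → Layer t u → u ≢ y
        layer≢y zero refl = x≢y
        layer≢y (suc t) (_ , _ , u∈P) = P≢y u∈P
      z≢ : ∀ {u} → R (3 + t) u ≡ true → u ~ z ≡ false → Rel false z u
      z≢ u∈ e = ∈≢∉ {R (3 + t)} u∈ z∉ ∘ sym , ~-sym e
      far : ∀ t′ {u v} → R t′ u ≡ true → R t′ v ≡ false → u ~ v ≡ false → Rel false v u
      far t′ u∈ v∉ e = ∈≢∉ {R t′} u∈ v∉ ∘ sym , ~-sym e

    -- Descends to the first layer containing a neighbour of `y`; minimality keeps `y` non-adjacent
    -- to everything before it.
    search : (Path P x y → Goal) → ∀ t → hasNbr (R t) y ≡ true → Goal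
    search k zero e with hasNbr-elim {R 0} e
    ... | u , u∈ , u~y = true≢false (subst (λ v → v ~ y ≡ true) (==⇒≡ {u = u} {x} u∈) u~y) x≁y
    search k (suc t) e with bool? (hasNbr (R t) y)
    ... | inj₁ e′ = search k t e′
    ... | inj₂ y∉N with hasNbr-elim {R (suc t)} e
    ...   | z , z∈ , z~y with bool? (R t z)
    ...     | inj₁ z∈′ = true≢false (hasNbr-intro {R t} z∈′ z~y) y∉N
    ...     | inj₂ z∉ = finish k t z (enter t z∈ z∉) z~y y∉N

  data Walk (P : V → Bool) (a : V) : V → Set where
    stop : P a ≡ true → Walk P a a
    step : ∀ {b c} → Walk P a b → P c ≡ true → b ~ c ≡ true → Walk P a c

  walk-cons : ∀ {P a b c} → P a ≡ true → a ~ b ≡ true → Walk P b c → Walk P a c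
  walk-cons a∈P a~b (stop b∈P) = step (stop a∈P) b∈P a~b
  walk-cons a∈P a~b (step wk c∈P e) = step (walk-cons a∈P a~b wk) c∈P e

  walk-trans : ∀ {P a b c} → Walk P a b → Walk P b c → Walk P a c
  walk-trans wk (stop _) = wk
  walk-trans wk (step wk′ c∈P e) = step (walk-trans wk wk′) c∈P e

  walk-sym : ∀ {P a b} → Walk P a b → Walk P b a
  walk-sym (stop e) = stop e
  walk-sym (step wk c∈P e) = walk-cons c∈P (~-sym e) (walk-sym wk)

  record Component (P : V → Bool) (d : V) : Set where
    field
      D      : V → Bool
      d∈D    : D d ≡ true
      walk   : ∀ v → D v ≡ true → Walk P d v
      closed-D : ∀ u v → D u ≡ true → P v ≡ true → u ~ v ≡ true → D v ≡ true

  component : ∀ P d → P d ≡ true → Component P d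
  -- Every round adds a vertex, so the invariant bounding `n` by fuel plus size of `D` forbids
  -- running out of fuel before `D` is closed.
  component P d d∈P = grow n (_== d) (==-refl d) (λ v e → subst (Walk P d) (sym (==⇒≡ e)) (stop d∈P)) (ℕₚ.m≤m+n n _)
    where
    grow : ∀ f (D : V → Bool) → D d ≡ true → (∀ v → D v ≡ true → Walk P d v) → n ≤ f + count D → Component P d
    grow f D d∈D wk n≤ with any? (λ v → (D v 𝔹.≟ false) ×-dec ((P v 𝔹.≟ true) ×-dec (hasNbr D v 𝔹.≟ true)))
    ... | no ¬v = record { D = D ; d∈D = d∈D ; walk = wk ; closed-D = cl }
      where
      cl : ∀ u v → D u ≡ true → P v ≡ true → u ~ v ≡ true → D v ≡ true
      cl u v u∈D v∈P u~v with bool? (D v)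
      ... | inj₁ e = e
      ... | inj₂ v∉D = ⊥-elim (¬v (v , v∉D , v∈P , hasNbr-intro {D} u∈D u~v))
    grow zero D d∈D wk n≤ | yes (v , v∉D , _) = ⊥-elim (ℕₚ.<⇒≱ (count<n D v v∉D) n≤)
    grow (suc f) D d∈D wk n≤ | yes (v , v∉D , v∈P , nb) with hasNbr-elim {D} nb
    ... | u , u∈D , u~v = grow f (λ z → D z ∨ (z == v)) (cong (_∨ (d == v)) d∈D)
      (λ z e → case ∨-true (D z) e of λ
        { (inj₁ z∈D) → wk z z∈D ; (inj₂ z≡v) → subst (Walk P d) (sym (==⇒≡ z≡v)) (step (wk u u∈D) v∈P u~v) })
      (≤-trans n≤ (≤-trans (≤-reflexive (sym (ℕₚ.+-suc f (count D))))
        (ℕₚ.+-monoʳ-≤ f (count-mono-< (λ z z∈D → cong (_∨ (z == v)) z∈D) v v∉D (∨-introʳ (D v) (==-refl v))))))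

  -- Either two non-adjacent neighbours of the component of d in P are joined through it by an induced path, or its
  -- neighbourhood is a clique cutset.
  region : ∀ P d → P d ≡ true → ∀ q → P q ≡ false → (∀ v → P v ≡ true → v ~ q ≡ false) →
    (∀ x y → P x ≡ false → P y ≡ false → x ≢ y → x ~ y ≡ false → Path P x y → Goal) → Goal
  region P d d∈P q q∉P q-far k with any? (λ x → any? λ y → (N x 𝔹.≟ true) ×-dec ((N y 𝔹.≟ true) ×-dec (¬? (x ≟ y) ×-dec (x ~ y 𝔹.≟ false))))
    where
    open Component (component P d d∈P)
    N : V → Bool
    N v = not (P v) ∧ hasNbr D v
  ... | yes (x , y , x∈N , y∈N , x≢y , x≁y) = go (∧-true (not (P x)) x∈N) (∧-true (not (P y)) y∈N)
    where
    open Component (component P d d∈P)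
    go : _ × _ → _ × _ → Goal
    go (x∉P , nx) (y∉P , ny) with hasNbr-elim {D} nx | hasNbr-elim {D} ny
    ... | a , a∈D , a~x | b , b∈D , b~y = reach (walk-trans (walk-sym (walk a a∈D)) (walk b b∈D)) b~y
      where
      open Layers P x y (not-true y∉P) x≢y x≁y
      reached : ∀ {b} → Walk P a b → Σ ℕ λ t → R t b ≡ true
      reached (stop a∈P) = 1 , R-step 0 a∈P (==-refl x) (~-sym a~x)
      reached (step wk c∈P e) with reached wk
      ... | t , r = suc t , R-step t c∈P r e
      reach : ∀ {b} → Walk P a b → b ~ y ≡ true → Goal
      reach wk b~y with reached wk
      ... | t , r = search (k x y (not-true x∉P) (not-true y∉P) x≢y x≁y) t (hasNbr-intro {R t} r b~y)
  ... | no ¬xy = clique-cutset D N N-clique sep N∩D d d∈D q (D⊆P q q∉P) N-q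
    where
    open Component (component P d d∈P)
    N : V → Bool
    N v = not (P v) ∧ hasNbr D v
    walk-end : ∀ {a b} → Walk P a b → P b ≡ true
    walk-end (stop e) = e
    walk-end (step _ e _) = e
    D⊆P : ∀ v → P v ≡ false → D v ≡ false
    D⊆P v v∉P with bool? (D v)
    ... | inj₂ e = e
    ... | inj₁ v∈D = true≢false (walk-end (walk v v∈D)) v∉P
    N-clique : ∀ u v → N u ≡ true → N v ≡ true → u ≢ v → u ~ v ≡ true
    N-clique u v u∈N v∈N u≢v with bool? (u ~ v)
    ... | inj₁ e = e
    ... | inj₂ u≁v = ⊥-elim (¬xy (u , v , u∈N , v∈N , u≢v , u≁v))
    sep : ∀ u v → D u ≡ true → D v ≡ false → N v ≡ false → u ~ v ≡ true → ⊥
    sep u v u∈D v∉D v∉N u~v with bool? (P v)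
    ... | inj₁ v∈P = true≢false (closed-D u v u∈D v∈P u~v) v∉D
    ... | inj₂ v∉P = true≢false (∧-intro (cong not v∉P) (hasNbr-intro {D} u∈D u~v)) v∉N
    N∩D : ∀ v → N v ≡ true → D v ≡ false
    N∩D v v∈N = D⊆P v (not-true (proj₁ (∧-true (not (P v)) v∈N)))
    N-q : N q ≡ false
    N-q with bool? (N q)
    ... | inj₂ e = e
    ... | inj₁ q∈N with hasNbr-elim {D} (proj₂ (∧-true (not (P q)) q∈N))
    ...   | u , u∈D , u~q = true≢false u~q (q-far u (walk-end (walk u u∈D)))

  rel? : ∀ β x y → Dec (Rel β x y)
  rel? β x y = map′ (λ { (p , q) → p , q }) (λ { (p , q) → p , q }) (¬? (x ≟ y) ×-dec (x ~ y 𝔹.≟ β))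

  fits? : ∀ ρ j r x → Dec (Fits ρ j r x)
  fits? ρ j []      x = yes tt
  fits? ρ j (β ∷ r) x = rel? β x (ρ j) ×-dec fits? ρ (suc j) r x

  freshDec : ∀ k ρ x → Dec (Fresh k ρ x)
  freshDec k ρ x with fresh? k ρ x
  ... | inj₂ fr = yes fr
  ... | inj₁ (i , i<k , e) = no λ fr → fr i i<k e

  -- A search either finds two non-adjacent members, a failure that yields `Goal`, or shows that the
  -- listing of `P` is a clique.
  clique-count : (P : V → Bool) → (∀ x y → P x ≡ true → P y ≡ true → x ≢ y → x ~ y ≡ false → Goal) →
    (count P ≤ w → Goal) → Goal
  clique-count P viol k with any? (λ x → any? λ y →
    (P x 𝔹.≟ true) ×-dec ((P y 𝔹.≟ true) ×-dec (¬? (x ≟ y) ×-dec (x ~ y 𝔹.≟ false))))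
  ... | yes (x , y , x∈P , y∈P , x≢y , x≁y) = viol x y x∈P y∈P x≢y x≁y
  ... | no ¬xy = k (bound (count P) (elem , elem-inj , λ i j i≢j → ≡true⇒T (ad i j (i≢j ∘ elem-inj))))
    where
    open Listing (listing P)
    ad : ∀ i j → elem i ≢ elem j → elem i ~ elem j ≡ true
    ad i j e≢ with bool? (elem i ~ elem j)
    ... | inj₁ e = e
    ... | inj₂ e = ⊥-elim (¬xy (elem i , elem j , elem-∈ i , elem-∈ j , e≢ , e))

  -- Soundness of the clique-cover and universal-vertex checks

  module At (Γ : List Pat) (Γ-excl : All Excluded Γ) (B : Pat) (mode : Maybe Bool) (ρ₀ : ℕ → V)
    (O : Sound.Oracle Γ Γ-excl B mode ρ₀ mode) where

    open Checks Γ B mode public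
    open Sound Γ Γ-excl B mode ρ₀ public

    within-sound : ∀ {o f} → within o f ≡ true → Σ (List Row) λ E → (o ≡ just E) × (f E ≡ true)
    within-sound {just E} e = E , refl , e

    Refutes : Pat → Bool → Row → Row → Set
    Refutes p β e e′ = Σ Prf λ t → pairPrf p β e e′ t ≡ true

    rowPairs-∈ : ∀ {p β e e′} ys ts → rowPairs p β e ys ts ≡ true → e′ ∈ ys → Refutes p β e e′
    rowPairs-∈ {p} {β} {e} (y ∷ ys) (t ∷ ts) eq (here refl) = t , proj₁ (∧-true (pairPrf p β e y t) eq)
    rowPairs-∈ {p} {β} {e} (y ∷ ys) (t ∷ ts) eq (there e′∈) = rowPairs-∈ ys ts (proj₂ (∧-true (pairPrf p β e y t) eq)) e′∈

    triangle-∈ : ∀ {p β e e′} es tss → triangle p β es tss ≡ true → e ∈ es → e′ ∈ es → Refutes p β e e′ ⊎ Refutes p β e′ e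
    triangle-∈ {p} {β} (f ∷ es) (ts ∷ tss) eq e∈ e′∈ with ∧-true (rowPairs p β f (f ∷ es) ts) eq
    triangle-∈ (f ∷ es) (ts ∷ tss) eq (here refl) e′∈ | r , _ = inj₁ (rowPairs-∈ (f ∷ es) ts r e′∈)
    triangle-∈ (f ∷ es) (ts ∷ tss) eq (there e∈) (here refl) | r , _ = inj₂ (rowPairs-∈ (f ∷ es) ts r (there e∈))
    triangle-∈ (f ∷ es) (ts ∷ tss) eq (there e∈) (there e′∈) | _ , rest = triangle-∈ es tss rest e∈ e′∈

    rectangle-∈ : ∀ {p β e e′} es ys tss → rectangle p β es ys tss ≡ true → e ∈ es → e′ ∈ ys → Refutes p β e e′
    rectangle-∈ {p} {β} (f ∷ es) ys (ts ∷ tss) eq e∈ e′∈ with ∧-true (rowPairs p β f ys ts) eq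
    rectangle-∈ (f ∷ es) ys (ts ∷ tss) eq (here refl) e′∈ | r , _ = rowPairs-∈ ys ts r e′∈
    rectangle-∈ (f ∷ es) ys (ts ∷ tss) eq (there e∈) e′∈ | _ , rest = rectangle-∈ es ys tss rest e∈ e′∈

    refute : ∀ {p ρ β e e′} → Refutes p β e e′ → length B ≤ length p → Agree ρ → Real p ρ →
      ∀ x y → Fresh (length p) ρ x → Fresh (length p) ρ y → x ≢ y → Fits ρ 0 e x → Fits ρ 0 e′ y → y ~ x ≡ β → Goal
    refute {p} {ρ} {β} {e} {e′} (t , ok) B≤p ag rl x y x-fr y-fr x≢y x-fits y-fits y~x
      with ∧-true (length e ≡ᵇ length p) ok
    ... | len , ok₁ with ∧-true (length e′ ≡ᵇ length p) ok₁
    ... | len′ , ok₂ = ends-sound (e ∷ p) t (isNone-sound ok₂) O (≤-trans B≤p (n≤1+n _))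
        (λ i i<B → trans (sym (upd-below ρ x (≤-trans i<B B≤p))) (ag i i<B))
        (extend {r = e} rl (≤-reflexive le) x-fits) y y-fr′ tt
        (≤-reflexive (trans (length-∷ʳ e′ β) (cong suc le′)))
        (Fits-∷ʳ e′ (Fits-cong {r = e′} (λ i i< → upd-below ρ x (subst (i <_) le′ i<)) y-fits)
          (subst (Rel β y) (trans (sym (upd-here ρ (length p) x)) (cong (upd ρ (length p) x) (sym (trans (ℕₚ.+-identityʳ _) le′)))) (x≢y ∘ sym , y~x)))
        λ _ ()
      where
      le = ≡ᵇ⇒≡ {length e} len
      le′ = ≡ᵇ⇒≡ {length e′} len′
      y-fr′ : Fresh (suc (length p)) (upd ρ (length p) x) y
      y-fr′ i i<sp eq with ℕₚ.m≤n⇒m<n∨m≡n (≤-pred i<sp)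
      ... | inj₁ i<p = y-fr i i<p (trans eq (sym (upd-below ρ x i<p)))
      ... | inj₂ refl = x≢y (sym (trans eq (upd-here ρ (length p) x)))

    module OnBase (rl : Real B ρ₀) where

      K-sound : ∀ {i j β} → K i j ≡ just β → Rel β (ρ₀ i) (ρ₀ j)
      K-sound {i} {j} = lookupᴷ-sound B {i = i} {j} refl rl

      classify : ∀ {t E} → ends nothing B [] t ≡ just E → ∀ x → Fresh b ρ₀ x → (∀ e → e ∈ E → Fits ρ₀ 0 e x → Goal) → Goal
      classify {t} eq x fr = ends-sound B t eq O ≤-refl (λ _ _ → refl) rl x fr tt z≤n tt

      Mem : List Row → Clique → V → Set
      Mem E c x = Any (λ i → x ≡ ρ₀ i) (basesOf c) ⊎ (Fresh b ρ₀ x × Any (λ e → Fits ρ₀ 0 e x) (rowsOf E c))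

      mem? : ∀ E c x → Dec (Mem E c x)
      mem? E c x = Any.any? (λ i → x ≟ ρ₀ i) (basesOf c) ⊎-dec (freshDec b ρ₀ x ×-dec Any.any? (λ e → fits? ρ₀ 0 e x) (rowsOf E c))

      mem-clique : ∀ {E} c → cliqueOK E c ≡ true → ∀ x y → Mem E c x → Mem E c y → x ≢ y → x ~ y ≡ false → Goal
      mem-clique {E} (clique bs rs ts) ok x y mx my x≢y x≁y with ∧-true (every _ bs) ok
      ... | bases , rows = go mx my
        where
        at : ∀ {i} → i ∈ bs → (every (λ j → (i ≡ᵇ j) ∨ is true (K i j)) bs ≡ true) × (every (λ e → is true (e ! i)) (pick E rs) ≡ true)
        at i∈ = ∧-true (every _ bs) (every-sound bases i∈)
        mixed : ∀ {u v i e} → i ∈ bs → u ≡ ρ₀ i → e ∈ pick E rs → Fits ρ₀ 0 e v → v ~ u ≡ true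
        mixed {u} {v} {i} {e} i∈ refl e∈ fs = rel-~ (Fits-!₀ {r = e} fs (is-sound (every-sound (proj₂ (at i∈)) e∈)))
        go : Mem E (clique bs rs ts) x → Mem E (clique bs rs ts) y → Goal
        go (inj₁ ax) (inj₁ ay) with find ax | find ay
        ... | i , i∈ , refl | j , j∈ , refl with ∨-true (i ≡ᵇ j) (every-sound (proj₁ (at i∈)) j∈)
        ...   | inj₁ e = ⊥-elim (x≢y (cong ρ₀ (≡ᵇ⇒≡ {i} e)))
        ...   | inj₂ e = true≢false (rel-~ (K-sound (is-sound e))) x≁y
        go (inj₁ ax) (inj₂ (_ , ay)) with find ax | find ay
        ... | i , i∈ , x≡ | e , e∈ , fs = true≢false (~-sym (mixed i∈ x≡ e∈ fs)) x≁y
        go (inj₂ (_ , ax)) (inj₁ ay) with find ax | find ay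
        ... | e , e∈ , fs | i , i∈ , y≡ = true≢false (mixed i∈ y≡ e∈ fs) x≁y
        go (inj₂ (x-fr , ax)) (inj₂ (y-fr , ay)) with find ax | find ay
        ... | e , e∈ , fs | e′ , e′∈ , fs′ with triangle-∈ (pick E rs) ts rows e∈ e′∈
        ...   | inj₁ rf = refute rf ≤-refl (λ _ _ → refl) rl x y x-fr y-fr x≢y fs fs′ (~-sym x≁y)
        ...   | inj₂ rf = refute rf ≤-refl (λ _ _ → refl) rl y x y-fr x-fr (x≢y ∘ sym) fs′ fs x≁y

      -- The closed neighbourhoods of two vertices are covered, with multiplicity, by three cliques, so they have at most
      -- 3w elements together and one of them has at most half of that.
      pair-sound : ∀ t c₁ c₂ c₃ → pairCheck t c₁ c₂ c₃ ≡ true → Goal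
      pair-sound t c₁ c₂ c₃ check with within-sound check
      ... | E , eqE , ok with ∧-true (cliqueOK E c₁) ok
      ... | ok₁ , ok′ with ∧-true (cliqueOK E c₂) ok′
      ... | ok₂ , ok″ with ∧-true (cliqueOK E c₃) ok″
      ... | ok₃ , ok‴ with ∧-true (allBelow b _) ok‴
      ... | base-cover , row-cover = decide
        where
        P : Clique → V → Bool
        P c x = does (mem? E c x)
        lhs rhs : V → ℕ
        lhs x = bit (closed (ρ₀ 0) x) + bit (closed (ρ₀ 1) x)
        rhs x = bit (P c₁ x) + (bit (P c₂ x) + bit (P c₃ x))
        closed-bit : ∀ {x u o} → (o ≡ just false → Rel false x u) → bit (closed u x) ≤ bit (not (is false o))
        closed-bit {x} {u} {just false} f = ≤-reflexive (cong bit (cong₂ _∨_ (≢⇒== (rel-≢ (f refl))) (~-sym (rel-~ (f refl)))))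
        closed-bit {o = just true} f = bit-mono λ _ → refl
        closed-bit {o = nothing} f = bit-mono λ _ → refl
        base-bit : ∀ c {i} → bit (member i (basesOf c)) ≤ bit (P c (ρ₀ i))
        base-bit c {i} = bit-mono λ e → dec-true (mem? E c (ρ₀ i)) (inj₁ (lose (member-sound (basesOf c) e) refl))
        row-bit : ∀ c {x e} → Fresh b ρ₀ x → Fits ρ₀ 0 e x → bit (memberRow e (rowsOf E c)) ≤ bit (P c x)
        row-bit c {x} fr fs = bit-mono λ q → dec-true (mem? E c x) (inj₂ (fr , lose (memberRow-sound (rowsOf E c) q) fs))
        bound3 : ∀ {x a₁ a₂ a₃ f} → lhs x ≤ needs f → (needs f ≤ᵇ (a₁ + (a₂ + a₃))) ≡ true →
          a₁ ≤ bit (P c₁ x) → a₂ ≤ bit (P c₂ x) → a₃ ≤ bit (P c₃ x) → lhs x ≤ rhs x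
        bound3 {f = f} l e p q r = ≤-trans l (≤-trans (ℕₚ.≤ᵇ⇒≤ (needs f) _ (≡true⇒T e)) (+-mono-≤ p (+-mono-≤ q r)))
        covered : ∀ x → ¬ (lhs x ≤ rhs x) → (Σ ℕ λ i → (i < b) × (x ≡ ρ₀ i)) ⊎ Fresh b ρ₀ x → Goal
        covered x ¬c (inj₁ (i , i<b , refl)) = ⊥-elim (¬c (bound3 {f = K i}
            (+-mono-≤ (closed-bit K-sound) (closed-bit K-sound)) (allBelow-sound base-cover i i<b)
            (base-bit c₁) (base-bit c₂) (base-bit c₃)))
        covered x ¬c (inj₂ fr) = classify {t} eqE x fr λ e e∈ fs → ⊥-elim (¬c (bound3 {f = e !_}
            (+-mono-≤ (closed-bit (Fits-!₀ {r = e} fs)) (closed-bit (Fits-!₀ {r = e} fs))) (every-sound row-cover e∈)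
            (row-bit c₁ fr fs) (row-bit c₂ fr fs) (row-bit c₃ fr fs)))
        size : ∀ c → cliqueOK E c ≡ true → (count (P c) ≤ w → Goal) → Goal
        size c okc = clique-count (P c) λ x y x∈ y∈ →
          mem-clique c okc x y (does-true (mem? E c x) x∈) (does-true (mem? E c y) y∈)
        conclude : (∀ x → lhs x ≤ rhs x) → count (P c₁) ≤ w → count (P c₂) ≤ w → count (P c₃) ≤ w → Goal
        conclude l≤r s₁ s₂ s₃ with cdeg (ρ₀ 0) ℕₚ.≤? m | cdeg (ρ₀ 1) ℕₚ.≤? m
        ... | yes small | _ = small-vertex (ρ₀ 0) small
        ... | no _ | yes small = small-vertex (ρ₀ 1) small
        -- Both closed neighbourhoods having at least m + 1 elements gives 2m + 2 ≤ 3w, while the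
        -- rounding in `m` gives 3w ≤ 2m + 1.
        ... | no big₀ | no big₁ = ⊥-elim (ℕₚ.<-irrefl refl (≤-trans (≤-trans (s≤s (half-upper (3 * w))) (≤-reflexive (cong suc (sym (ℕₚ.+-suc m m)))))
            (≤-trans (+-mono-≤ (ℕₚ.≰⇒> big₀) (ℕₚ.≰⇒> big₁)) total)))
          where
          total : cdeg (ρ₀ 0) + cdeg (ρ₀ 1) ≤ 3 * w
          total = ≤-trans (≤-reflexive (sym (∑-+ (bit ∘ closed (ρ₀ 0)) (bit ∘ closed (ρ₀ 1)))))
            (≤-trans (∑-mono l≤r)
            (≤-trans (≤-reflexive (trans (∑-+ (bit ∘ P c₁) (λ x → bit (P c₂ x) + bit (P c₃ x)))
              (cong (count (P c₁) +_) (∑-+ (bit ∘ P c₂) (bit ∘ P c₃)))))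
            (+-mono-≤ s₁ (+-mono-≤ s₂ (≤-trans s₃ (ℕₚ.m≤m+n w 0))))))
        decide : Goal
        -- Classifying a vertex produces only `Goal`, so the covering inequality cannot be read off
        -- vertex by vertex; a search settles first whether it fails anywhere.
        decide with any? (λ x → ¬? (lhs x ℕₚ.≤? rhs x))
        ... | yes (x , ¬c) = covered x ¬c (fresh? b ρ₀ x)
        ... | no all = size c₁ ok₁ λ s₁ → size c₂ ok₂ λ s₂ → size c₃ ok₃ λ s₃ → conclude l≤r s₁ s₂ s₃
          where
          l≤r : ∀ x → lhs x ≤ rhs x
          l≤r x with lhs x ℕₚ.≤? rhs x
          ... | yes p = p
          ... | no ¬p = ⊥-elim (all (x , ¬p))

      uni-sound : ∀ t → uniCheck t ≡ true → Goal
      uni-sound t check with within-sound check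
      ... | E , eqE , ok with ∧-true (every _ E) ok
      ... | rows , bases with any? (λ v → ¬? (v ≟ ρ₀ 0) ×-dec (ρ₀ 0 ~ v 𝔹.≟ false))
      ... | no ¬v = universal (ρ₀ 0) λ v v≢ → case bool? (ρ₀ 0 ~ v) of λ
          { (inj₁ e) → e ; (inj₂ e) → ⊥-elim (¬v (v , v≢ , e)) }
      ... | yes (v , v≢ , e) with fresh? b ρ₀ v
      ...   | inj₂ fr = classify {t} eqE v fr λ r r∈ fs →
          true≢false (~-sym (rel-~ (Fits-!₀ {r = r} fs (is-sound (every-sound rows r∈))))) e
      ...   | inj₁ (i , i<b , refl) with ∨-true (i ≡ᵇ 0) (allBelow-sound bases i i<b)
      ...     | inj₁ q = ⊥-elim (v≢ (cong ρ₀ (≡ᵇ⇒≡ {i} q)))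
      ...     | inj₂ q = true≢false (~-sym (rel-~ (K-sound (is-sound q)))) e

  -- Cutsets around the vertices with a prescribed row

  Rel-bit : ∀ {β β′ x y} → Rel β x y → Rel β′ x y → β ≡ β′
  Rel-bit r r′ = trans (sym (rel-~ r)) (rel-~ r′)

  fits-at : ∀ {ρ x i} r → Fits ρ 0 r x → i < length r → Σ Bool λ β → (r ! i ≡ just β) × Rel β x (ρ i)
  fits-at {i = i} r fs i<r with r ! i in eq
  ... | just β = β , refl , Fits-!₀ {r = r} fs eq
  ... | nothing = ⊥-elim (absurd r i<r eq)
    where
    absurd : ∀ (r : Row) {i} → i < length r → r ! i ≡ nothing → ⊥
    absurd (_ ∷ r) {suc i} (s≤s lt) e = absurd r lt e

  fits-tabulate : ∀ {ρ x} j r → (∀ i β → r ! i ≡ just β → Rel β x (ρ (i + j))) → Fits ρ j r x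
  fits-tabulate j [] f = tt
  fits-tabulate {ρ} {x} j (β ∷ r) f = f 0 β refl , fits-tabulate (suc j) r λ i β′ e →
    subst (λ z → Rel β′ x (ρ z)) (sym (ℕₚ.+-suc i j)) (f (suc i) β′ e)

  fits-take : ∀ {ρ x} j r e → Fits ρ j r x → Fits ρ j e x → length r ≤ length e → take (length r) e ≡ r
  fits-take j [] e _ _ _ = refl
  fits-take j (β ∷ r) (β′ ∷ e) (f , fs) (f′ , fs′) (s≤s le) = cong₂ _∷_ (Rel-bit f′ f) (fits-take (suc j) r e fs fs′ le)

  fits-prefix : ∀ {ρ x} j k e → Fits ρ j e x → Fits ρ j (take k e) x
  fits-prefix j zero e fs = tt
  fits-prefix j (suc k) [] fs = tt
  fits-prefix j (suc k) (β ∷ e) (f , fs) = f , fits-prefix (suc j) k e fs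

  infixr 5 _◂_
  _◂_ : V → (ℕ → V) → ℕ → V
  (d ◂ ρ) zero    = d
  (d ◂ ρ) (suc i) = ρ i

  fits-shift : ∀ {d ρ x} j s → Fits ρ j s x → Fits (d ◂ ρ) (suc j) s x
  fits-shift j []      _        = tt
  fits-shift j (β ∷ s) (f , fs) = f , fits-shift (suc j) s fs

  fits-unshift : ∀ {d ρ x} j s → Fits (d ◂ ρ) (suc j) s x → Fits ρ j s x
  fits-unshift j []      _        = tt
  fits-unshift j (β ∷ s) (f , fs) = f , fits-unshift (suc j) s fs

  fits-drop : ∀ {d ρ x} s → Fits (d ◂ ρ) 0 s x → Fits ρ 0 (drop 1 s) x
  fits-drop []      _        = tt
  fits-drop (β ∷ s) (_ , fs) = fits-unshift 0 s fs

  oldest-real : ∀ {ρ d} r p → (∀ i → i < length p → Σ Bool λ β → (r ! i ≡ just β) × Rel β d (ρ i)) →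
    Real p ρ → Real (oldest r p) (d ◂ ρ)
  oldest-real r [] _ _ = z≤n , tt , tt
  oldest-real {ρ} {d} r (s ∷ p) h (len , fs , rl) =
    subst (suc (length s) ≤_) (sym (length-oldest r p)) (s≤s len) ,
    subst (λ k → Fits (d ◂ ρ) 0 (is true (r ! length p) ∷ s) ((d ◂ ρ) k)) (sym (length-oldest r p)) (first , fits-shift 0 s fs) ,
    oldest-real r p (λ i i<p → h i (≤-trans i<p (n≤1+n _))) rl
    where
    first : Rel (is true (r ! length p)) (ρ (length p)) d
    first with h (length p) ≤-refl
    ... | β , eq , rel rewrite eq | is-true-just β = Rel-sym rel

  addOldest : ∀ {ρ d} r p → length r ≡ length p → Fits ρ 0 r d → Real p ρ → Real (oldest r p) (d ◂ ρ)
  addOldest r p le fs = oldest-real r p λ i i<p → fits-at r fs (subst (i <_) (sym le) i<p)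

  ◂-fresh : ∀ {k ρ d x} → x ≢ d → Fresh k ρ x → Fresh (suc k) (d ◂ ρ) x
  ◂-fresh x≢d fr zero    _         = x≢d
  ◂-fresh x≢d fr (suc i) (s≤s i<k) = fr i i<k

  module Region (Γ : List Pat) (Γ-excl : All Excluded Γ) (A : Pat) (r : Row) (ρ : ℕ → V) (rl : Real A ρ) where

    open RegionCheck Γ A r
    open At Γ Γ-excl [] nothing ρ tt hiding (K)

    P? : ∀ x → Dec (Fresh a ρ x × Fits ρ 0 r x)
    P? x = freshDec a ρ x ×-dec fits? ρ 0 r x

    P : V → Bool
    P x = does (P? x)

    kept : ∀ {x} e → P x ≡ false → Fresh a ρ x → Fits ρ 0 e x → keep r e ≡ true
    kept {x} e x∉P fr fs with bool? (eqRow e r)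
    ... | inj₂ q = cong not q
    ... | inj₁ q = true≢false (dec-true (P? x) (fr , subst (λ s → Fits ρ 0 s x) (eqRow-sound e r q) fs)) x∉P

    region-sound : ∀ d → P d ≡ true → ∀ q → check₀ q ≡ true → ∀ t₁ ts₁ → check₁ t₁ ts₁ ≡ true →
      ∀ t₂ u₂ ts₂ → check₂ t₂ u₂ ts₂ ≡ true → ∀ t₃ u₃ ts₃ → check₃ t₃ u₃ ts₃ ≡ true → Goal
    region-sound d d∈P q ok₀ t₁ ts₁ ok₁ t₂ u₂ ts₂ ok₂ t₃ u₃ ts₃ ok₃
      with ∧-true (length r ≡ᵇ a) ok₀ | within-sound ok₁ | within-sound ok₂ | within-sound ok₃
    ... | len , ok₀′ | E₁ , eq₁ , ok₁′ | E₂ , eq₂ , ok₂′ | E₃ , eq₃ , ok₃′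
      with ∧-true (q <ᵇ a) ok₀′ | ∧-true (every _ (sift keep₁ E₁)) ok₁′ | within-sound ok₂′ | within-sound ok₃′
    ... | q<ᵇa , ok₀″ | sub , tri | E₂′ , eq₂′ , rect₂ | E₃′ , eq₃′ , rect₃ with ∧-true (is false (r ! q)) ok₀″
    ... | rq , cl = region P d d∈P (ρ q) q∉P (λ v v∈P → rel-~ (Fits-!₀ {r = r} (proj₂ (P-elim v∈P)) (is-sound rq))) connect
      where
      le : length r ≡ a
      le = ≡ᵇ⇒≡ {length r} len
      P-elim : ∀ {v} → P v ≡ true → Fresh a ρ v × Fits ρ 0 r v
      P-elim {v} = does-true (P? v)
      q∉P : P (ρ q) ≡ false
      q∉P = dec-false (P? (ρ q)) λ (fr , _) → fr q (<ᵇ⇒< q<ᵇa) refl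
      ∉≢∈ : ∀ {x v} → P x ≡ false → P v ≡ true → x ≢ v
      ∉≢∈ x∉P v∈P refl = true≢false v∈P x∉P
      -- All of `P` has row `r`, so a vertex of `A` cannot tell two members apart; this keeps `A`
      -- away from the ends of paths with two or three interior vertices.
      uniform : ∀ {i v v′} → i < a → P v ≡ true → P v′ ≡ true → ρ i ~ v ≡ true → ρ i ~ v′ ≡ false → Goal
      uniform i<a v∈P v′∈P e e′ with fits-at r (proj₂ (P-elim v∈P)) (subst (_ <_) (sym le) i<a)
                                   | fits-at r (proj₂ (P-elim v′∈P)) (subst (_ <_) (sym le) i<a)
      ... | β , q₁ , rel₁ | β′ , q₂ , rel₂ with trans (sym q₁) q₂
      ...   | refl = true≢false (trans (sym (trans (rel-~ (Rel-sym rel₁)) (sym (rel-~ (Rel-sym rel₂))))) e) e′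
      bit-true : ∀ {i v} → P v ≡ true → ρ i ~ v ≡ true → is false (r ! i) ≡ true → ⊥
      bit-true {i} v∈P e q = true≢false e (rel-~ (Rel-sym (Fits-!₀ {r = r} (proj₂ (P-elim v∈P)) (is-sound q))))
      module One (v : V) (v∈P : P v ≡ true) where
        rl₁ : Real p₁ (v ◂ ρ)
        rl₁ = addOldest r A le (proj₂ (P-elim v∈P)) rl
        fresh₁ : ∀ {x} → P x ≡ false → Fresh a ρ x → Fresh (length p₁) (v ◂ ρ) x
        fresh₁ x∉P fr = subst (λ k → Fresh k (v ◂ ρ) _) (sym (length-oldest r A)) (◂-fresh (∉≢∈ x∉P v∈P) fr)
        classify₁ : ∀ {x} → P x ≡ false → Fresh a ρ x → x ~ v ≡ true →
          (∀ e → e ∈ sift keep₁ E₁ → Fits (v ◂ ρ) 0 e x → Goal) → Goal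
        classify₁ {x} x∉P fr x~v k = ends-sound p₁ t₁ eq₁ tt z≤n (λ _ ()) rl₁ x (fresh₁ x∉P fr) tt
          (subst (1 ≤_) (sym (length-oldest r A)) (s≤s z≤n)) ((∉≢∈ x∉P v∈P , x~v) , tt)
          λ e e∈ fs → k e (sift-∈ E₁ e∈ (kept (drop 1 e) x∉P fr (fits-drop e fs))) fs
        half : ∀ {i y} → i < a → P y ≡ false → Fresh a ρ y → ρ i ~ v ≡ true → y ~ v ≡ true → y ~ ρ i ≡ false → Goal
        half {i} {y} i<a y∉P fr i~v y~v y≁i = classify₁ y∉P fr y~v λ e e∈ fs →
          case ∨-true (is false (r ! i)) (allBelow-sound (every-sound sub e∈) i i<a) of λ
          { (inj₁ q) → ⊥-elim (bit-true v∈P i~v q)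
          ; (inj₂ q) → true≢false (rel-~ (Fits-!₀ {r = e} {i = suc i} fs (is-sound q))) y≁i }
      module Two (u v : V) (u∈P : P u ≡ true) (v∈P : P v ≡ true) (u~v : u ~ v ≡ true) where
        open One v v∈P using (rl₁; fresh₁)
        fit₂ : Fits (v ◂ ρ) 0 (true ∷ r) u
        fit₂ = (~⇒≢ u~v , u~v) , fits-shift 0 r (proj₂ (P-elim u∈P))
        rl₂ : Real p₂ (u ◂ v ◂ ρ)
        rl₂ = addOldest (true ∷ r) p₁ (trans (cong suc le) (sym (length-oldest r A))) fit₂ rl₁
        fresh₂ : ∀ {x} → P x ≡ false → Fresh a ρ x → Fresh (length p₂) (u ◂ v ◂ ρ) x
        fresh₂ x∉P fr = subst (λ k → Fresh k (u ◂ v ◂ ρ) _) (sym (length-oldest (true ∷ r) p₁)) (◂-fresh (∉≢∈ x∉P u∈P) (fresh₁ x∉P fr))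
        classify₂ : ∀ {x t E β β′} → ends nothing p₂ (β ∷ β′ ∷ []) t ≡ just E → P x ≡ false → Fresh a ρ x → x ~ u ≡ β → x ~ v ≡ β′ →
          (∀ e → e ∈ sift keep₂ E → Fits (u ◂ v ◂ ρ) 0 e x → Goal) → Goal
        classify₂ {x} {t} {E} eq x∉P fr x-u x-v k = ends-sound p₂ t eq tt z≤n (λ _ ()) rl₂ x (fresh₂ x∉P fr) tt
          (subst (2 ≤_) (sym (trans (length-oldest (true ∷ r) p₁) (cong suc (length-oldest r A)))) (s≤s (s≤s z≤n)))
          ((∉≢∈ x∉P u∈P , x-u) , (∉≢∈ x∉P v∈P , x-v) , tt)
          λ e e∈ fs → k e (sift-∈ E e∈ (kept (drop 1 (drop 1 e)) x∉P fr (fits-drop (drop 1 e) (fits-drop e fs)))) fs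
      module Three (s u v : V) (s∈P : P s ≡ true) (u∈P : P u ≡ true) (v∈P : P v ≡ true)
        (s~u : s ~ u ≡ true) (u~v : u ~ v ≡ true) (s-v : Rel false s v) where
        open Two u v u∈P v∈P u~v using (rl₂; fresh₂)
        rl₃ : Real p₃ (s ◂ u ◂ v ◂ ρ)
        rl₃ = addOldest (true ∷ false ∷ r) p₂
          (trans (cong (2 +_) le) (sym (trans (length-oldest (true ∷ r) p₁) (cong suc (length-oldest r A)))))
          ((~⇒≢ s~u , s~u) , s-v , fits-shift 1 r (fits-shift 0 r (proj₂ (P-elim s∈P)))) rl₂
        fresh₃ : ∀ {x} → P x ≡ false → Fresh a ρ x → Fresh (length p₃) (s ◂ u ◂ v ◂ ρ) x
        fresh₃ x∉P fr = subst (λ k → Fresh k (s ◂ u ◂ v ◂ ρ) _) (sym (length-oldest (true ∷ false ∷ r) p₂)) (◂-fresh (∉≢∈ x∉P s∈P) (fresh₂ x∉P fr))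
        classify₃ : ∀ {x t E β β′ β″} → ends nothing p₃ (β ∷ β′ ∷ β″ ∷ []) t ≡ just E → P x ≡ false → Fresh a ρ x →
          x ~ s ≡ β → x ~ u ≡ β′ → x ~ v ≡ β″ → (∀ e → e ∈ sift keep₃ E → Fits (s ◂ u ◂ v ◂ ρ) 0 e x → Goal) → Goal
        classify₃ {x} {t} {E} eq x∉P fr x-s x-u x-v k = ends-sound p₃ t eq tt z≤n (λ _ ()) rl₃ x (fresh₃ x∉P fr) tt
          (subst (3 ≤_) (sym (trans (length-oldest (true ∷ false ∷ r) p₂)
            (cong suc (trans (length-oldest (true ∷ r) p₁) (cong suc (length-oldest r A)))))) (s≤s (s≤s (s≤s z≤n))))
          ((∉≢∈ x∉P s∈P , x-s) , (∉≢∈ x∉P u∈P , x-u) , (∉≢∈ x∉P v∈P , x-v) , tt)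
          λ e e∈ fs → k e (sift-∈ E e∈ (kept (drop 1 (drop 1 (drop 1 e))) x∉P fr (fits-drop (drop 1 (drop 1 e)) (fits-drop (drop 1 e) (fits-drop e fs))))) fs
      connect : ∀ x y → P x ≡ false → P y ≡ false → x ≢ y → x ~ y ≡ false → Path P x y → Goal
      connect x y x∉P y∉P x≢y x≁y path = go (fresh? a ρ x) (fresh? a ρ y) path
        where
        go : (Σ ℕ λ i → (i < a) × (x ≡ ρ i)) ⊎ Fresh a ρ x → (Σ ℕ λ i → (i < a) × (y ≡ ρ i)) ⊎ Fresh a ρ y → Path P x y → Goal
        go (inj₁ (i , i<a , refl)) _ (path₂ u v u∈ v∈ x~u x≁v _ _ _) = uniform i<a u∈ v∈ x~u x≁v
        go (inj₁ (i , i<a , refl)) _ (path₃ s u v s∈ u∈ v∈ x~s x≁u _ _ _ _ _ _ _ _) = uniform i<a s∈ u∈ x~s x≁u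
        go (inj₂ _) (inj₁ (j , j<a , refl)) (path₂ u v u∈ v∈ _ _ y≁u y~v _) = uniform j<a v∈ u∈ y~v y≁u
        go (inj₂ _) (inj₁ (j , j<a , refl)) (path₃ s u v s∈ u∈ v∈ _ _ _ _ y≁u y~v _ _ _ _) = uniform j<a v∈ u∈ y~v y≁u
        go (inj₁ (i , i<a , refl)) (inj₁ (j , j<a , refl)) (path₁ v v∈ x~v y~v)
          with ∨-true (i ≡ᵇ j) (allBelow-sound (allBelow-sound cl i i<a) j j<a)
        ... | inj₁ e = ⊥-elim (x≢y (cong ρ (≡ᵇ⇒≡ {i} e)))
        ... | inj₂ e with ∨-true (is false (r ! i)) e
        ...   | inj₁ e₁ = ⊥-elim (bit-true v∈ x~v e₁)
        ...   | inj₂ e₁ with ∨-true (is false (r ! j)) e₁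
        ...     | inj₁ e₂ = ⊥-elim (bit-true v∈ y~v e₂)
        ...     | inj₂ e₂ = true≢false (rel-~ (lookupᴷ-sound A {i = i} {j} refl rl (is-sound e₂))) x≁y
        go (inj₁ (i , i<a , refl)) (inj₂ y-fr) (path₁ v v∈ x~v y~v) = One.half v v∈ i<a y∉P y-fr x~v y~v (~-sym x≁y)
        go (inj₂ x-fr) (inj₁ (j , j<a , refl)) (path₁ v v∈ x~v y~v) = One.half v v∈ j<a x∉P x-fr y~v x~v x≁y
        go (inj₂ x-fr) (inj₂ y-fr) (path₁ v v∈ x~v y~v) =
          classify₁ x∉P x-fr x~v λ e e∈ fs → classify₁ y∉P y-fr y~v λ e′ e′∈ fs′ →
          case triangle-∈ (sift keep₁ E₁) ts₁ tri e∈ e′∈ of λ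
          { (inj₁ rf) → refute rf z≤n (λ _ ()) rl₁ x y (fresh₁ x∉P x-fr) (fresh₁ y∉P y-fr) x≢y fs fs′ (~-sym x≁y)
          ; (inj₂ rf) → refute rf z≤n (λ _ ()) rl₁ y x (fresh₁ y∉P y-fr) (fresh₁ x∉P x-fr) (x≢y ∘ sym) fs′ fs x≁y }
          where open One v v∈
        go (inj₂ x-fr) (inj₂ y-fr) (path₂ u v u∈ v∈ x~u x≁v y≁u y~v u~v) =
          classify₂ {t = t₂} eq₂ x∉P x-fr x~u x≁v λ e e∈ fs → classify₂ {t = u₂} eq₂′ y∉P y-fr y≁u y~v λ e′ e′∈ fs′ →
          refute (rectangle-∈ (sift keep₂ E₂) (sift keep₂ E₂′) ts₂ rect₂ e∈ e′∈) z≤n (λ _ ()) rl₂ x y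
            (fresh₂ x∉P x-fr) (fresh₂ y∉P y-fr) x≢y fs fs′ (~-sym x≁y)
          where open Two u v u∈ v∈ u~v
        go (inj₂ x-fr) (inj₂ y-fr) (path₃ s u v s∈ u∈ v∈ x~s x≁u x≁v y≁s y≁u y~v s~u u~v s≁v s≢v) =
          classify₃ {t = t₃} eq₃ x∉P x-fr x~s x≁u x≁v λ e e∈ fs → classify₃ {t = u₃} eq₃′ y∉P y-fr y≁s y≁u y~v λ e′ e′∈ fs′ →
          refute (rectangle-∈ (sift keep₃ E₃) (sift keep₃ E₃′) ts₃ rect₃ e∈ e′∈) z≤n (λ _ ()) rl₃ x y
            (fresh₃ x∉P x-fr) (fresh₃ y∉P y-fr) x≢y fs fs′ (~-sym x≁y)
          where open Three s u v s∈ u∈ v∈ s~u u~v (s≢v , s≁v)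

  path-left : ∀ {P x y} → Path P x y → Σ V λ d → (P d ≡ true) × (d ~ x ≡ true)
  path-left (path₁ a a∈ x~a _) = a , a∈ , ~-sym x~a
  path-left (path₂ a b a∈ _ x~a _ _ _ _) = a , a∈ , ~-sym x~a
  path-left (path₃ a b c a∈ _ _ x~a _ _ _ _ _ _ _ _ _) = a , a∈ , ~-sym x~a

  path-right : ∀ {P x y} → Path P x y → Σ V λ d → (P d ≡ true) × (d ~ y ≡ true)
  path-right (path₁ a a∈ _ y~a) = a , a∈ , ~-sym y~a
  path-right (path₂ a b _ b∈ _ _ _ y~b _) = b , b∈ , ~-sym y~b
  path-right (path₃ a b c _ _ c∈ _ _ _ _ _ y~c _ _ _ _) = c , c∈ , ~-sym y~c

  module Separation (Γ : List Pat) (Γ-excl : All Excluded Γ) (B : Pat) (mode : Maybe Bool) (ρ : ℕ → V)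
    (O : Sound.Oracle Γ Γ-excl B mode ρ mode) (rl : Real B ρ) where

    open At Γ Γ-excl B mode ρ O
    open OnBase rl

    -- Every neighbour of the region outside it belongs to the clique `c`, as `outer` shows, so a
    -- path through the region cannot have non-adjacent ends and `region` falls back on the cutset.
    sep-sound : ∀ a r q t c tss → sepCheck a r q t c tss ≡ true → Goal
    sep-sound a r q t c tss check with within-sound check
    ... | E , eqE , ok with ∧-true (length r ≡ᵇ a) ok
    ... | len , ok₁ with ∧-true (a <ᵇ b) ok₁
    ... | a<ᵇb , ok₂ with ∧-true (allBelow b _) ok₂
    ... | extras , ok₃ with ∧-true (every _ E) ok₃
    ... | full , ok₄ with ∧-true (cliqueOK E c) ok₄
    ... | okc , ok₅ with ∧-true (allBelow a _) ok₅
    ... | sides , ok₆ with ∧-true (q <ᵇ a) ok₆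
    ... | q<ᵇa , ok₇ with ∧-true (is false (r ! q)) ok₇
    ... | rq , ok₈ with ∧-true (every _ (sift (outside a r (rowsOf E c)) E)) ok₈
    ... | quiet , rect = region P (ρ a) (dec-true (P? (ρ a)) (extra a ≤-refl (<ᵇ⇒< a<ᵇb))) (ρ q)
        (dec-false (P? (ρ q)) λ (fr , _) → fr q (<ᵇ⇒< q<ᵇa) refl)
        (λ v v∈P → rel-~ (Fits-!₀ {r = r} (proj₂ (P-elim v∈P)) (is-sound rq))) connect
      where
      le : length r ≡ a
      le = ≡ᵇ⇒≡ {length r} len
      P? : ∀ x → Dec (Fresh a ρ x × Fits ρ 0 r x)
      P? x = freshDec a ρ x ×-dec fits? ρ 0 r x
      P : V → Bool
      P x = does (P? x)
      P-elim : ∀ {v} → P v ≡ true → Fresh a ρ v × Fits ρ 0 r v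
      P-elim {v} = does-true (P? v)
      extra : ∀ i → a ≤ i → i < b → Fresh a ρ (ρ i) × Fits ρ 0 r (ρ i)
      extra i a≤i i<b with ∨-true (i <ᵇ a) (allBelow-sound extras i i<b)
      ... | inj₁ e = ⊥-elim (ℕₚ.<⇒≱ (<ᵇ⇒< e) a≤i)
      ... | inj₂ e = (λ j j<a → rel-≢ (proj₁ (proj₂ (proj₂ (at j j<a))))) , fits-tabulate 0 r λ j β q →
          subst (λ z → Rel β (ρ i) (ρ z)) (sym (ℕₚ.+-identityʳ j))
            (let β′ , q′ , rel , _ = at j (subst (j <_) le (!-< r q)) in
              subst (λ γ → Rel γ (ρ i) (ρ j)) (just-inj (trans (sym q′) q)) rel)
        where
        just-inj : ∀ {x y : Bool} → just x ≡ just y → x ≡ y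
        just-inj refl = refl
        at : ∀ j → j < a → Σ Bool λ β → (r ! j ≡ just β) × Rel β (ρ i) (ρ j) × ⊤
        at j j<a with same-sound (allBelow-sound e j j<a)
        ... | β , q₁ , q₂ = β , q₂ , K-sound q₁ , tt
      outer : ∀ d z → P d ≡ true → P z ≡ false → ¬ Mem E c z → d ~ z ≡ true → Goal
      outer d z d∈P z∉P z∉X d~z = go (fresh? b ρ z)
        where
        d-fr = proj₁ (P-elim d∈P)
        inP : ∀ {z} → P z ≡ false → Fresh a ρ z → Fits ρ 0 r z → Goal
        inP {z} z∉P fr fs = true≢false (dec-true (P? z) (fr , fs)) z∉P
        low-fresh : ∀ {z} → Fresh b ρ z → Fresh a ρ z
        low-fresh fr i i<a = fr i (≤-trans i<a (ℕₚ.<⇒≤ (<ᵇ⇒< a<ᵇb)))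
        go : (Σ ℕ λ i → (i < b) × (z ≡ ρ i)) ⊎ Fresh b ρ z → Goal
        go (inj₁ (i , i<b , refl)) with i ℕₚ.<? a
        ... | no i≮a = let fr , fs = extra i (ℕₚ.≮⇒≥ i≮a) i<b in inP z∉P fr fs
        ... | yes i<a with ∨-true (member i (basesOf c)) (allBelow-sound sides i i<a)
        ...   | inj₁ e = ⊥-elim (z∉X (inj₁ (lose (member-sound (basesOf c) e) refl)))
        ...   | inj₂ e = true≢false d~z (rel-~ (Fits-!₀ {r = r} (proj₂ (P-elim d∈P)) (is-sound e)))
        go (inj₂ z-fr) = classify {t} eqE z z-fr λ e e∈ fs → use e e∈ fs (bool? (eqRow (take a e) r)) (bool? (memberRow e (rowsOf E c)))
          where
          use : ∀ e → e ∈ E → Fits ρ 0 e z → (eqRow (take a e) r ≡ true) ⊎ (eqRow (take a e) r ≡ false) →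
            (memberRow e (rowsOf E c) ≡ true) ⊎ (memberRow e (rowsOf E c) ≡ false) → Goal
          use e e∈ fs (inj₁ q) _ = inP z∉P (low-fresh z-fr) (subst (λ s → Fits ρ 0 s z) (eqRow-sound (take a e) r q) (fits-prefix 0 a e fs))
          use e e∈ fs (inj₂ _) (inj₁ q) = ⊥-elim (z∉X (inj₂ (z-fr , lose (memberRow-sound (rowsOf E c) q) fs)))
          use e e∈ fs (inj₂ q) (inj₂ q′) = final (fresh? b ρ d)
            where
            e∈O : e ∈ sift (outside a r (rowsOf E c)) E
            e∈O = sift-∈ E e∈ (∧-intro (cong not q) (cong not q′))
            final : (Σ ℕ λ i → (i < b) × (d ≡ ρ i)) ⊎ Fresh b ρ d → Goal
            final (inj₁ (i , i<b , refl)) with ∨-true (i <ᵇ a) (allBelow-sound (every-sound quiet e∈O) i i<b)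
            ... | inj₁ i<ᵇa = ⊥-elim (d-fr i (<ᵇ⇒< i<ᵇa) refl)
            ... | inj₂ ei = true≢false (~-sym d~z) (rel-~ (Fits-!₀ {r = e} fs (is-sound ei)))
            final (inj₂ d-fr′) = classify {t} eqE d d-fr′ λ e′ e′∈ fs′ →
              refute (rectangle-∈ (sift (inside a r) E) (sift (outside a r (rowsOf E c)) E) tss rect
                  (sift-∈ E e′∈ (subst (λ k → eqRow (take k e′) r ≡ true) le
                    (subst (λ s → eqRow s r ≡ true) (sym (fits-take 0 r e′ (proj₂ (P-elim d∈P)) fs′ (long e′∈))) (eqRow-refl r)))) e∈O)
                ≤-refl (λ _ _ → refl) rl d z d-fr′ z-fr (~⇒≢ d~z) fs′ fs (~-sym d~z)
              where
              long : ∀ {e′} → e′ ∈ E → length r ≤ length e′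
              long {e′} e′∈ = ≤-trans (≤-reflexive le) (≤-trans (ℕₚ.<⇒≤ (<ᵇ⇒< a<ᵇb))
                (≤-reflexive (sym (≡ᵇ⇒≡ {length e′} (every-sound full e′∈)))))
      connect : ∀ x y → P x ≡ false → P y ≡ false → x ≢ y → x ~ y ≡ false → Path P x y → Goal
      connect x y x∉P y∉P x≢y x≁y path with mem? E c x | mem? E c y
      ... | yes mx | yes my = mem-clique c okc x y mx my x≢y x≁y
      ... | no ¬mx | _ = let d , d∈ , d~x = path-left path in outer d x d∈ x∉P ¬mx d~x
      ... | yes _ | no ¬my = let d , d∈ , d~y = path-right path in outer d y d∈ y∉P ¬my d~y

  -- Copies with extremal degree sum

  fits-map : ∀ {ρ ρ′ x x′} j r → (∀ i β → i < j + length r → Rel β x (ρ i) → Rel β x′ (ρ′ i)) → Fits ρ j r x → Fits ρ′ j r x′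
  fits-map j [] f _ = tt
  fits-map j (β ∷ r) f (g , gs) = f j β (ℕₚ.m<m+n j (s≤s z≤n)) g ,
    fits-map (suc j) r (λ i β′ i< → f i β′ (subst (i <_) (sym (ℕₚ.+-suc j (length r))) i<)) gs

  real-map : ∀ {ρ ρ′} p → (∀ i j β → i < length p → j < length p → Rel β (ρ i) (ρ j) → Rel β (ρ′ i) (ρ′ j)) →
    Real p ρ → Real p ρ′
  real-map [] f _ = tt
  real-map (r ∷ p) f (len , fs , rl) = len ,
    fits-map 0 r (λ i β i<r → f (length p) i β ≤-refl (≤-trans i<r (≤-trans len (n≤1+n _)))) fs ,
    real-map p (λ i j β i<p j<p → f i j β (≤-trans i<p (n≤1+n _)) (≤-trans j<p (n≤1+n _))) rl

  cdeg≤n : ∀ v → cdeg v ≤ n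
  cdeg≤n v = subst (cdeg v ≤_) (count-all n) (∑-mono λ i → bit-mono {closed v i} {true} λ _ → refl)

  -- Choosing the realisation of B with extremal degree sum: replacing the vertex q of the base by a vertex x with the
  -- same neighbours in the base cannot improve the sum, so no closed neighbourhood is properly nested the wrong way.
  extremal : ∀ Γ (Γ-excl : All Excluded Γ) B μ →
    (∀ ρ → Real B ρ → Sound.Oracle Γ Γ-excl B (just μ) ρ (just μ) → Goal) → Impossible B
  extremal Γ Γ-excl B μ k ρ rl = go ρ rl (<-wellFounded (weight ρ))
    where
    open Sound Γ Γ-excl B (just μ) using (low; high)
    cost : Bool → V → ℕ
    cost true  v = cdeg v
    cost false v = n ∸ cdeg v
    weight : (ℕ → V) → ℕ
    weight ρ = sumBelow (length B) (cost μ ∘ ρ)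
    -- Without such a `z`, the closed neighbourhood of `s` would lie inside that of `t`, properly
    -- because of `y`, against the comparison of sizes.
    nested : ∀ s t y → s ~ t ≡ true → y ~ t ≡ true → y ~ s ≡ false → y ≢ s → cdeg t ≤ cdeg s →
      (∀ z → z ~ s ≡ true → z ~ t ≡ false → z ≢ t → Goal) → Goal
    nested s t y s~t y~t y≁s y≢s le k′ with any? (λ z → (z ~ s 𝔹.≟ true) ×-dec ((z ~ t 𝔹.≟ false) ×-dec ¬? (z ≟ t)))
    ... | yes (z , z~s , z≁t , z≢t) = k′ z z~s z≁t z≢t
    ... | no ¬z = ⊥-elim (ℕₚ.<⇒≱ (count-mono-< sub y (cong₂ _∨_ (≢⇒== y≢s) (~-sym y≁s)) (∨-introʳ (y == t) (~-sym y~t))) le)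
      where
      sub : ∀ z → closed s z ≡ true → closed t z ≡ true
      sub z e with z ≟ t
      ... | yes _ = refl
      ... | no z≢t with bool? (z ~ t)
      ...   | inj₁ z~t = ~-sym z~t
      ...   | inj₂ z≁t with ∨-true (z == s) e
      ...     | inj₁ z≡s = true≢false s~t (subst (λ v → v ~ t ≡ false) (==⇒≡ {u = z} {s} z≡s) z≁t)
      ...     | inj₂ s~z = ⊥-elim (¬z (z , ~-sym s~z , z≁t , z≢t))
    go : ∀ ρ → Real B ρ → Acc _<_ (weight ρ) → Goal
    go ρ rl (acc rec) = k ρ rl oracle
      where
      replace : ∀ q x → q < length B → (∀ i → i < length B → i ≢ q → Σ Bool λ β → Rel β x (ρ i) × Rel β (ρ q) (ρ i)) →
        Real B (upd ρ q x)
      replace q x q<B twin = real-map B swap-in rl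
        where
        swap-in : ∀ i j β → i < length B → j < length B → Rel β (ρ i) (ρ j) → Rel β (upd ρ q x i) (upd ρ q x j)
        swap-in i j β i<B j<B rel with i ≡ᵇ q in eqi | j ≡ᵇ q in eqj
        ... | true | true = ⊥-elim (rel-≢ rel (cong ρ (trans (≡ᵇ⇒≡ {i} eqi) (sym (≡ᵇ⇒≡ {j} eqj)))))
        ... | false | false = rel
        ... | true | false with twin j j<B (λ { refl → true≢false (≡ᵇ-refl j) eqj })
        ...   | β′ , rel₁ , rel₂ = subst (λ γ → Rel γ x (ρ j)) (Rel-bit rel₂ (subst (λ z → Rel β (ρ z) (ρ j)) (≡ᵇ⇒≡ {i} eqi) rel)) rel₁
        swap-in i j β i<B j<B rel | false | true with twin i i<B (λ { refl → true≢false (≡ᵇ-refl i) eqi })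
        ... | β′ , rel₁ , rel₂ = Rel-sym (subst (λ γ → Rel γ x (ρ i))
            (Rel-bit rel₂ (subst (λ z → Rel β (ρ z) (ρ i)) (≡ᵇ⇒≡ {j} eqj) (Rel-sym rel))) rel₁)
      oracle : Sound.Oracle Γ Γ-excl B (just μ) ρ (just μ)
      -- A cheaper clone gives a copy of smaller weight, from which the whole argument restarts;
      -- otherwise the comparison of costs feeds `nested`.
      oracle q x y q<B twin x~q y~t y≁s y≢s k′ with cost μ x ℕₚ.<? cost μ (ρ q)
      ... | yes lt = go (upd ρ q x) (replace q x q<B twin) (rec (sumBelow-< (length B) q q<B
          (subst (λ v → cost μ v < cost μ (ρ q)) (sym (upd-here ρ q x)) lt)
          λ i i<B i≢q → cong (cost μ) (same-vertex i i≢q)))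
        where
        same-vertex : ∀ i → i ≢ q → upd ρ q x i ≡ ρ i
        same-vertex i i≢q with i ≡ᵇ q in eq
        ... | false = refl
        ... | true = ⊥-elim (i≢q (≡ᵇ⇒≡ eq))
      ... | no ≮ = nested (low ρ μ (ρ q) x) (high ρ μ (ρ q) x) y (edge μ) y~t y≁s y≢s (order μ ≮) k′
        where
        edge : ∀ μ → low ρ μ (ρ q) x ~ high ρ μ (ρ q) x ≡ true
        edge true = x~q
        edge false = ~-sym x~q
        order : ∀ μ → ¬ (cost μ x < cost μ (ρ q)) → cdeg (high ρ μ (ρ q) x) ≤ cdeg (low ρ μ (ρ q) x)
        order true ≮ = ℕₚ.≮⇒≥ ≮
        order false ≮ with cdeg x ℕₚ.≤? cdeg (ρ q)
        ... | yes p = p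
        ... | no ≰ = ⊥-elim (≮ (ℕₚ.∸-monoʳ-< (ℕₚ.≰⇒> ≰) (cdeg≤n x)))

  -- Graphs obtained by replacing base vertices by cliques

  module Blowup (Γ : List Pat) (Γ-excl : All Excluded Γ) (B : Pat) (ρ : ℕ → V) (rl : Real B ρ) where

    open At Γ Γ-excl B nothing ρ tt
    open OnBase rl

    Ok : ℕ → ℕ → Set
    Ok i j = (i ≡ j) ⊎ (ρ i ~ ρ j ≡ true)

    ok? : ∀ i j → Dec (Ok i j)
    ok? i j = (i ℕₚ.≟ j) ⊎-dec (ρ i ~ ρ j 𝔹.≟ true)

    Ok-sym : ∀ {i j} → Ok i j → Ok j i
    Ok-sym (inj₁ e) = inj₁ (sym e)
    Ok-sym (inj₂ e) = inj₂ (~-sym e)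

    compat-sound : ∀ i j → compat i j ≡ true → Ok i j
    compat-sound i j e with ∨-true (i ≡ᵇ j) e
    ... | inj₁ q = inj₁ (≡ᵇ⇒≡ q)
    ... | inj₂ q = inj₂ (rel-~ (K-sound (is-sound q)))

    twinRow-∈ : ∀ {e i e′ j} es ts → twinRow e i es ts ≡ true → (e′ , j) ∈ es → Ok i j ⊎ Refutes B true e e′
    twinRow-∈ {e} {i} ((f , l) ∷ es) ts q m with compat i l in eq
    twinRow-∈ {e} {i} ((f , l) ∷ es) ts q (here refl) | true = inj₁ (compat-sound i l eq)
    twinRow-∈ {e} {i} ((f , l) ∷ es) ts q (there m) | true = twinRow-∈ es ts q m
    twinRow-∈ {e} {i} ((f , l) ∷ es) (t ∷ ts) q (here refl) | false = inj₂ (t , proj₁ (∧-true (pairPrf B true e f t) q))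
    twinRow-∈ {e} {i} ((f , l) ∷ es) (t ∷ ts) q (there m) | false = twinRow-∈ es ts (proj₂ (∧-true (pairPrf B true e f t) q)) m

    twinPairs-∈ : ∀ {e i e′ j} es tss → twinPairs es tss ≡ true → (e , i) ∈ es → (e′ , j) ∈ es →
      Ok i j ⊎ (Refutes B true e e′ ⊎ Refutes B true e′ e)
    twinPairs-∈ ((f , l) ∷ es) (ts ∷ tss) q m m′ with ∧-true (twinRow f l ((f , l) ∷ es) ts) q
    twinPairs-∈ ((f , l) ∷ es) (ts ∷ tss) q (here refl) m′ | r , _ with twinRow-∈ ((f , l) ∷ es) ts r m′
    ... | inj₁ o = inj₁ o
    ... | inj₂ o = inj₂ (inj₁ o)
    twinPairs-∈ ((f , l) ∷ es) (ts ∷ tss) q (there m) (here refl) | r , _ with twinRow-∈ ((f , l) ∷ es) ts r (there m)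
    ... | inj₁ o = inj₁ (Ok-sym o)
    ... | inj₂ o = inj₂ (inj₂ o)
    twinPairs-∈ ((f , l) ∷ es) (ts ∷ tss) q (there m) (there m′) | _ , rest = twinPairs-∈ es tss rest m m′

    -- All vertices are clones of base vertices, so every clique outside the base extends by two base vertices; removing the
    -- base costs three colours and lowers the clique number by two.
    blowup-sound : ∀ t ids col nb tss → blowupCheck t ids col nb tss ≡ true → Goal
    blowup-sound t ids col nb tss check with within-sound check
    ... | E , eqE , ok with ∧-true (every twinOK (zipId E ids)) ok
    ... | twins , ok₁ with ∧-true (twinPairs (zipId E ids) tss) ok₁
    ... | pairs , ok₂ with ∧-true (0 <ᵇ b) ok₂
    ... | 0<ᵇb , ok₃ with ∧-true (allBelow b _) ok₃
    ... | nbs , cols = decide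
      where
      T? : ∀ x → Dec (Any (λ ei → Fits ρ 0 (proj₁ ei) x) (zipId E ids))
      T? x = Any.any? (λ ei → fits? ρ 0 (proj₁ ei) x) (zipId E ids)
      Clash : V → V → Set
      Clash x y = Any (λ ei → Any (λ ei′ → Fits ρ 0 (proj₁ ei) x × Fits ρ 0 (proj₁ ei′) y × ¬ Ok (proj₂ ei) (proj₂ ei′)) (zipId E ids)) (zipId E ids)
      clash? : ∀ x y → Dec (Clash x y)
      clash? x y = Any.any? (λ ei → Any.any? (λ ei′ → fits? ρ 0 (proj₁ ei) x ×-dec (fits? ρ 0 (proj₁ ei′) y ×-dec ¬? (ok? (proj₂ ei) (proj₂ ei′)))) (zipId E ids)) (zipId E ids)
      module Blown (typed : ∀ x → Fresh b ρ x → Any (λ ei → Fits ρ 0 (proj₁ ei) x) (zipId E ids))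
        (agree : ∀ x y → Fresh b ρ x → Fresh b ρ y → x ~ y ≡ true → ¬ Clash x y) where
        id : ∀ x → Fresh b ρ x → ℕ
        id x fr = proj₂ (proj₁ (find (typed x fr)))
        row : ∀ x → Fresh b ρ x → Row
        row x fr = proj₁ (proj₁ (find (typed x fr)))
        row-fits : ∀ x fr → Fits ρ 0 (row x fr) x
        row-fits x fr = proj₂ (proj₂ (find (typed x fr)))
        row-∈ : ∀ x fr → (row x fr , id x fr) ∈ zipId E ids
        row-∈ x fr = proj₁ (proj₂ (find (typed x fr)))
        id<b : ∀ x fr → id x fr < b
        id<b x fr = <ᵇ⇒< (proj₁ (∧-true (id x fr <ᵇ b) (every-sound twins (row-∈ x fr))))
        twin : ∀ x fr j → j < b → (if j ≡ᵇ id x fr then is true (row x fr ! j) else same (row x fr ! j) (K (id x fr) j)) ≡ true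
        twin x fr j j<b = allBelow-sound (proj₂ (∧-true (id x fr <ᵇ b) (every-sound twins (row-∈ x fr)))) j j<b
        adjacent : ∀ x fr j → j < b → Ok (id x fr) j → ρ j ~ x ≡ true
        adjacent x fr j j<b o with j ≡ᵇ id x fr in eq | twin x fr j j<b
        ... | true | q = ~-sym (rel-~ (Fits-!₀ {r = row x fr} (row-fits x fr) (is-sound q)))
        ... | false | q with o
        ...   | inj₁ refl = true≢false (≡ᵇ-refl (id x fr)) eq
        ...   | inj₂ i~j with same-sound q
        ...     | β , q₁ , q₂ = ~-sym (trans (rel-~ (Fits-!₀ {r = row x fr} (row-fits x fr) q₁)) (trans (sym (rel-~ (K-sound {id x fr} q₂))) i~j))
        ids-ok : ∀ x y frx fry → x ~ y ≡ true → Ok (id x frx) (id y fry)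
        ids-ok x y frx fry x~y with ok? (id x frx) (id y fry)
        ... | yes o = o
        ... | no ¬o = ⊥-elim (agree x y frx fry x~y
            (lose (row-∈ x frx) (lose (row-∈ y fry) (row-fits x frx , row-fits y fry , ¬o))))
        0<b : 0 < b
        0<b = <ᵇ⇒< 0<ᵇb
        nb< : ∀ i → i < b → digit nb i < b
        nb< i i<b = <ᵇ⇒< (proj₁ (∧-true (digit nb i <ᵇ b) (allBelow-sound nbs i i<b)))
        nb~ : ∀ i → i < b → ρ i ~ ρ (digit nb i) ≡ true
        nb~ i i<b = rel-~ (K-sound {i} {digit nb i} (is-sound (proj₂ (∧-true (digit nb i <ᵇ b) (allBelow-sound nbs i i<b)))))
        grow : ∀ {k} (f : Fin k → V) → IsClique G f → ∀ i j → ρ i ~ ρ j ≡ true → (∀ c → ρ i ~ f c ≡ true) → (∀ c → ρ j ~ f c ≡ true) → 2 + k ≤ w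
        grow {k} f cl i j i~j i~f j~f with clique-cons f cl (ρ i) i~f
        ... | g , gcl , g-ext with clique-cons g gcl (ρ j) (g-ext (ρ j) j~f (~-sym i~j))
        ...   | h , hcl , _ = bound (2 + k) (h , hcl)
        -- If two members are clones of different base vertices, those two base vertices are
        -- adjacent and complete to the clique. If all are clones of one base vertex, that vertex
        -- and its chosen neighbour can be added.
        cliques : ∀ k (f : Fin k → V) → (∀ c → Fresh b ρ (f c)) → IsClique G f → 2 + k ≤ w
        cliques zero f fr cl = grow f cl 0 (digit nb 0) (nb~ 0 0<b) (λ ()) λ ()
        cliques (suc k) f fr cl@(_ , f-adj) with any? (λ c → ¬? (id (f c) (fr c) ℕₚ.≟ id (f zero) (fr zero)))
        ... | yes (c , c≢) = grow f cl (ι zero) (ι c) (link (all-ok zero c)) (full zero) (full c)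
          where
          ι : Fin (suc k) → ℕ
          ι c = id (f c) (fr c)
          all-ok : ∀ c d → Ok (ι c) (ι d)
          all-ok c d with c ≟ d
          ... | yes refl = inj₁ refl
          ... | no c≢d = ids-ok (f c) (f d) (fr c) (fr d) (T⇒≡true (f-adj c d c≢d))
          link : Ok (ι zero) (ι c) → ρ (ι zero) ~ ρ (ι c) ≡ true
          link (inj₁ e) = ⊥-elim (c≢ (sym e))
          link (inj₂ e) = e
          full : ∀ c d → ρ (ι c) ~ f d ≡ true
          full c d = adjacent (f d) (fr d) (ι c) (id<b (f c) (fr c)) (all-ok d c)
        ... | no same-id = grow f cl i (digit nb i) (nb~ i i<b)
            (λ c → adjacent (f c) (fr c) i i<b (inj₁ (≡i c)))
            (λ c → adjacent (f c) (fr c) (digit nb i) (nb< i i<b) (inj₂ (subst (λ j → ρ j ~ ρ (digit nb i) ≡ true) (sym (≡i c)) (nb~ i i<b))))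
          where
          i = id (f zero) (fr zero)
          i<b = id<b (f zero) (fr zero)
          ≡i : ∀ c → id (f c) (fr c) ≡ i
          ≡i c with id (f c) (fr c) ℕₚ.≟ i
          ... | yes e = e
          ... | no ≢ = ⊥-elim (same-id (c , ≢))
        X : V → Bool
        X v = not (does (freshDec b ρ v))
        X-false : ∀ {v} → not (X v) ≡ true → Fresh b ρ v
        X-false {v} e = does-true (freshDec b ρ v) (trans (sym (𝔹.not-involutive _)) e)
        X-true : ∀ {v} → X v ≡ true → Σ ℕ λ i → (i < b) × (v ≡ ρ i)
        X-true {v} e with fresh? b ρ v
        ... | inj₁ p = p
        colour : ∀ v → (Σ ℕ λ i → (i < b) × (v ≡ ρ i)) ⊎ Fresh b ρ v → ℕ
        colour v (inj₁ (i , _)) = digit col i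
        colour v (inj₂ _) = 0
        colour< : ∀ v s → colour v s < 3
        colour< v (inj₁ (i , i<b , _)) = <ᵇ⇒< (proj₁ (∧-true (digit col i <ᵇ 3) (allBelow-sound cols i i<b)))
        colour< v (inj₂ _) = s≤s z≤n
        proper : ∀ u v s s′ → X u ≡ true → X v ≡ true → u ~ v ≡ true → colour u s ≢ colour v s′
        proper u v (inj₂ fr) s′ u∈X _ _ = let i , i<b , e = X-true {u} u∈X in ⊥-elim (fr i i<b e)
        proper u v (inj₁ _) (inj₂ fr) _ v∈X _ = let i , i<b , e = X-true {v} v∈X in ⊥-elim (fr i i<b e)
        proper u v (inj₁ (i , i<b , refl)) (inj₁ (j , j<b , refl)) _ _ u~v eq
          with ∨-true (i ≡ᵇ j) (allBelow-sound (proj₂ (∧-true (digit col i <ᵇ 3) (allBelow-sound cols i i<b))) j j<b)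
        ... | inj₁ e = ~⇒≢ u~v (cong ρ (≡ᵇ⇒≡ {i} e))
        ... | inj₂ e with ∨-true (is false (K i j)) e
        ...   | inj₁ e′ = true≢false u~v (rel-~ (K-sound {i} {j} (is-sound e′)))
        ...   | inj₂ e′ = true≢false (subst (λ c → (digit col i ≡ᵇ c) ≡ true) eq (≡ᵇ-refl (digit col i))) (not-true e′)
        three : PColor X 3
        three = (λ v → colour v (fresh? b ρ v)) , (λ v _ → colour< v (fresh? b ρ v)) ,
          λ u v u∈X v∈X u~v → proper u v (fresh? b ρ u) (fresh? b ρ v) u∈X v∈X u~v
        0∈X : X (ρ 0) ≡ true
        0∈X = cong not (dec-false (freshDec b ρ (ρ 0)) λ fr → fr 0 0<b refl)
        finish : ∀ w′ → w ≡ w′ → Goal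
        -- Even the empty clique extends by an edge of the base, so `w` is at least two.
        finish zero e = case subst (2 ≤_) e (cliques 0 (λ ()) (λ ()) ((λ { {()} }) , λ ())) of λ ()
        finish (suc zero) e = case subst (2 ≤_) e (cliques 0 (λ ()) (λ ()) ((λ { {()} }) , λ ())) of λ { (s≤s ()) }
        finish (suc (suc w′)) refl = peel 3 w′ X (ρ 0) 0∈X three
          (λ { k (f , f∈ , cl) → ≤-pred (≤-pred (cliques k f (λ c → X-false (f∈ c)) cl)) }) (half3-2 w′)
      decide : Goal
      decide with any? (λ x → freshDec b ρ x ×-dec ¬? (T? x))
      ... | yes (x , fr , ¬t) = classify {t} eqE x fr λ e e∈ fs → let i , ei∈ = zipId-∈ E ids e∈ in ⊥-elim (¬t (lose ei∈ fs))
      ... | no untyped with any? (λ x → any? λ y → freshDec b ρ x ×-dec (freshDec b ρ y ×-dec ((x ~ y 𝔹.≟ true) ×-dec clash? x y)))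
      ...   | no calm = Blown.finish (λ x fr → typed x fr (T? x)) (λ x y frx fry x~y cl → calm (x , y , frx , fry , x~y , cl)) w refl
        where
        typed : ∀ x → Fresh b ρ x → Dec _ → Any (λ ei → Fits ρ 0 (proj₁ ei) x) (zipId E ids)
        typed x fr (yes p) = p
        typed x fr (no ¬p) = ⊥-elim (untyped (x , fr , ¬p))
      ...   | yes (x , y , frx , fry , x~y , cl) with find cl
      ...     | (e , i) , ei∈ , cl′ with find cl′
      ...       | (e′ , j) , ej∈ , fs , fs′ , ¬o with twinPairs-∈ (zipId E ids) tss pairs ei∈ ej∈
      ...         | inj₁ o = ⊥-elim (¬o o)
      ...         | inj₂ (inj₁ rf) = refute rf ≤-refl (λ _ _ → refl) rl x y frx fry (~⇒≢ x~y) fs fs′ (~-sym x~y)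
      ...         | inj₂ (inj₂ rf) = refute rf ≤-refl (λ _ _ → refl) rl y x fry frx (~⇒≢ x~y ∘ sym) fs′ fs x~y

  -- From checked certificates to excluded graphs

  wf-sound : ∀ p → wfᵇ p ≡ true → WF p
  wf-sound []      _ = tt
  wf-sound (r ∷ p) e with ∧-true (length r ≤ᵇ length p) e
  ... | e₁ , e₂ = ℕₚ.≤ᵇ⇒≤ (length r) (length p) (≡true⇒T e₁) , wf-sound p e₂

  pair-excludes : ∀ {Γ} (Γ-excl : All Excluded Γ) F t c₁ c₂ c₃ → wfᵇ F ∧ Checks.pairCheck Γ F nothing t c₁ c₂ c₃ ≡ true → Excluded F
  pair-excludes {Γ} Γ-excl F t c₁ c₂ c₃ ok with ∧-true (wfᵇ F) ok
  ... | wf , check = wf-sound F wf , λ ρ rl → At.OnBase.pair-sound Γ Γ-excl F nothing ρ tt rl t c₁ c₂ c₃ check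

  pair-excludes-ext : ∀ {Γ} (Γ-excl : All Excluded Γ) F μ t c₁ c₂ c₃ →
    wfᵇ F ∧ Checks.pairCheck Γ F (just μ) t c₁ c₂ c₃ ≡ true → Excluded F
  pair-excludes-ext {Γ} Γ-excl F μ t c₁ c₂ c₃ ok with ∧-true (wfᵇ F) ok
  ... | wf , check = wf-sound F wf , extremal Γ Γ-excl F μ λ ρ rl O →
    At.OnBase.pair-sound Γ Γ-excl F (just μ) ρ O rl t c₁ c₂ c₃ check

  sep-excludes : ∀ {Γ} (Γ-excl : All Excluded Γ) F μ a r q t c tss →
    wfᵇ F ∧ Checks.sepCheck Γ F (just μ) a r q t c tss ≡ true → Excluded F
  sep-excludes {Γ} Γ-excl F μ a r q t c tss ok with ∧-true (wfᵇ F) ok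
  ... | wf , check = wf-sound F wf , extremal Γ Γ-excl F μ λ ρ rl O →
    Separation.sep-sound Γ Γ-excl F (just μ) ρ O rl a r q t c tss check

  uni-excludes : ∀ {Γ} (Γ-excl : All Excluded Γ) F t → wfᵇ F ∧ Checks.uniCheck Γ F nothing t ≡ true → Excluded F
  uni-excludes {Γ} Γ-excl F t ok with ∧-true (wfᵇ F) ok
  ... | wf , check = wf-sound F wf , λ ρ rl → At.OnBase.uni-sound Γ Γ-excl F nothing ρ tt rl t check

  blowup-excludes : ∀ {Γ} (Γ-excl : All Excluded Γ) F t ids col nb tss →
    wfᵇ F ∧ Checks.blowupCheck Γ F nothing t ids col nb tss ≡ true → Excluded F
  blowup-excludes {Γ} Γ-excl F t ids col nb tss ok with ∧-true (wfᵇ F) ok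
  ... | wf , check = wf-sound F wf , λ ρ rl → Blowup.blowup-sound Γ Γ-excl F ρ rl t ids col nb tss check

  region-excludes : ∀ {Γ} (Γ-excl : All Excluded Γ) A r q → wfᵇ (r ∷ A) ∧ RegionCheck.check₀ Γ A r q ≡ true →
    ∀ t₁ ts₁ → RegionCheck.check₁ Γ A r t₁ ts₁ ≡ true → ∀ t₂ u₂ ts₂ → RegionCheck.check₂ Γ A r t₂ u₂ ts₂ ≡ true →
    ∀ t₃ u₃ ts₃ → RegionCheck.check₃ Γ A r t₃ u₃ ts₃ ≡ true → Excluded (r ∷ A)
  region-excludes {Γ} Γ-excl A r q ok t₁ ts₁ ok₁ t₂ u₂ ts₂ ok₂ t₃ u₃ ts₃ ok₃ with ∧-true (wfᵇ (r ∷ A)) ok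
  ... | wf , check₀ with ∧-true (length r ≡ᵇ length A) check₀
  ... | len , _ = wf-sound (r ∷ A) wf , λ ρ (_ , fs , rl) →
    let open Region Γ Γ-excl A r ρ rl in
    region-sound (ρ (length A))
      (dec-true (P? (ρ (length A))) ((λ i i<a → rel-≢ (proj₂ (proj₂ (fits-at r fs (subst (i <_) (sym (≡ᵇ⇒≡ {length r} len)) i<a))))) , fs))
      q check₀ t₁ ts₁ ok₁ t₂ u₂ ts₂ ok₂ t₃ u₃ ts₃ ok₃

  no-path₆ : Excluded path₆
  no-path₆ = wf-sound path₆ refl , impossible-path₆

  no-square : Excluded square
  no-square = wf-sound square refl , impossible-square

-- The excluded graphs, with certificates found by exhaustive search. A theta is a hexagon with a vertex joined to two
-- opposite vertices, a cap a hexagon with a vertex joined to four consecutive ones; a hub is joined to all of these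
-- vertices, a point to none, a pendant to one, an ear to the two ends of an edge. pet-1 and pet-2 lack one and two
-- vertices of the Petersen graph.

-- The hexagon is 0 3 2 1 6 5, vertex 4 joins 2 and 5, and 7 is the hub; the pendant 8 hangs on 4
-- and misses the hub.
theta-hub-pendant : Pat
theta-hub-pendant = graph (0 ∷ 0 ∷ 2 ∷ 5 ∷ 4 ∷ 17 ∷ 34 ∷ 127 ∷ 16 ∷ [])

t-theta-hub-pendant : Prf
t-theta-hub-pendant = or (or end (or (or (or (or (emb 0 0x912305) (or (emb 1 0x9561) (or (emb 1 0x9571) (or end (emb
  0 0x698423))))) (emb 1 0x9421)) (emb 1 0x9321)) (or (or (or (or (emb 0 0x916503) (or (emb 1 0x9672) (or end (emb 0
  0x984503)))) (emb 1 0x9542)) (or (emb 0 0x194503) (or (emb 1 0x9561) (or (emb 1 0x9471) (or end end))))) (or (or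
  (emb 0 0x193054) (emb 1 0x5930)) (or (or (or (emb 1 0x9371) (or end (emb 0 0x891650))) (emb 1 0x9654)) (emb 1
  0x5930)))))) (or (or (or (or (or (emb 0 0x124509) (or (emb 0 0x612309) (emb 0 0x96124))) (or (emb 1 0x9450) (or (emb
  0 0x612309) (or (emb 1 0x9470) (or end (emb 0 0x890321)))))) (or (or (emb 0 0x124509) (or (or (emb 1 0x9573) (or end
  (emb 0 0x895612))) (emb 0 0x96124))) (emb 1 0x4932))) (or (emb 1 0x9230) (or (or (or (or (emb 1 0x9270) (or end (emb
  0 0x398456))) (emb 1 0x9650)) (emb 1 0x9542)) (or (emb 1 0x9450) (or (or (emb 1 0x9270) (or end end)) (emb 1
  0x6921)))))) (or (or (or (or (or (or (emb 1 0x9170) (or (emb 0 0x842309) (emb 1 0x8974))) (emb 0 0x965423)) (or (emb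
  1 0x9561) (emb 0 0x690324))) (emb 1 0x9421)) (emb 1 0x9321)) (or (emb 1 0x9230) (or (or (or (emb 0 0x391654) (emb 1
  0x9650)) (emb 1 0x9542)) (or (emb 1 0x9450) (or (emb 1 0x9561) (or (emb 1 0x9170) (or end end))))))))

c1-theta-hub-pendant : Clique
c1-theta-hub-pendant = clique (0 ∷ 3 ∷ 7 ∷ []) (7 ∷ 8 ∷ 9 ∷ 10 ∷ 11 ∷ 12 ∷ []) (((emb 1 0xa593) ∷ (emb 0 0x612a09) ∷
  (emb 0 0x612a09) ∷ (emb 0 0x612a09) ∷ (emb 1 0xa593) ∷ (emb 1 0xa593) ∷ []) ∷ ((emb 1 0xa290) ∷ (emb 0 0x165a39) ∷
  (emb 0 0x165a39) ∷ (emb 1 0xa290) ∷ (emb 1 0xa290) ∷ []) ∷ ((emb 1 0xa290) ∷ (emb 1 0xa290) ∷ (emb 1 0xa290) ∷ (emb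
  1 0xa290) ∷ []) ∷ ((emb 1 0xa290) ∷ (emb 1 0xa290) ∷ (emb 1 0xa290) ∷ []) ∷ ((emb 1 0xa190) ∷ (emb 1 0xa190) ∷ []) ∷
  ((emb 1 0xa190) ∷ []) ∷ [])

c2-theta-hub-pendant : Clique
c2-theta-hub-pendant = clique (1 ∷ 2 ∷ 7 ∷ []) (2 ∷ 3 ∷ 4 ∷ 5 ∷ 11 ∷ 12 ∷ []) (((emb 1 0xa692) ∷ (emb 0 0x91a503) ∷
  (emb 0 0x91a503) ∷ (emb 0 0x91a305) ∷ (emb 1 0xa692) ∷ (emb 1 0xa692) ∷ []) ∷ ((emb 1 0xa491) ∷ (emb 1 0xa491) ∷
  (emb 0 0x694a30) ∷ (emb 1 0xa491) ∷ (emb 1 0xa491) ∷ []) ∷ ((emb 1 0xa491) ∷ (emb 0 0x891a30) ∷ (emb 1 0xa491) ∷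
  (emb 1 0xa491) ∷ []) ∷ ((emb 1 0xa391) ∷ (emb 1 0xa391) ∷ (emb 1 0xa391) ∷ []) ∷ ((emb 1 0xa190) ∷ (emb 1 0xa190) ∷
  []) ∷ ((emb 1 0xa190) ∷ []) ∷ [])

c3-theta-hub-pendant : Clique
c3-theta-hub-pendant = clique (5 ∷ 6 ∷ []) (1 ∷ 6 ∷ []) (((emb 1 0xa591) ∷ (emb 0 0x91230a) ∷ []) ∷ ((emb 1 0xa490)
  ∷ []) ∷ [])

-- The hexagon is 0 2 3 5 6 1, with 4 over 3 5 6 1. The pendants forming the region hang on 4.
A-cap-pendant : Pat
A-cap-pendant = graph (0 ∷ 1 ∷ 1 ∷ 4 ∷ 10 ∷ 24 ∷ 50 ∷ [])

r-cap-pendant : Row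
r-cap-pendant = bits 7 16

cap-pendant : Pat
cap-pendant = r-cap-pendant ∷ A-cap-pendant

t1-cap-pendant : Prf
t1-cap-pendant = or (or (or (or (or (emb 0 0x312508) (or (or end (emb 0 0x87213)) (emb 0 0x864312))) (emb 0
  0x84312)) (or (or (or (emb 0 0x650831) (emb 1 0x8650)) (emb 1 0x8543)) (or (emb 1 0x8450) (or (or (emb 0 0x846721)
  (emb 1 0x8764)) (or (emb 0 0x86721) end))))) (or (or (emb 0 0x82134) (or (emb 1 0x8250) (or (or end (emb 1 0x8764))
  (or (emb 1 0x8672) end)))) (emb 1 0x3821))) (or (or (or (or (or (emb 0 0x650813) (emb 1 0x8650)) (emb 1 0x8521))
  (emb 1 0x8431)) (or (or (or (or (emb 0 0x467218) (emb 1 0x8750)) (emb 1 0x8650)) (emb 1 0x8521)) (or (emb 1 0x8450)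
  (emb 1 0x8521)))) (or (or (or (emb 1 0x8250) (or (emb 0 0x81346) (or (emb 1 0x8672) end))) (emb 1 0x8431)) (or (or
  (emb 1 0x8250) (emb 1 0x8543)) (or (emb 1 0x8250) (or (or end (emb 1 0x8764)) (or (emb 1 0x8672) end))))))

ts1-cap-pendant : List (List Prf)
ts1-cap-pendant = ((emb 1 0x9380) ∷ (emb 0 0x680921) ∷ (emb 1 0x9480) ∷ (emb 1 0x9680) ∷ (emb 1 0x9380) ∷ (emb 1
  0x9380) ∷ []) ∷ ((emb 1 0x9280) ∷ (emb 1 0x9280) ∷ (emb 0 0x790843) ∷ (emb 1 0x9280) ∷ (emb 1 0x9280) ∷ []) ∷ ((emb
  1 0x9280) ∷ (emb 1 0x9280) ∷ (emb 1 0x9280) ∷ (emb 1 0x9280) ∷ []) ∷ ((emb 1 0x9180) ∷ (emb 1 0x9180) ∷ (emb 1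
  0x9180) ∷ []) ∷ ((emb 1 0x9180) ∷ (emb 1 0x9180) ∷ []) ∷ ((emb 1 0x9180) ∷ []) ∷ []

t2-cap-pendant : Prf
t2-cap-pendant = or (or (or (or (or (emb 0 0x423609) (or (or end (emb 0 0x238901)) (emb 0 0x457901))) (emb 0
  0x245901)) (emb 0 0x324901)) (or (emb 0 0x423901) (emb 1 0x4932))) (or (or (or (emb 0 0x542901) (emb 1 0x9542)) (or
  (or (or (emb 0 0x754901) (emb 1 0x9760)) (emb 1 0x9632)) (or (emb 1 0x9560) (emb 1 0x9632)))) (or (or (emb 0
  0x542901) (emb 1 0x9542)) (or (or (emb 1 0x9360) (emb 1 0x9654)) (or (emb 1 0x9360) (or (or (emb 0 0x783901) (emb 1
  0x9875)) (or (emb 1 0x9783) end))))))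

u2-cap-pendant : Prf
u2-cap-pendant = or (or (or (or (or (emb 0 0x423619) (or (or end (emb 0 0x238910)) (emb 0 0x457910))) (emb 0
  0x245910)) (emb 0 0x324910)) (or (emb 0 0x423910) (emb 1 0x4932))) (or (or (or (emb 0 0x542910) (emb 1 0x9542)) (or
  (or (or (emb 0 0x754910) (emb 1 0x9761)) (emb 1 0x9632)) (or (emb 1 0x9561) (emb 1 0x9632)))) (or (or (emb 0
  0x542910) (emb 1 0x9542)) (or (or (emb 1 0x9361) (emb 1 0x9654)) (or (emb 1 0x9361) (or (or (emb 0 0x783910) (emb 1
  0x9875)) (or (emb 1 0x9783) end))))))

ts2-cap-pendant : List (List Prf)
ts2-cap-pendant = ((emb 1 0xa592) ∷ []) ∷ []

t3-cap-pendant : Prf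
t3-cap-pendant = or (or (or (or (or (emb 0 0x53470a) (or (or end (emb 0 0x349a01)) (emb 0 0x568a01))) (emb 0
  0x356a01)) (emb 0 0x435a01)) (emb 0 0x34a012)) (or (emb 0 0x43a012) (or (emb 0 0x53a012) (or (emb 0 0x65a012) (or
  (emb 1 0xa470) (or (emb 0 0x86a012) (or (emb 0 0x94a012) end))))))

u3-cap-pendant : Prf
u3-cap-pendant = or (or (or (or (or (emb 0 0x53472a) (or (or end (emb 0 0x49a210)) (emb 0 0x68a210))) (emb 0
  0x56a210)) (emb 0 0x35a210)) (emb 0 0x34a210)) (or (emb 0 0x43a210) (or (emb 0 0x53a210) (or (emb 0 0x65a210) (or
  (emb 1 0xa472) (or (emb 0 0x86a210) (or (emb 0 0x94a210) end))))))

ts3-cap-pendant : List (List Prf)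
ts3-cap-pendant = ((emb 1 0xb6a3) ∷ []) ∷ []

-- The hexagon is 0 1 5 6 3 4, and 2 joins its opposite vertices 1 and 3.
A-theta-point : Pat
A-theta-point = graph (0 ∷ 1 ∷ 2 ∷ 4 ∷ 9 ∷ 2 ∷ 40 ∷ [])

r-theta-point : Row
r-theta-point = bits 7 0

theta-point : Pat
theta-point = r-theta-point ∷ A-theta-point

t1-theta-point : Prf
t1-theta-point = or (or (or (or (or (or (or end (emb 0 0x874512)) (emb 0 0x86215)) (emb 0 0x85123)) (emb 0 0x84321))
  (or (or (emb 0 0x83215) (emb 1 0x8543)) (or (emb 0 0x84512) (or (emb 0 0x85126) (emb 1 0x6832))))) (or (or (or (emb
  0 0x82345) (emb 1 0x5821)) (emb 1 0x8432)) (or (or (emb 0 0x83451) (emb 1 0x5821)) (or (or (or end (emb 1 0x8762))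
  (or (emb 1 0x8674) end)) (emb 1 0x5821))))) (or (or (or (emb 0 0x81234) (or (emb 1 0x8451) (or (emb 0 0x84326) (emb
  1 0x8621)))) (emb 1 0x8321)) (or (or (or (emb 0 0x81543) (or (or (emb 0 0x82347) (emb 1 0x8762)) (or (emb 0 0x86743)
  (emb 1 0x7854)))) (emb 1 0x8432)) (or (or (or (or (emb 0 0x674518) (emb 1 0x8762)) (or (emb 0 0x86745) (emb 1
  0x8743))) (emb 1 0x8543)) (or (emb 1 0x8451) (or (or end (emb 1 0x8762)) (or (emb 1 0x8674) end))))))

ts1-theta-point : List (List Prf)
ts1-theta-point = ((emb 1 0x9280) ∷ (emb 1 0x9280) ∷ (emb 1 0x9280) ∷ (emb 1 0x9280) ∷ []) ∷ ((emb 1 0x9280) ∷ (emb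
  1 0x9280) ∷ (emb 1 0x9280) ∷ []) ∷ ((emb 1 0x9180) ∷ (emb 1 0x9180) ∷ []) ∷ ((emb 1 0x9180) ∷ []) ∷ []

t2-theta-point : Prf
t2-theta-point = or (or (or (or (or (or (or end (emb 0 0x458901)) (emb 0 0x237901)) (emb 0 0x326901)) (emb 0
  0x345901)) (emb 0 0x234901)) (or (or (emb 0 0x543901) (emb 1 0x9543)) (or (or (emb 0 0x623901) (emb 1 0x6932)) (or
  (emb 0 0x623901) (emb 1 0x6932))))) (or (or (emb 0 0x432901) (emb 1 0x9432)) (or (or (emb 0 0x543901) (emb 1
  0x9543)) (or (or (emb 0 0x562901) (emb 1 0x9654)) (or (emb 1 0x9562) (or (or (emb 0 0x873901) (emb 1 0x9873)) (or
  (emb 1 0x9785) end))))))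

u2-theta-point : Prf
u2-theta-point = or (or (or (or (or (or (or end (emb 0 0x458910)) (emb 0 0x237910)) (emb 0 0x326910)) (emb 0
  0x345910)) (emb 0 0x234910)) (or (or (emb 0 0x543910) (emb 1 0x9543)) (or (or (emb 0 0x623910) (emb 1 0x6932)) (or
  (emb 0 0x623910) (emb 1 0x6932))))) (or (or (emb 0 0x432910) (emb 1 0x9432)) (or (or (emb 0 0x543910) (emb 1
  0x9543)) (or (or (emb 0 0x562910) (emb 1 0x9654)) (or (emb 1 0x9562) (or (or (emb 0 0x873910) (emb 1 0x9873)) (or
  (emb 1 0x9785) end))))))

ts2-theta-point : List (List Prf)
ts2-theta-point = ((emb 1 0xa492) ∷ []) ∷ []

t3-theta-point : Prf
t3-theta-point = or (or (or (or (or (or (or end (emb 0 0x569a01)) (emb 0 0x348a01)) (emb 0 0x437a01)) (emb 0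
  0x456a01)) (emb 0 0x345a01)) (emb 0 0x34a012)) (or (emb 0 0x43a012) (or (emb 0 0x54a012) (or (emb 0 0x65a012) (or
  (emb 0 0x73a012) (or (emb 0 0x84a012) (or (emb 0 0x96a012) end))))))

u3-theta-point : Prf
u3-theta-point = or (or (or (or (or (or (or end (emb 0 0x69a210)) (emb 0 0x48a210)) (emb 0 0x37a210)) (emb 0
  0x56a210)) (emb 0 0x45a210)) (emb 0 0x34a210)) (or (emb 0 0x43a210) (or (emb 0 0x54a210) (or (emb 0 0x65a210) (or
  (emb 0 0x73a210) (or (emb 0 0x84a210) (or (emb 0 0x96a210) end))))))

ts3-theta-point : List (List Prf)
ts3-theta-point = ((emb 1 0xb5a3) ∷ []) ∷ []

A-cap-point : Pat
A-cap-point = graph (0 ∷ 1 ∷ 1 ∷ 4 ∷ 10 ∷ 24 ∷ 50 ∷ [])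

r-cap-point : Row
r-cap-point = bits 7 0

cap-point : Pat
cap-point = r-cap-point ∷ A-cap-point

t1-cap-point : Prf
t1-cap-point = or (or (or (or (or (or (or end (emb 0 0x87213)) (emb 0 0x864312)) (emb 0 0x85213)) (emb 0 0x84312))
  (or (or (emb 0 0x83125) (emb 1 0x8543)) (or (emb 0 0x84521) (or (or (emb 0 0x846721) (emb 1 0x8764)) (or (emb 0
  0x86721) end))))) (or (or (emb 0 0x82134) (or (emb 1 0x8452) (or (or end (emb 1 0x8764)) (or (emb 1 0x8672) end))))
  (emb 1 0x3821))) (or (or (or (or (emb 0 0x81345) (emb 1 0x8521)) (emb 1 0x8431)) (or (or (emb 0 0x83452) (emb 1
  0x8521)) (or (or (emb 0 0x81256) (or end (emb 1 0x8721))) (emb 1 0x8521)))) (or (or (or (emb 0 0x82543) (or (emb 0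
  0x81346) (or (emb 1 0x8672) end))) (emb 1 0x8431)) (or (or (or (or (emb 0 0x83457) end) (emb 1 0x8652)) (emb 1
  0x8543)) (or (emb 1 0x8452) (or (or end (emb 1 0x8764)) (or (emb 1 0x8672) end))))))

ts1-cap-point : List (List Prf)
ts1-cap-point = ((emb 1 0x9380) ∷ (emb 0 0x680921) ∷ (emb 1 0x9480) ∷ (emb 1 0x9380) ∷ (emb 1 0x9580) ∷ (emb 1
  0x9380) ∷ (emb 1 0x9380) ∷ (emb 1 0x9380) ∷ []) ∷ ((emb 1 0x9280) ∷ (emb 1 0x9280) ∷ (emb 0 0x390827) ∷ (emb 0
  0x790843) ∷ (emb 0 0x190846) ∷ (emb 1 0x9280) ∷ (emb 1 0x9280) ∷ []) ∷ ((emb 1 0x9280) ∷ (emb 1 0x9480) ∷ (emb 1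
  0x9280) ∷ (emb 1 0x9280) ∷ (emb 1 0x9280) ∷ (emb 1 0x9280) ∷ []) ∷ ((emb 1 0x9180) ∷ (emb 1 0x9180) ∷ (emb 1 0x9180)
  ∷ (emb 1 0x9180) ∷ (emb 1 0x9180) ∷ []) ∷ ((emb 1 0x9180) ∷ (emb 1 0x9180) ∷ (emb 1 0x9180) ∷ (emb 1 0x9180) ∷ []) ∷
  ((emb 1 0x9180) ∷ (emb 1 0x9180) ∷ (emb 1 0x9180) ∷ []) ∷ ((emb 1 0x9180) ∷ (emb 1 0x9180) ∷ []) ∷ ((emb 1 0x9180) ∷
  []) ∷ []

t2-cap-point : Prf
t2-cap-point = or (or (or (or (or (or (or end (emb 0 0x238901)) (emb 0 0x457901)) (emb 0 0x236901)) (emb 0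
  0x245901)) (emb 0 0x324901)) (or (emb 0 0x423901) (emb 1 0x4932))) (or (or (or (emb 0 0x542901) (emb 1 0x9542)) (or
  (or (emb 0 0x632901) (emb 1 0x9632)) (or (emb 0 0x632901) (emb 1 0x9632)))) (or (or (emb 0 0x542901) (emb 1 0x9542))
  (or (or (emb 0 0x563901) (emb 1 0x9654)) (or (emb 1 0x9563) (or (or (emb 0 0x783901) (emb 1 0x9875)) (or (emb 1
  0x9783) end))))))

u2-cap-point : Prf
u2-cap-point = or (or (or (or (or (or (or end (emb 0 0x238910)) (emb 0 0x457910)) (emb 0 0x236910)) (emb 0
  0x245910)) (emb 0 0x324910)) (or (emb 0 0x423910) (emb 1 0x4932))) (or (or (or (emb 0 0x542910) (emb 1 0x9542)) (or
  (or (emb 0 0x632910) (emb 1 0x9632)) (or (emb 0 0x632910) (emb 1 0x9632)))) (or (or (emb 0 0x542910) (emb 1 0x9542))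
  (or (or (emb 0 0x563910) (emb 1 0x9654)) (or (emb 1 0x9563) (or (or (emb 0 0x783910) (emb 1 0x9875)) (or (emb 1
  0x9783) end))))))

ts2-cap-point : List (List Prf)
ts2-cap-point = ((emb 1 0xa592) ∷ []) ∷ []

t3-cap-point : Prf
t3-cap-point = or (or (or (or (or (or (or end (emb 0 0x349a01)) (emb 0 0x568a01)) (emb 0 0x347a01)) (emb 0
  0x356a01)) (emb 0 0x435a01)) (emb 0 0x34a012)) (or (emb 0 0x43a012) (or (emb 0 0x53a012) (or (emb 0 0x65a012) (or
  (emb 0 0x74a012) (or (emb 0 0x86a012) (or (emb 0 0x94a012) end))))))

u3-cap-point : Prf
u3-cap-point = or (or (or (or (or (or (or end (emb 0 0x49a210)) (emb 0 0x68a210)) (emb 0 0x47a210)) (emb 0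
  0x56a210)) (emb 0 0x35a210)) (emb 0 0x34a210)) (or (emb 0 0x43a210) (or (emb 0 0x53a210) (or (emb 0 0x65a210) (or
  (emb 0 0x74a210) (or (emb 0 0x86a210) (or (emb 0 0x94a210) end))))))

ts3-cap-point : List (List Prf)
ts3-cap-point = ((emb 1 0xb6a3) ∷ []) ∷ []

-- The hexagon is 0 1 5 4 3 2, with 6 over 0 2 3 4. Vertex 7 sees 4 and the two hexagon neighbours
-- of 4, like a clone of it, but misses 6.
clones : Pat
clones = graph (0 ∷ 1 ∷ 1 ∷ 4 ∷ 8 ∷ 18 ∷ 29 ∷ 56 ∷ [])

t-clones : Prf
t-clones = or (or end (or (or (or (emb 0 0x432018) (or (emb 1 0x8451) (or (or (emb 0 0x748102) end) (emb 1
  0x6810)))) (or (or (or (emb 0 0x264518) (emb 1 0x6810)) (emb 1 0x8543)) (or (emb 1 0x8451) (or (or (emb 0 0x748102)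
  end) (emb 1 0x6810))))) (emb 1 0x2810))) (or (or (or (or (or (emb 0 0x345108) (emb 1 0x8510)) (or (or (emb 1 0x8460)
  (or (emb 0 0x375108) (emb 0 0x268751))) (emb 1 0x8510))) (emb 1 0x8320)) (or (or (or (emb 0 0x345108) (emb 1
  0x8510)) (emb 1 0x8432)) (or (or (or (emb 0 0x154628) (or end (emb 1 0x7864))) (emb 1 0x8510)) (or (or (emb 1
  0x8360) (or end end)) (emb 1 0x8510))))) (or (or (or (or (emb 0 0x543208) (or (or end (emb 0 0x187462)) (emb 1
  0x6854))) (or (emb 1 0x8451) (or (emb 1 0x8460) (or end (emb 1 0x7863))))) (emb 1 0x8320)) (or (or (or (or (or (emb
  0 0x573608) (emb 1 0x8751)) (or end (emb 1 0x8751))) (or (or (emb 0 0x182647) (emb 1 0x8732)) (emb 1 0x6854))) (emb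
  1 0x8432)) (or (or (or (emb 1 0x8360) (or end (emb 1 0x8751))) (emb 1 0x8543)) (or (emb 1 0x8451) (or (emb 1 0x8360)
  (or (emb 1 0x8573) end)))))))

-- One pair of rows calls for extremality: 9 is a clone of base vertex 0, and 8 sees 0 but misses 9.
-- Least degree sum then provides a vertex seeing 9 and missing 0, and all its rows are refuted.
c1-clones : Clique
c1-clones = clique (0 ∷ 2 ∷ 6 ∷ []) (3 ∷ 4 ∷ 5 ∷ 8 ∷ 9 ∷ 10 ∷ []) (((emb 1 0x9380) ∷ (emb 0 0x154928) ∷ (emb 0
  0x154928) ∷ (emb 0 0x543809) ∷ (emb 0 0x451928) ∷ (emb 1 0x9380) ∷ []) ∷ ((emb 1 0x9380) ∷ (emb 0 0x157928) ∷ (emb 0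
  0x573809) ∷ (emb 0 0x751928) ∷ (emb 1 0x9380) ∷ []) ∷ ((emb 1 0x9380) ∷ (ext 0 9 8 (or (or (or (or (or (or (or (or
  (or (or nope (emb 0 0xa91543)) (or nope (emb 0 0x38a915))) (emb 0 0xa73201)) (or (emb 0 0xa63751) (emb 0 0xa73201)))
  (emb 0 0xa54320)) (emb 0 0xa43201)) (or (or (emb 0 0xa34510) (emb 1 0xa543)) (or (emb 0 0xa45102) (or (or (emb 1
  0xa573) (or (or nope (emb 1 0x9a51)) (or nope (emb 1 0x9a80)))) (or (emb 1 0xa573) (or (emb 1 0xa786) (or nope (emb
  1 0x9a80)))))))) (or (or (or (emb 0 0x45102a) (or (emb 0 0x36015a) (emb 1 0x6a54))) (emb 1 0xa432)) (or (or (emb 0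
  0xa34510) (emb 1 0xa543)) (or (or (emb 0 0xa36015) (or (emb 0 0x74a201) (or (emb 0 0xa38015) (or nope (emb 1
  0x9a80))))) (or (emb 1 0xa462) (or (emb 0 0x74a201) (or (emb 1 0xa482) (or nope (emb 1 0x9a80))))))))) (or (or (or
  (emb 0 0x43201a) (or (emb 1 0xa451) (or (or (emb 0 0x74a102) (or (or nope (emb 0 0x5a9083)) (emb 1 0x8a10))) (emb 1
  0x6a10)))) (or (or (or (emb 0 0x26451a) (emb 1 0x6a10)) (emb 1 0xa543)) (or (emb 1 0xa451) (or (or (emb 0 0x74a102)
  (or (or nope (emb 1 0x9a32)) (emb 1 0x8a10))) (emb 1 0x6a10))))) (emb 1 0x2a10))) nope)) ∷ (emb 1 0x9380) ∷ (emb 1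
  0x9380) ∷ []) ∷ ((emb 1 0x9281) ∷ (emb 0 0x543908) ∷ (emb 1 0x9281) ∷ []) ∷ ((emb 1 0x9380) ∷ (emb 1 0x9380) ∷ []) ∷
  ((emb 1 0x9380) ∷ []) ∷ [])

c2-clones : Clique
c2-clones = clique (0 ∷ 1 ∷ []) (6 ∷ 7 ∷ 8 ∷ 9 ∷ 10 ∷ []) (((emb 1 0x9580) ∷ (emb 0 0x234918) ∷ (emb 0 0x345809) ∷
  (emb 0 0x746918) ∷ (emb 1 0x9580) ∷ []) ∷ ((emb 1 0x9480) ∷ (emb 0 0x375809) ∷ (emb 0 0x291847) ∷ (emb 1 0x9480) ∷
  []) ∷ ((emb 1 0x9281) ∷ (emb 0 0x543908) ∷ (emb 1 0x9281) ∷ []) ∷ ((emb 1 0x9380) ∷ (emb 1 0x9380) ∷ []) ∷ ((emb 1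
  0x9380) ∷ []) ∷ [])

c3-clones : Clique
c3-clones = clique (1 ∷ 5 ∷ []) (1 ∷ 2 ∷ 6 ∷ 7 ∷ []) (((emb 1 0x9481) ∷ (emb 0 0x859320) ∷ (emb 0 0x843209) ∷ (emb 0
  0x873209) ∷ []) ∷ ((emb 1 0x9381) ∷ (emb 0 0x264819) ∷ (emb 0 0x781962) ∷ []) ∷ ((emb 1 0x9580) ∷ (emb 0 0x234918) ∷
  []) ∷ ((emb 1 0x9480) ∷ []) ∷ [])

-- Vertex 0 is the hub. A vertex missing it creates a P6, a C4, `theta-point` or
-- `theta-hub-pendant`, so the hub is universal; `cap-hub` works in the same way.
theta-hub : Pat
theta-hub = graph (0 ∷ 1 ∷ 1 ∷ 1 ∷ 11 ∷ 7 ∷ 13 ∷ 41 ∷ [])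

t-theta-hub : Prf
t-theta-hub = or (or (or (or (or (or (or (or (emb 3 0x82615734) (emb 2 0x802574361)) (emb 0 0x862514)) (or (emb 0
  0x852634) (emb 1 0x6850))) (or (or (emb 0 0x843625) (emb 1 0x6840)) (emb 1 0x5840))) (or (or (emb 0 0x251438) (emb 1
  0x5830)) (or (or (emb 0 0x841526) (emb 1 0x6840)) (emb 1 0x5830)))) (or (or (or (emb 0 0x341528) (or (emb 0
  0x143628) (emb 1 0x6850))) (emb 1 0x4820)) (emb 1 0x3820))) (or (or (or (or (or (emb 0 0x263418) (emb 1 0x6810)) (or
  (emb 0 0x263418) (emb 1 0x6810))) (or (or (emb 0 0x362518) (emb 1 0x6810)) (emb 1 0x5840))) (emb 1 0x3810)) (emb 1
  0x2810))) end

cap-hub : Pat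
cap-hub = graph (0 ∷ 1 ∷ 1 ∷ 1 ∷ 7 ∷ 11 ∷ 13 ∷ 87 ∷ [])

t-cap-hub : Prf
t-cap-hub = or (or (or (or (or (or (or (or (emb 3 0x84276315) (emb 2 0x84276315)) (emb 0 0x863514)) (or (emb 0
  0x853624) (emb 1 0x6850))) (or (or (emb 0 0x842635) (emb 1 0x6840)) (emb 1 0x5840))) (or (or (emb 0 0x241538) (or
  (emb 0 0x851426) (emb 1 0x6850))) (emb 1 0x4830))) (or (or (or (emb 0 0x351428) (emb 1 0x5820)) (or (or (emb 0
  0x153628) (emb 1 0x6840)) (emb 1 0x5820))) (emb 1 0x3820))) (or (or (or (or (or (emb 0 0x362418) (emb 1 0x6810)) (or
  (emb 0 0x362418) (emb 1 0x6810))) (or (or (emb 0 0x263518) (emb 1 0x6810)) (emb 1 0x5840))) (emb 1 0x3810)) (emb 1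
  0x2810))) end

-- The hexagon 0 1 2 4 5 3 has its opposite pairs joined through 6, 7 and 9, which are all adjacent
-- to 8. Ten rows stay open, one for the clones of each vertex; the table `ts-petersen` has one
-- refutation for each of the thirty non-adjacent pairs.
petersen : Pat
petersen = graph (0 ∷ 1 ∷ 2 ∷ 1 ∷ 4 ∷ 24 ∷ 12 ∷ 34 ∷ 192 ∷ 273 ∷ [])

t-petersen : Prf
t-petersen = or (or (or (or (or (or (or (emb 2 0xa5403621) (or (emb 0 0xa63017) (or (emb 1 0xa786) (or (emb 0
  0xa62109) end)))) (emb 0 0xa54210)) (emb 0 0xa42103)) (or (emb 0 0xa30124) (or (emb 1 0xa453) (or (or (emb 0
  0x4a3017) (or (or end (emb 0 0x5a9012)) (emb 0 0x8a4210))) (emb 0 0x5a6210))))) (or (or (or (emb 0 0x53012a) (emb 1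
  0xa542)) (or (emb 0 0xa45301) (or (or (or (or (emb 0 0x5a2109) end) (emb 0 0x8a5301)) (emb 0 0x4a7103)) (emb 0
  0x4a6301)))) (or (or (or (emb 1 0xa362) (or (or (emb 0 0xa68710) (or end (emb 0 0x6a9017))) (emb 1 0x7a21))) (emb 1
  0xa542)) (or (emb 1 0xa453) (or (emb 1 0xa362) (or (emb 0 0x6a5710) (emb 1 0x7a21))))))) (or (or (or (or (emb 0
  0x45301a) (or (or (emb 1 0xa571) (or (emb 0 0x86301a) (or end (emb 0 0x7a9426)))) (emb 1 0xa621))) (emb 1 0xa421))
  (emb 1 0x3a10)) (or (or (or (emb 0 0x45301a) (emb 1 0xa542)) (or (or (emb 0 0x4a1036) (or (or (or end (emb 0
  0x2a9035)) (emb 0 0x8a4530)) (emb 0 0x2a7530))) (or (emb 0 0x4a1036) (emb 1 0x6a53)))) (emb 1 0x3a10)))) (or (or (or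
  (or (or (emb 0 0x54210a) (emb 1 0xa530)) (or (or (or (or (emb 0 0x86210a) (or (emb 1 0xa490) end)) (emb 0 0x7a0362))
  (emb 1 0xa630)) (emb 1 0xa530))) (or (or (emb 0 0x54210a) (or (emb 0 0x5a0126) (or (or (or end (emb 0 0x9a5712))
  (emb 0 0x3a8712)) (emb 0 0x3a7124)))) (or (emb 1 0xa453) (or (emb 0 0x5a0126) (emb 1 0x6a42))))) (emb 1 0xa210)) (or
  (or (or (or (emb 0 0x24530a) (emb 1 0xa530)) (emb 1 0xa421)) (or (or (or (or (or (or (emb 0 0x62490a) end) (emb 0
  0xa8624)) (emb 0 0x7a3624)) (emb 0 0xa6245)) (or (emb 0 0xa5426) (emb 1 0xa621))) (emb 1 0xa421))) (or (or (or (or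
  (or (emb 0 0x63571a) (or (or end (emb 0 0x9a2635)) (emb 0 0x1a8635))) (emb 0 0x1a6354)) (emb 1 0xa530)) (or (or (emb
  0 0x1a4536) (emb 1 0xa630)) (emb 1 0xa530))) (or (or (or (emb 1 0xa362) (or (emb 0 0x6a1754) (emb 1 0xa753))) (emb 1
  0xa542)) (or (emb 1 0xa453) (or (emb 1 0xa362) (emb 3 0x6431250a)))))))

ts-petersen : List (List Prf)
ts-petersen = ((emb 0 0x8ab301) ∷ (emb 0 0xab5301) ∷ (emb 0 0x8ab103) ∷ (emb 0 0x8ab012) ∷ (emb 0 0x8ab124) ∷ (emb 0
  0x8ab035) ∷ []) ∷ ((emb 0 0xba4901) ∷ (emb 0 0x5ab109) ∷ (emb 0 0x5ab012) ∷ (emb 0 0x5ab126) ∷ (emb 0 0x5ab268) ∷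
  []) ∷ ((emb 0 0x4ab301) ∷ (emb 0 0x4ab103) ∷ (emb 0 0x4ab017) ∷ (emb 0 0xba268) ∷ (emb 0 0x4ab036) ∷ []) ∷ ((emb 0
  0x6ab109) ∷ (emb 0 0x6ab017) ∷ (emb 0 0xba245) ∷ (emb 0 0xab0945) ∷ []) ∷ ((emb 0 0xab4903) ∷ (emb 0 0x9ba126) ∷
  (emb 0 0x3ba124) ∷ (emb 0 0xab3624) ∷ []) ∷ ((emb 0 0x2ab035) ∷ (emb 0 0x3ba178) ∷ (emb 0 0x2ab357) ∷ []) ∷ ((emb 0
  0xab5712) ∷ (emb 0 0xab2635) ∷ []) ∷ ((emb 0 0x3ab249) ∷ []) ∷ [] ∷ [] ∷ []

-- The 4-regular graph formed by the hexagon 0 1 2 4 5 3 and three pairwise non-adjacent vertices 6,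
-- 7, 8, each over four consecutive hexagon vertices and missing one of the alternate edges 45, 12,
-- 03.
quartic : Pat
quartic = graph (0 ∷ 1 ∷ 2 ∷ 1 ∷ 4 ∷ 24 ∷ 15 ∷ 57 ∷ 54 ∷ [])

t-quartic : Prf
t-quartic = or (or (or (or (or (or (or (emb 2 0x91063524) (or (emb 2 0x93574201) (emb 1 0x7960))) (emb 0 0x954210))
  (emb 0 0x942103)) (or (emb 0 0x930124) (or (emb 1 0x9453) (or (or (emb 0 0x957012) (or (emb 0 0x970628) end)) (emb 1
  0x6942))))) (or (or (or (emb 0 0x530129) (emb 1 0x9542)) (or (emb 0 0x945301) (or (or (emb 0 0x163749) (or (emb 0
  0x948103) end)) (emb 1 0x6953)))) (or (or (or (emb 1 0x9362) (or (emb 0 0x570129) (emb 1 0x7960))) (emb 1 0x9542))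
  (or (emb 1 0x9453) (or (emb 1 0x9362) (or (emb 1 0x9473) (emb 1 0x7960))))))) (or (or (or (or (emb 0 0x453019) (or
  (emb 0 0x62459) (emb 1 0x6953))) (emb 1 0x9421)) (emb 1 0x3910)) (or (or (or (emb 0 0x453019) (emb 1 0x9542)) (or
  (or (or (emb 0 0x570629) (emb 1 0x7910)) (or (or (emb 0 0x35829) end) (emb 1 0x7910))) (or (or (or (emb 1 0x9481)
  end) (emb 1 0x7910)) (emb 1 0x6953)))) (emb 1 0x3910)))) (or (or (or (or (or (emb 0 0x542109) (emb 1 0x9530)) (or
  (or (emb 0 0x163549) (emb 1 0x6942)) (emb 1 0x9530))) (or (or (emb 0 0x542109) (or (or (emb 0 0x937421) (or (emb 0
  0x974816) (emb 1 0x9810))) (or (emb 0 0x937421) (or end (emb 1 0x9810))))) (or (emb 1 0x9453) (or (or (emb 1 0x9470)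
  (or end (emb 1 0x9810))) (emb 1 0x6942))))) (emb 1 0x9210)) (or (or (or (or (emb 0 0x245309) (emb 1 0x9530)) (emb 1
  0x9421)) (or (or (or (emb 0 0x542609) (or (or (emb 0 0x285709) (emb 1 0x8962)) (or end (emb 1 0x8962)))) (or (emb 1
  0x9361) (or (emb 1 0x9570) (or (emb 1 0x9581) (emb 1 0x8962))))) (emb 1 0x9421))) (or (or (or (or (emb 0 0x453619)
  (or (or (emb 0 0x374819) end) (emb 1 0x9742))) (emb 1 0x9530)) (or (or (emb 1 0x9260) (or (emb 1 0x9470) (emb 1
  0x7963))) (emb 1 0x9530))) (or (or (or (emb 1 0x9260) (or (or end (emb 1 0x9853)) (emb 1 0x9742))) (emb 1 0x9542))
  (or (emb 1 0x9453) (or (emb 1 0x9260) (emb 3 0x63415029)))))))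

ts-quartic : List (List Prf)
ts-quartic = ((emb 1 0x9a63) ∷ (emb 1 0xa981) ∷ (emb 1 0xa930) ∷ (emb 1 0xa970) ∷ []) ∷ ((emb 1 0x9a62) ∷ (emb 1
  0xa921) ∷ (emb 1 0xa970) ∷ (emb 1 0xa970) ∷ []) ∷ ((emb 1 0xa910) ∷ (emb 1 0xa910) ∷ (emb 1 0x9a74) ∷ []) ∷ ((emb 1
  0xa910) ∷ (emb 1 0xa910) ∷ (emb 1 0x9a62) ∷ (emb 1 0xa953) ∷ []) ∷ ((emb 1 0x9a85) ∷ []) ∷ ((emb 1 0xa942) ∷ (emb 1
  0xa942) ∷ []) ∷ [] ∷ [] ∷ [] ∷ []

pet-1 : Pat
pet-1 = graph (0 ∷ 0 ∷ 2 ∷ 5 ∷ 1 ∷ 18 ∷ 20 ∷ 40 ∷ 192 ∷ [])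

t-pet-1 : Prf
t-pet-1 = or (or end (or (or (or (emb 0 0x912304) (or (emb 1 0x9451) (or (or (emb 0 0x957326) (or end (emb 0
  0x598623))) (emb 0 0x596230)))) (emb 1 0x9321)) (or (or (or (emb 0 0x915403) (or (or (or end (emb 0 0x895403)) (emb
  0 0x197304)) (emb 0 0x196403))) (or (emb 1 0x9451) (or (emb 1 0x9462) (or (emb 0 0x695730) (emb 1 0x9732))))) (or
  (or (or (emb 0 0x193046) (or (or end (emb 0 0x891540)) (emb 0 0x297540))) (or (emb 0 0x193046) (emb 1 0x6954))) (emb
  1 0x4930))))) (or (or (or (or (or (emb 0 0x512309) (emb 1 0x9540)) (or (emb 0 0x512309) (or (emb 0 0x95126) (or (or
  end (emb 0 0x890321)) (emb 0 0x497321))))) (or (or (emb 0 0x215409) (emb 1 0x9540)) (or (or (or (or end (emb 0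
  0x894512)) (emb 0 0x97512)) (emb 0 0x96215)) (or (emb 0 0x95126) (emb 1 0x6932))))) (or (emb 1 0x9230) (or (or (or
  (or (emb 0 0x754629) (or end (emb 0 0x398645))) (emb 0 0x396451)) (emb 1 0x9540)) (or (or (emb 1 0x9462) (or (emb 0
  0x693751) (emb 1 0x9754))) (emb 1 0x5921))))) (or (or (or (or (or (or (or (emb 0 0x862309) (emb 2 0x9876514230))
  (emb 0 0x790462)) (emb 1 0x9640)) (emb 1 0x9540)) (or (emb 1 0x9451) (or (emb 0 0x590326) (emb 1 0x9621)))) (emb 1
  0x9321)) (or (emb 1 0x9230) (or (or (or (emb 0 0x391546) (emb 1 0x9640)) (emb 1 0x9540)) (or (emb 1 0x9451) (or (emb
  1 0x9462) (or (emb 1 0x9573) (or (emb 1 0x9786) end))))))))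

c1-pet-1 : Clique
c1-pet-1 = clique (0 ∷ 3 ∷ []) (5 ∷ 6 ∷ 7 ∷ []) (((emb 1 0xa493) ∷ (emb 0 0x512a09) ∷ (emb 1 0xa493) ∷ []) ∷
  ((emb 1 0xa290) ∷ (emb 1 0xa290) ∷ []) ∷ ((emb 1 0xa190) ∷ []) ∷ [])

c2-pet-1 : Clique
c2-pet-1 = clique (1 ∷ 2 ∷ []) (2 ∷ 3 ∷ 7 ∷ []) (((emb 1 0xa592) ∷ (emb 0 0x91a304) ∷ (emb 1 0xa592) ∷ []) ∷
  ((emb 1 0xa391) ∷ (emb 1 0xa391) ∷ []) ∷ ((emb 1 0xa190) ∷ []) ∷ [])

c3-pet-1 : Clique
c3-pet-1 = clique (4 ∷ 5 ∷ []) (1 ∷ 4 ∷ []) (((emb 1 0xa491) ∷ (emb 0 0x91230a) ∷ []) ∷ ((emb 1 0xa590) ∷ []) ∷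
  [])

cap : Pat
cap = graph (0 ∷ 1 ∷ 2 ∷ 1 ∷ 12 ∷ 24 ∷ 52 ∷ [])

t-cap : Prf
t-cap = or (or end (or (or (or (or (or (emb 0 0x643017) (emb 1 0x7621)) (or (emb 0 0x643017) (emb 1 0x7621))) (emb 1
  0x7421)) (emb 1 0x3710)) (or (or (or (or (emb 0 0x643017) (emb 2 0x74126503)) (emb 1 0x7542)) (or (or (emb 0
  0x653017) end) (or (emb 1 0x7562) end))) (emb 1 0x3710)))) (or (or (or (or (or (emb 0 0x542107) (emb 1 0x7530)) (emb
  1 0x7430)) (or (or (emb 0 0x542107) (or (emb 2 0x74035612) (emb 1 0x7643))) (or (or (emb 0 0x562107) (emb 1 0x7653))
  (or end end)))) (emb 1 0x7210)) (or (or (or (or (or (emb 0 0x265307) (emb 1 0x7621)) (emb 1 0x7530)) (emb 1 0x7430))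
  (or (or (or end (emb 1 0x7621)) (or end (emb 1 0x7621))) (emb 1 0x7421))) (or (or (or (or end end) (emb 1 0x7530))
  (emb 1 0x7430)) (or (emb 1 0x7342) (or (or end (emb 1 0x7653)) (or (emb 1 0x7562) end))))))

c1-cap : Clique
c1-cap = clique (0 ∷ 3 ∷ []) (3 ∷ 4 ∷ 5 ∷ 6 ∷ 9 ∷ 10 ∷ []) (((emb 1 0x8470) ∷ (emb 0 0x738621) ∷ (emb 0 0x265708) ∷
  (emb 0 0x738126) ∷ (emb 1 0x8470) ∷ (emb 1 0x8470) ∷ []) ∷ ((emb 1 0x8470) ∷ (emb 2 0x87103526) ∷ (emb 1 0x8570) ∷
  (emb 1 0x8470) ∷ (emb 1 0x8470) ∷ []) ∷ ((emb 1 0x8371) ∷ (emb 0 0x245807) ∷ (emb 0 0x562807) ∷ (emb 1 0x8371) ∷ [])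
  ∷ ((emb 1 0x8570) ∷ (emb 1 0x8371) ∷ (emb 1 0x8570) ∷ []) ∷ ((emb 1 0x8270) ∷ (emb 1 0x8270) ∷ []) ∷ ((emb 1 0x8270)
  ∷ []) ∷ [])

c2-cap : Clique
c2-cap = clique (0 ∷ 1 ∷ []) (5 ∷ 6 ∷ 7 ∷ 8 ∷ 9 ∷ 10 ∷ []) (((emb 1 0x8371) ∷ (emb 0 0x245807) ∷ (emb 0 0x542807) ∷
  (emb 0 0x542807) ∷ (emb 0 0x562807) ∷ (emb 1 0x8371) ∷ []) ∷ ((emb 1 0x8570) ∷ (emb 0 0x643718) ∷ (emb 3
  0x487261530) ∷ (emb 1 0x8371) ∷ (emb 1 0x8570) ∷ []) ∷ ((emb 1 0x8270) ∷ (emb 0 0x346817) ∷ (emb 0 0x653817) ∷ (emb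
  1 0x8270) ∷ []) ∷ ((emb 1 0x8270) ∷ (emb 1 0x8270) ∷ (emb 1 0x8270) ∷ []) ∷ ((emb 1 0x8270) ∷ (emb 1 0x8270) ∷ []) ∷
  ((emb 1 0x8270) ∷ []) ∷ [])

c3-cap : Clique
c3-cap = clique (1 ∷ 2 ∷ []) (1 ∷ 2 ∷ 7 ∷ 8 ∷ []) (((emb 1 0x8471) ∷ (emb 0 0x35827) ∷ (emb 0 0x765308) ∷ (emb 0
  0x530827) ∷ []) ∷ ((emb 1 0x8471) ∷ (emb 2 0x87012635) ∷ (emb 1 0x8671) ∷ []) ∷ ((emb 1 0x8270) ∷ (emb 0 0x346817) ∷
  []) ∷ ((emb 1 0x8270) ∷ []) ∷ [])

pet-2 : Pat
pet-2 = graph (0 ∷ 0 ∷ 1 ∷ 6 ∷ 3 ∷ 16 ∷ 36 ∷ 40 ∷ [])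

t-pet-2 : Prf
t-pet-2 = or (or end (or (or (or (or (or (emb 0 0x562318) (or (emb 2 0x24653187) (emb 0 0x781402))) (emb 0
  0x581320)) (or (or (emb 0 0x562318) (emb 1 0x8654)) (emb 0 0x581320))) (or (or (emb 0 0x540238) (emb 1 0x8541)) (or
  (or (or end (emb 0 0x875620)) (emb 1 0x6832)) (or (emb 0 0x185620) (emb 1 0x6832))))) (or (emb 1 0x8231) (or (or (or
  (or (emb 0 0x754028) end) (emb 0 0x386540)) (emb 1 0x8541)) (emb 1 0x4820))))) (or (or (or (or (or (or (or (emb 0
  0x573208) (emb 2 0x134752086)) (emb 0 0x680413)) (emb 0 0x580231)) (or (or (emb 0 0x845623) (emb 1 0x8620)) (emb 0
  0x580231))) (emb 1 0x8320)) (or (or (or (emb 0 0x541328) (emb 1 0x8540)) (or (or (or end (emb 1 0x8732)) (emb 1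
  0x8654)) (or (emb 1 0x8562) (or (emb 0 0x85731) (emb 1 0x8732))))) (or (or (or (emb 0 0x145628) (or end (emb 0
  0x287541))) (emb 1 0x8540)) (emb 1 0x4831)))) (or (or (or (emb 1 0x8140) (or (or (emb 0 0x562318) (emb 1 0x8620))
  (or (or end (emb 0 0x487326)) (emb 1 0x8620)))) (emb 1 0x8320)) (or (emb 1 0x8231) (or (emb 1 0x8140) (or (or (or
  (emb 0 0x83756) (emb 1 0x8754)) (emb 1 0x8654)) (or (emb 1 0x8562) (or (emb 1 0x8573) end)))))))

c1-pet-2 : Clique
c1-pet-2 = clique (0 ∷ 4 ∷ []) (3 ∷ 5 ∷ 6 ∷ []) (((emb 1 0x9482) ∷ (emb 0 0x731908) ∷ (emb 1 0x9482) ∷ []) ∷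
  ((emb 1 0x9180) ∷ (emb 1 0x9180) ∷ []) ∷ ((emb 1 0x9180) ∷ []) ∷ [])

c2-pet-2 : Clique
c2-pet-2 = clique (1 ∷ 4 ∷ []) (1 ∷ 5 ∷ 6 ∷ []) (((emb 1 0x9483) ∷ (emb 0 0x620918) ∷ (emb 1 0x9483) ∷ []) ∷
  ((emb 1 0x9180) ∷ (emb 1 0x9180) ∷ []) ∷ ((emb 1 0x9180) ∷ []) ∷ [])

c3-pet-2 : Clique
c3-pet-2 = clique (2 ∷ 3 ∷ []) (2 ∷ 4 ∷ []) (((emb 1 0x9281) ∷ (emb 0 0x781409) ∷ []) ∷ ((emb 1 0x9380) ∷ []) ∷
  [])

theta : Pat
theta = graph (0 ∷ 0 ∷ 2 ∷ 5 ∷ 8 ∷ 18 ∷ 33 ∷ [])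

t-theta : Prf
t-theta = or (or end (or (or (or (or (emb 0 0x34517) (or (emb 0 0x712306) (emb 0 0x176034))) (or (emb 1 0x7451) (or
  (emb 0 0x712306) end))) (emb 1 0x7321)) (or (or (or (emb 0 0x34517) (or end (emb 0 0x176034))) (emb 1 0x7432)) (or
  (or (or end (emb 1 0x6730)) (emb 1 0x7543)) (or (emb 1 0x7451) (or end (emb 1 0x6730))))))) (or (or (or (or (or (emb
  0 0x512307) (or (emb 1 0x7560) end)) (emb 1 0x7430)) (or (or (or (emb 0 0x215607) end) (emb 1 0x7543)) (or (emb 0
  0x74512) (or (emb 1 0x7560) end)))) (or (emb 1 0x7230) (or (or (emb 0 0x72154) (emb 1 0x5721)) (or (or end (emb 1
  0x7654)) (emb 1 0x5721))))) (or (or (or (or (or (emb 2 0x27153046) (emb 0 0x765432)) (or (emb 1 0x7560) (emb 0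
  0x671234))) (emb 1 0x7430)) (emb 1 0x7321)) (or (emb 1 0x7230) (or (or (or (emb 0 0x270654) (emb 1 0x7651)) (emb 1
  0x7543)) (or (emb 1 0x7451) (or (emb 1 0x7560) end))))))

c1-theta : Clique
c1-theta = clique (0 ∷ 3 ∷ []) (6 ∷ 7 ∷ 8 ∷ 9 ∷ []) (((emb 1 0x8673) ∷ (emb 0 0x215807) ∷ (emb 0 0x512807) ∷ (emb 1
  0x8673) ∷ []) ∷ ((emb 1 0x8470) ∷ (emb 0 0x674821) ∷ (emb 1 0x8470) ∷ []) ∷ ((emb 1 0x8270) ∷ (emb 1 0x8270) ∷ []) ∷
  ((emb 1 0x8170) ∷ []) ∷ [])

c2-theta : Clique
c2-theta = clique (1 ∷ 2 ∷ []) (2 ∷ 3 ∷ 4 ∷ 9 ∷ []) (((emb 1 0x8572) ∷ (emb 0 0x718306) ∷ (emb 0 0x718306) ∷ (emb 1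
  0x8572) ∷ []) ∷ ((emb 1 0x8371) ∷ (emb 0 0x65827) ∷ (emb 1 0x8371) ∷ []) ∷ ((emb 1 0x8371) ∷ (emb 1 0x8371) ∷ []) ∷
  ((emb 1 0x8170) ∷ []) ∷ [])

c3-theta : Clique
c3-theta = clique (5 ∷ 6 ∷ []) (1 ∷ 5 ∷ []) (((emb 1 0x8471) ∷ (emb 0 0x712308) ∷ []) ∷ ((emb 1 0x8570) ∷ []) ∷ [])

hexagon : Pat
hexagon = graph (0 ∷ 0 ∷ 1 ∷ 6 ∷ 1 ∷ 18 ∷ [])

t-hexagon : Prf
t-hexagon = or (or end (or (or (or (emb 0 0x613204) (or (emb 1 0x6451) end)) (or (or (emb 0 0x615402) end) (or (emb
  1 0x6451) (emb 2 0x1564320)))) (or (emb 1 0x6231) (or (or end (emb 2 0x3165204)) (emb 1 0x4620))))) (or (or (or (or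
  (or (emb 0 0x513206) (emb 1 0x6540)) (or (emb 0 0x513206) end)) (emb 1 0x6320)) (or (or (or (emb 0 0x315406) (emb 1
  0x6540)) (or end (emb 2 0x465231))) (or (or end (emb 1 0x6540)) (or (emb 2 0x2064315) (emb 1 0x5631))))) (or (or (or
  (or (emb 3 0x3160452) (emb 1 0x6540)) (or (emb 1 0x6451) (emb 2 0x4561023))) (emb 1 0x6320)) (or (emb 1 0x6231) (or
  (or (emb 2 0x2361045) (emb 1 0x6540)) (or (emb 1 0x6451) end)))))

c1-hexagon : Clique
c1-hexagon = clique (0 ∷ 2 ∷ []) (5 ∷ 6 ∷ 7 ∷ []) (((emb 1 0x7462) ∷ (emb 0 0x513706) ∷ (emb 1 0x7462) ∷ []) ∷ ((emb
  1 0x7360) ∷ (emb 1 0x7360) ∷ []) ∷ ((emb 1 0x7160) ∷ []) ∷ [])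

c2-hexagon : Clique
c2-hexagon = clique (1 ∷ 3 ∷ []) (2 ∷ 3 ∷ 7 ∷ []) (((emb 1 0x7563) ∷ (emb 0 0x617204) ∷ (emb 1 0x7563) ∷ []) ∷ ((emb
  1 0x7261) ∷ (emb 1 0x7261) ∷ []) ∷ ((emb 1 0x7160) ∷ []) ∷ [])

c3-hexagon : Clique
c3-hexagon = clique (4 ∷ 5 ∷ []) (1 ∷ 4 ∷ []) (((emb 1 0x7461) ∷ (emb 0 0x613207) ∷ []) ∷ ((emb 1 0x7560) ∷ []) ∷
  [])

-- Two pentagons 1 2 3 4 5 and 0 2 3 4 6 share the path 2 3 4, with 5 and 6 adjacent; 7 is an ear on
-- the edge 23.
boiler : Pat
boiler = graph (0 ∷ 0 ∷ 3 ∷ 4 ∷ 8 ∷ 18 ∷ 49 ∷ 12 ∷ [])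

t-boiler : Prf
t-boiler = or (or end (or (or (or (or (or (emb 0 0x460218) (emb 1 0x8651)) (emb 0 0x854320)) (or (emb 1 0x8451) (or
  (emb 0 0x856023) (or end (emb 1 0x8721))))) (emb 1 0x8321)) (or (or (or (or (or (emb 0 0x734518) (emb 0 0x187346))
  (emb 1 0x6820)) (or (or end (emb 0 0x187346)) (emb 1 0x6820))) (emb 1 0x8432)) (or (or (or (emb 0 0x183460) (emb 1
  0x6820)) (emb 1 0x8543)) (or (emb 1 0x8451) (or (or (emb 0 0x65837) end) (emb 1 0x6820))))))) (or (or (or (or (or
  (emb 0 0x451208) (emb 2 0x583240)) (or (emb 2 0x481250) (or (emb 1 0x8460) (or end (emb 1 0x8720))))) (emb 1
  0x8320)) (or (or (or (or (or (emb 0 0x734608) (emb 0 0x87345)) (or end (emb 0 0x87345))) (emb 1 0x5821)) (emb 1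
  0x8432)) (or (or (emb 0 0x83451) (emb 1 0x5821)) (or (or (emb 0 0x380651) (or (emb 0 0x156837) end)) (emb 1
  0x5821))))) (or (emb 1 0x8120) (or (or (or (emb 0 0x81543) (or (emb 0 0x180643) (or (emb 0 0x85437) end))) (emb 1
  0x8432)) (or (or (or (or (emb 0 0x560837) end) (emb 1 0x8651)) (emb 1 0x8543)) (or (emb 1 0x8451) (or (emb 1 0x8460)
  (or end end)))))))

c1-boiler : Clique
c1-boiler = clique (0 ∷ 2 ∷ []) (5 ∷ 6 ∷ 7 ∷ 8 ∷ 9 ∷ 10 ∷ []) (((emb 1 0x9682) ∷ (emb 0 0x154908) ∷ (emb 0 0x345908)
  ∷ (emb 0 0x451908) ∷ (emb 1 0x9682) ∷ (emb 1 0x9682) ∷ []) ∷ ((emb 1 0x9380) ∷ (emb 1 0x9780) ∷ (emb 1 0x9380) ∷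
  (emb 1 0x9380) ∷ (emb 1 0x9380) ∷ []) ∷ ((emb 1 0x9180) ∷ (emb 1 0x9180) ∷ (emb 1 0x9180) ∷ (emb 1 0x9180) ∷ []) ∷
  ((emb 1 0x9180) ∷ (emb 1 0x9180) ∷ (emb 1 0x9180) ∷ []) ∷ ((emb 1 0x9180) ∷ (emb 1 0x9180) ∷ []) ∷ ((emb 1 0x9180) ∷
  []) ∷ [])

c2-boiler : Clique
c2-boiler = clique (1 ∷ 2 ∷ []) (2 ∷ 3 ∷ 7 ∷ 8 ∷ 9 ∷ 10 ∷ []) (((emb 1 0x9582) ∷ (emb 0 0x64918) ∷ (emb 0 0x346918)
  ∷ (emb 0 0x460918) ∷ (emb 1 0x9582) ∷ (emb 1 0x9582) ∷ []) ∷ ((emb 1 0x9381) ∷ (emb 1 0x9781) ∷ (emb 1 0x9381) ∷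
  (emb 1 0x9381) ∷ (emb 1 0x9381) ∷ []) ∷ ((emb 1 0x9180) ∷ (emb 1 0x9180) ∷ (emb 1 0x9180) ∷ (emb 1 0x9180) ∷ []) ∷
  ((emb 1 0x9180) ∷ (emb 1 0x9180) ∷ (emb 1 0x9180) ∷ []) ∷ ((emb 1 0x9180) ∷ (emb 1 0x9180) ∷ []) ∷ ((emb 1 0x9180) ∷
  []) ∷ [])

c3-boiler : Clique
c3-boiler = clique (5 ∷ 6 ∷ []) (1 ∷ 4 ∷ []) (((emb 1 0x9481) ∷ (emb 0 0x859023) ∷ []) ∷ ((emb 1 0x9480) ∷ []) ∷ [])

-- The pentagon is 0 1 2 3 4. Vertex 5 hangs on 1, and the region consists of the pendants on its
-- neighbour 0.
A-C5-pendants : Pat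
A-C5-pendants = graph (0 ∷ 1 ∷ 2 ∷ 4 ∷ 9 ∷ 2 ∷ [])

r-C5-pendants : Row
r-C5-pendants = bits 6 1

C5-pendants : Pat
C5-pendants = r-C5-pendants ∷ A-C5-pendants

t1-C5-pendants : Prf
t1-C5-pendants = or (or (or (or (emb 0 0x432107) (emb 2 0x472130)) (or (or (emb 2 0x375140) (emb 1 0x7510))
  (or (or (emb 0 0x470126) (emb 1 0x6732)) (emb 1 0x7510)))) (emb 1 0x7210)) (or (or (or (or (or end (emb 0 0x76234))
  (emb 0 0x75432)) (or (emb 1 0x7451) (or (emb 0 0x74326) (emb 1 0x7621)))) (emb 1 0x7321)) (or (or (or (emb 0
  0x72345) (or end end)) (emb 1 0x7432)) (or (or (or end end) (emb 1 0x7543)) (or (emb 1 0x7451) (or end end)))))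

ts1-C5-pendants : List (List Prf)
ts1-C5-pendants = ((emb 1 0x8270) ∷ (emb 1 0x8270) ∷ (emb 1 0x8270) ∷ (emb 0 0x680754) ∷ (emb 1 0x8270) ∷ (emb
  1 0x8270) ∷ []) ∷ ((emb 1 0x8270) ∷ (emb 0 0x670834) ∷ (emb 1 0x8270) ∷ (emb 1 0x8270) ∷ (emb 1 0x8270) ∷ []) ∷
  ((emb 1 0x8270) ∷ (emb 1 0x8270) ∷ (emb 1 0x8270) ∷ (emb 1 0x8270) ∷ []) ∷ ((emb 1 0x8270) ∷ (emb 1 0x8270) ∷ (emb 1
  0x8270) ∷ []) ∷ ((emb 1 0x8270) ∷ (emb 1 0x8270) ∷ []) ∷ ((emb 1 0x8270) ∷ []) ∷ []

t2-C5-pendants : Prf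
t2-C5-pendants = or (or (or (or (emb 0 0x543208) (emb 0 0x345801)) (or (or (emb 0 0x654801) (emb 1 0x8620))
  (or (or (emb 0 0x734801) (emb 0 0x587321)) (emb 1 0x8620)))) (emb 1 0x8320)) (or (or (or (or (or end (emb 0
  0x437801)) (emb 0 0x456801)) (emb 0 0x345801)) (emb 1 0x8432)) (or (or (emb 0 0x543801) (emb 1 0x8543)) (or (or (emb
  0 0x654801) (emb 1 0x8654)) (or (emb 1 0x8562) (or end end)))))

u2-C5-pendants : Prf
u2-C5-pendants = or (or (or (or (emb 0 0x543218) (emb 0 0x345810)) (or (or (emb 0 0x654810) (emb 1 0x8621))
  (or (or (emb 0 0x734810) (emb 0 0x587320)) (emb 1 0x8621)))) (emb 1 0x8321)) (or (or (or (or (or end (emb 0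
  0x437810)) (emb 0 0x456810)) (emb 0 0x345810)) (emb 1 0x8432)) (or (or (emb 0 0x543810) (emb 1 0x8543)) (or (or (emb
  0 0x654810) (emb 1 0x8654)) (or (emb 1 0x8562) (or end end)))))

ts2-C5-pendants : List (List Prf)
ts2-C5-pendants = ((emb 1 0x9482) ∷ (emb 1 0x9482) ∷ []) ∷ ((emb 1 0x9482) ∷ (emb 1 0x9482) ∷ []) ∷ []

t3-C5-pendants : Prf
t3-C5-pendants = or (or (or (or (emb 0 0x654309) (emb 0 0x456901)) (emb 0 0x459012)) (emb 1 0x9430)) (or (or
  (or (or (or end (emb 0 0x548901)) (emb 0 0x567901)) (emb 0 0x456901)) (emb 0 0x459012)) (or (emb 0 0x549012) (or
  (emb 0 0x659012) (or (emb 0 0x769012) (or (emb 0 0x849012) end)))))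

u3-C5-pendants : Prf
u3-C5-pendants = or (or (or (or (emb 0 0x654329) (emb 0 0x569210)) (emb 0 0x459210)) (emb 1 0x9432)) (or (or
  (or (or (or end (emb 0 0x489210)) (emb 0 0x679210)) (emb 0 0x569210)) (emb 0 0x459210)) (or (emb 0 0x549210) (or
  (emb 0 0x659210) (or (emb 0 0x769210) (or (emb 0 0x849210) end)))))

ts3-C5-pendants : List (List Prf)
ts3-C5-pendants = ((emb 1 0xa593) ∷ []) ∷ []

-- The ear 5 sits on the edge 01, and the region consists of the pendants on its end 0.
A-C5-pendant-ear : Pat
A-C5-pendant-ear = graph (0 ∷ 1 ∷ 2 ∷ 4 ∷ 9 ∷ 3 ∷ [])

r-C5-pendant-ear : Row
r-C5-pendant-ear = bits 6 1

C5-pendant-ear : Pat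
C5-pendant-ear = r-C5-pendant-ear ∷ A-C5-pendant-ear

t1-C5-pendant-ear : Prf
t1-C5-pendant-ear = or (or (or (or (emb 0 0x432107) (emb 2 0x472130)) (or (or (emb 2 0x375140) (emb 1 0x7510))
  (or (or (emb 3 0x67432150) (emb 1 0x7610)) (emb 1 0x7510)))) (emb 1 0x7210)) (or (or (or (or (or end (emb 0
  0x76234)) (emb 0 0x75432)) (or (emb 1 0x7451) (or (emb 0 0x74326) end))) (emb 1 0x7321)) (or (or (or (emb 0 0x72345)
  (or end end)) (emb 1 0x7432)) (or (or (or end end) (emb 1 0x7543)) (or (emb 1 0x7451) (or end end)))))

ts1-C5-pendant-ear : List (List Prf)
ts1-C5-pendant-ear = ((emb 1 0x8470) ∷ (emb 1 0x8570) ∷ (emb 1 0x8570) ∷ (emb 3 0x58234760) ∷ (emb 1 0x8670) ∷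
  (emb 1 0x8470) ∷ (emb 1 0x8470) ∷ []) ∷ ((emb 1 0x8270) ∷ (emb 1 0x8270) ∷ (emb 1 0x8270) ∷ (emb 0 0x680754) ∷ (emb
  1 0x8270) ∷ (emb 1 0x8270) ∷ []) ∷ ((emb 1 0x8270) ∷ (emb 0 0x670834) ∷ (emb 1 0x8270) ∷ (emb 1 0x8270) ∷ (emb 1
  0x8270) ∷ []) ∷ ((emb 1 0x8270) ∷ (emb 1 0x8270) ∷ (emb 1 0x8270) ∷ (emb 1 0x8270) ∷ []) ∷ ((emb 1 0x8270) ∷ (emb 1
  0x8270) ∷ (emb 1 0x8270) ∷ []) ∷ ((emb 1 0x8270) ∷ (emb 1 0x8270) ∷ []) ∷ ((emb 1 0x8270) ∷ []) ∷ []

t2-C5-pendant-ear : Prf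
t2-C5-pendant-ear = or (or (or (or (emb 0 0x543208) (emb 0 0x345801)) (or (or (emb 0 0x654801) (emb 1 0x8620))
  (or (emb 3 0x14580263) (emb 1 0x8620)))) (emb 1 0x8320)) (or (or (or (or (or end (emb 0 0x437801)) (emb 0 0x456801))
  (emb 0 0x345801)) (emb 1 0x8432)) (or (or (emb 0 0x543801) (emb 1 0x8543)) (or (or (emb 0 0x654801) (emb 1 0x8654))
  (or (emb 1 0x8562) (or end end)))))

u2-C5-pendant-ear : Prf
u2-C5-pendant-ear = or (or (or (or (emb 0 0x543218) (emb 0 0x345810)) (or (or (emb 0 0x654810) (emb 1 0x8621))
  (or (emb 3 0x4581263) (emb 1 0x8621)))) (emb 1 0x8321)) (or (or (or (or (or end (emb 0 0x437810)) (emb 0 0x456810))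
  (emb 0 0x345810)) (emb 1 0x8432)) (or (or (emb 0 0x543810) (emb 1 0x8543)) (or (or (emb 0 0x654810) (emb 1 0x8654))
  (or (emb 1 0x8562) (or end end)))))

ts2-C5-pendant-ear : List (List Prf)
ts2-C5-pendant-ear = ((emb 1 0x9482) ∷ (emb 1 0x9482) ∷ []) ∷ ((emb 1 0x9482) ∷ (emb 1 0x9482) ∷ []) ∷ []

t3-C5-pendant-ear : Prf
t3-C5-pendant-ear = or (or (or (or (emb 0 0x654309) (emb 0 0x456901)) (emb 0 0x459012)) (emb 1 0x9430)) (or
  (or (or (or (or end (emb 0 0x548901)) (emb 0 0x567901)) (emb 0 0x456901)) (emb 0 0x459012)) (or (emb 0 0x549012) (or
  (emb 0 0x659012) (or (emb 0 0x769012) (or (emb 0 0x849012) end)))))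

u3-C5-pendant-ear : Prf
u3-C5-pendant-ear = or (or (or (or (emb 0 0x654329) (emb 0 0x569210)) (emb 0 0x459210)) (emb 1 0x9432)) (or
  (or (or (or (or end (emb 0 0x489210)) (emb 0 0x679210)) (emb 0 0x569210)) (emb 0 0x459210)) (or (emb 0 0x549210) (or
  (emb 0 0x659210) (or (emb 0 0x769210) (or (emb 0 0x849210) end)))))

ts3-C5-pendant-ear : List (List Prf)
ts3-C5-pendant-ear = ((emb 1 0xa593) ∷ []) ∷ []

C5-pendant : Pat
C5-pendant = graph (0 ∷ 0 ∷ 3 ∷ 1 ∷ 10 ∷ 4 ∷ [])

t-C5-pendant : Prf
t-C5-pendant = or (or end (or (or (or (or (emb 3 0x6543021) (emb 0 0x561430)) (or (emb 0 0x643025) (emb 1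
  0x6521))) (or (emb 1 0x6341) (or end (emb 1 0x6521)))) (or (or (or (emb 4 0x5603412) (emb 0 0x561430)) (or end end))
  (emb 1 0x3620)))) (or (or (or (or (or (emb 3 0x6534120) (emb 0 0x560341)) (emb 1 0x6430)) (or (or (emb 0 0x634125)
  (emb 1 0x6520)) (or end (emb 1 0x6520)))) (or (or (or (emb 4 0x5614302) (emb 0 0x560341)) (emb 1 0x6430)) (or (or
  end end) (emb 1 0x4621)))) (or (emb 1 0x6120) (or (or (or end end) (emb 1 0x6430)) (or (emb 1 0x6341) (or end
  end)))))

c1-C5-pendant : Clique
c1-C5-pendant = clique (0 ∷ 2 ∷ []) (5 ∷ 6 ∷ 7 ∷ 8 ∷ 9 ∷ 10 ∷ []) (((emb 1 0x7362) ∷ (emb 1 0x7362) ∷ (emb 4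
  0x5763412) ∷ (emb 0 0x571436) ∷ (emb 1 0x7362) ∷ (emb 1 0x7362) ∷ []) ∷ ((emb 1 0x7560) ∷ (emb 0 0x560714) ∷ (emb 1
  0x7560) ∷ (emb 1 0x7362) ∷ (emb 1 0x7560) ∷ []) ∷ ((emb 1 0x7160) ∷ (emb 1 0x7160) ∷ (emb 1 0x7160) ∷ (emb 1 0x7160)
  ∷ []) ∷ ((emb 1 0x7160) ∷ (emb 1 0x7160) ∷ (emb 1 0x7160) ∷ []) ∷ ((emb 1 0x7160) ∷ (emb 1 0x7160) ∷ []) ∷ ((emb 1
  0x7160) ∷ []) ∷ [])

c2-C5-pendant : Clique
c2-C5-pendant = clique (1 ∷ 2 ∷ []) (2 ∷ 3 ∷ 7 ∷ 8 ∷ 9 ∷ 10 ∷ []) (((emb 1 0x7462) ∷ (emb 1 0x7462) ∷ (emb 4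
  0x5764302) ∷ (emb 0 0x570346) ∷ (emb 1 0x7462) ∷ (emb 1 0x7462) ∷ []) ∷ ((emb 1 0x7561) ∷ (emb 0 0x561703) ∷ (emb 1
  0x7561) ∷ (emb 1 0x7462) ∷ (emb 1 0x7561) ∷ []) ∷ ((emb 1 0x7160) ∷ (emb 1 0x7160) ∷ (emb 1 0x7160) ∷ (emb 1 0x7160)
  ∷ []) ∷ ((emb 1 0x7160) ∷ (emb 1 0x7160) ∷ (emb 1 0x7160) ∷ []) ∷ ((emb 1 0x7160) ∷ (emb 1 0x7160) ∷ []) ∷ ((emb 1
  0x7160) ∷ []) ∷ [])

c3-C5-pendant : Clique
c3-C5-pendant = clique (3 ∷ 4 ∷ []) (1 ∷ 4 ∷ []) (((emb 1 0x7361) ∷ (emb 0 0x647025) ∷ []) ∷ ((emb 1 0x7460) ∷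
  []) ∷ [])

-- Two non-adjacent ears 5 and 6 on the edge 34 of the pentagon 0 2 1 3 4. The pentagon is the frame
-- of the separation check.
C5-ears : Pat
C5-ears = graph (0 ∷ 0 ∷ 3 ∷ 2 ∷ 9 ∷ 24 ∷ 24 ∷ [])

t-C5-ears : Prf
t-C5-ears = or (or (or (or (or (or (or end (emb 0 0x763120)) (emb 0 0x753120)) (emb 3 0x712430)) (or (emb 3
  0x702341) (or (or end end) (or end end)))) (or (or (emb 3 0x734210) (emb 1 0x4720)) (emb 1 0x3721))) (or (or (or
  (emb 3 0x740132) (emb 1 0x7431)) (or (or (emb 0 0x540217) (emb 2 0x541270)) (or (emb 3 0x512470) (or (emb 3
  0x612470) end)))) (or (or (or (or end (emb 0 0x536720)) (emb 1 0x7531)) (emb 1 0x4720)) (or (or (or end (emb 3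
  0x572460)) (or (emb 3 0x672450) (emb 1 0x6754))) (emb 1 0x4720))))) (or (or (or (or (emb 3 0x731042) (or (emb 0
  0x531207) (emb 2 0x571230))) (or (emb 1 0x7340) (or (emb 3 0x502371) (or (emb 3 0x602371) end)))) (or (or (or (or
  end (emb 0 0x546721)) (emb 1 0x7540)) (or (or end (emb 3 0x572361)) (or (emb 3 0x672351) (emb 1 0x6753)))) (emb 1
  0x3721))) (or (emb 1 0x7120) (or (or (or (or end (emb 1 0x7640)) (emb 1 0x7540)) (emb 1 0x7431)) (or (emb 1 0x7340)
  (or (or end end) (or end end))))))

c-C5-ears : Clique
c-C5-ears = clique (3 ∷ 4 ∷ []) (5 ∷ 8 ∷ 12 ∷ 13 ∷ 14 ∷ 15 ∷ []) (((emb 1 0x8471) ∷ (emb 1 0x8675) ∷ (emb 1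
  0x8471) ∷ (emb 1 0x8471) ∷ (emb 1 0x8471) ∷ (emb 1 0x8471) ∷ []) ∷ ((emb 1 0x8370) ∷ (emb 1 0x8370) ∷ (emb 1 0x8370)
  ∷ (emb 1 0x8370) ∷ (emb 1 0x8370) ∷ []) ∷ ((emb 1 0x8170) ∷ (emb 1 0x8170) ∷ (emb 1 0x8170) ∷ (emb 1 0x8170) ∷ []) ∷
  ((emb 1 0x8170) ∷ (emb 1 0x8170) ∷ (emb 1 0x8170) ∷ []) ∷ ((emb 1 0x8170) ∷ (emb 1 0x8170) ∷ []) ∷ ((emb 1 0x8170) ∷
  []) ∷ [])

-- Extremality is needed when a member 7 of the region sees a clone 8 of 0 or 1, whose original it
-- misses. With the degree sum greatest, the original has a neighbour that the clone misses, which
-- is refuted.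
ts-C5-ears : List (List Prf)
ts-C5-ears = ((emb 0 0x873120) ∷ (emb 0 0x537820) ∷ (emb 3 0x582470) ∷ (emb 0 0x547821) ∷ (emb 3 0x582371) ∷
  (emb 1 0x8740) ∷ []) ∷ ((emb 0 0x873120) ∷ (emb 0 0x537820) ∷ (emb 3 0x582470) ∷ (emb 0 0x547821) ∷ (emb 3 0x582371)
  ∷ (emb 1 0x8740) ∷ []) ∷ ((emb 0 0x873120) ∷ (emb 0 0x637820) ∷ (emb 3 0x682470) ∷ (emb 0 0x647821) ∷ (emb 3
  0x682371) ∷ (emb 1 0x8740) ∷ []) ∷ ((emb 0 0x873120) ∷ (emb 1 0x8731) ∷ (ext 1 8 7 (or (or nope (or (or (or (emb 3
  0x940132) (emb 1 0x9431)) (or (or (emb 0 0x540219) (emb 2 0x541290)) (or (emb 3 0x512490) (or (emb 3 0x612490) (or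
  (emb 0 0x759120) (or (emb 1 0x9781) nope)))))) (or (or (or (or (or (or (emb 0 0x47819) nope) (emb 1 0x9731)) (emb 0
  0x536920)) (emb 1 0x9531)) (emb 1 0x4920)) (or (or (or (or (or (emb 0 0x47819) nope) (or (emb 1 0x9781) nope)) (emb
  3 0x592460)) (or (emb 3 0x692450) (emb 1 0x6954))) (emb 1 0x4920))))) (or nope (or (emb 1 0x9120) (or (or (or (or
  (or (or (emb 0 0x540918) nope) (emb 1 0x9740)) (emb 1 0x9640)) (emb 1 0x9540)) (emb 1 0x9431)) (or (emb 1 0x9340)
  (or (or (or (or (emb 0 0x91875) nope) (or (emb 1 0x9781) nope)) (or (or (emb 0 0x91875) nope) (or (emb 1 0x9781)
  nope))) (or (or (or (emb 0 0x91876) nope) (or (emb 1 0x9781) nope)) (or (emb 1 0x9675) (or (emb 1 0x9781)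
  nope)))))))))) ∷ (emb 1 0x8740) ∷ (ext 0 8 7 (or nope (or (or (or (or (emb 3 0x931042) (or (emb 0 0x531209) (emb 2
  0x591230))) (or (emb 1 0x9340) (or (emb 3 0x502391) (or (emb 3 0x602391) (or (emb 0 0x759021) (or (emb 1 0x9780)
  nope)))))) (or (or (or (or (or (or (emb 0 0x137809) nope) (emb 1 0x9740)) (emb 0 0x546921)) (emb 1 0x9540)) (or (or
  (or (or (emb 0 0x137809) nope) (or (emb 1 0x9780) nope)) (emb 3 0x592361)) (or (emb 3 0x692351) (emb 1 0x6953))))
  (emb 1 0x3921))) (or (emb 1 0x9120) (or (or (or (or (or (or (emb 0 0x531908) nope) (emb 1 0x9740)) (emb 1 0x9640))
  (emb 1 0x9540)) (emb 1 0x9431)) (or (emb 1 0x9340) (or (or (or (or (emb 0 0x190875) nope) (or (emb 1 0x9780) nope))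
  (or (or (emb 0 0x190875) nope) (or (emb 1 0x9780) nope))) (or (or (or (emb 0 0x190876) nope) (or (emb 1 0x9780)
  nope)) (or (emb 1 0x9675) (or (emb 1 0x9780) nope)))))))))) ∷ (emb 1 0x8740) ∷ []) ∷ []

-- The pentagon is 0 2 5 4 3 and the ear on the edge 25 is vertex 1, so the pair consists of the ear
-- and a pentagon vertex next to the edge.
C5-ear : Pat
C5-ear = graph (0 ∷ 0 ∷ 3 ∷ 1 ∷ 8 ∷ 22 ∷ [])

t-C5-ear : Prf
t-C5-ear = or (or end (or (or (or (emb 0 0x430216) (emb 2 0x431260)) (or (emb 3 0x412360) (or (emb 1 0x6451)
  end))) (or (or (or (emb 0 0x34516) end) (or (emb 1 0x6451) end)) (emb 1 0x3620)))) (or (or (or (or (or (emb 0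
  0x154306) (emb 1 0x6520)) (emb 1 0x6430)) (or (or end (emb 1 0x6520)) (or end (emb 1 0x6520)))) (or (or (or (emb 0
  0x154306) (emb 3 0x103564)) (emb 1 0x6430)) (or (or end (emb 1 0x6543)) (or (emb 1 0x6452) end)))) (or (emb 1
  0x6120) (or (or (or (emb 2 0x164350) end) (emb 1 0x6430)) (or (or end (emb 1 0x6543)) (or (emb 1 0x6451) end)))))

c1-C5-ear : Clique
c1-C5-ear = clique (0 ∷ 2 ∷ []) (6 ∷ 7 ∷ 8 ∷ 9 ∷ 10 ∷ []) (((emb 1 0x7362) ∷ (emb 1 0x7362) ∷ (ext 0 6 7 (or
  (or (or (or (or (or (or nope (emb 0 0x863451)) (emb 3 0x830542)) (emb 0 0x843021)) (or (or (emb 3 0x852340) (emb 1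
  0x8543)) (or (or nope (emb 0 0x68451)) (or nope (emb 1 0x6852))))) (or (or (or (emb 3 0x843250) (emb 4 0x8152304))
  (emb 3 0x143280)) (emb 1 0x3820))) (or (or (or (emb 0 0x430218) (emb 2 0x431280)) (or (emb 3 0x412380) (or (emb 1
  0x8451) (or nope (emb 1 0x8621))))) (or (or (or (emb 0 0x34518) (or nope (or (emb 0 0x436817) (emb 1 0x7860)))) (or
  (emb 1 0x8451) (or nope (emb 1 0x6843)))) (emb 1 0x3820)))) nope)) ∷ (emb 0 0x451706) ∷ (emb 1 0x7362) ∷ []) ∷ ((emb
  1 0x7460) ∷ (emb 1 0x7560) ∷ (emb 1 0x7362) ∷ (emb 1 0x7460) ∷ []) ∷ ((emb 1 0x7160) ∷ (emb 1 0x7160) ∷ (emb 1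
  0x7160) ∷ []) ∷ ((emb 1 0x7160) ∷ (emb 1 0x7160) ∷ []) ∷ ((emb 1 0x7160) ∷ []) ∷ [])

c2-C5-ear : Clique
c2-C5-ear = clique (1 ∷ 2 ∷ 5 ∷ []) (2 ∷ 3 ∷ 8 ∷ 10 ∷ []) (((emb 4 0x7652304) ∷ (emb 0 0x34716) ∷ (emb 0
  0x430716) ∷ (ext 1 6 7 (or (or (or (or (or (or (or nope (emb 0 0x865430)) (emb 3 0x830542)) (emb 0 0x843021)) (or
  (or (emb 3 0x852340) (emb 1 0x8543)) (or (or nope (emb 1 0x8654)) (or nope (or (emb 1 0x8573) (emb 1 0x7861))))))
  (or (or (or (emb 3 0x843250) (emb 4 0x8152304)) (emb 3 0x143280)) (emb 1 0x3820))) nope) (or (or (or (or (or (emb 0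
  0x154308) (emb 1 0x8520)) (emb 1 0x8430)) (or (or (or nope (emb 1 0x8620)) (emb 1 0x8520)) (or (or nope (emb 1
  0x8620)) (emb 1 0x8520)))) (or (or (or (emb 0 0x154308) (emb 3 0x103584)) (emb 1 0x8430)) (or (or (or nope (or (emb
  1 0x8372) (emb 1 0x7861))) (emb 1 0x8543)) (or (emb 1 0x8452) (or nope (or (emb 1 0x8470) (emb 1 0x7861)))))))
  nope))) ∷ []) ∷ ((emb 1 0x7461) ∷ (emb 2 0x174360) ∷ (emb 1 0x7461) ∷ []) ∷ ((emb 1 0x7160) ∷ (emb 1 0x7160) ∷ []) ∷
  ((emb 1 0x7160) ∷ []) ∷ [])

c3-C5-ear : Clique
c3-C5-ear = clique (3 ∷ []) (1 ∷ 4 ∷ 5 ∷ 9 ∷ []) (((emb 1 0x7361) ∷ (emb 0 0x461207) ∷ (emb 2 0x471260) ∷ (emb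
  1 0x7361) ∷ []) ∷ ((emb 4 0x7630524) ∷ (emb 0 0x154706) ∷ (emb 0 0x451706) ∷ []) ∷ ((emb 1 0x7460) ∷ (emb 2
  0x174650) ∷ []) ∷ ((emb 1 0x7160) ∷ []) ∷ [])

pentagon : Pat
pentagon = graph (0 ∷ 0 ∷ 3 ∷ 2 ∷ 9 ∷ [])

t-pentagon : Prf
t-pentagon = or (or end (or (or (or (emb 3 0x540132) (emb 1 0x5431)) (or (emb 4 0x340152) end)) (or (or (emb 4
  0x204153) (emb 1 0x4520)) (or end (emb 1 0x4520))))) (or (or (or (or (emb 3 0x531042) (emb 4 0x431052)) (or (emb 1
  0x5340) end)) (or (or (emb 4 0x213054) end) (emb 1 0x3521))) (or (emb 1 0x5120) (or (or end (emb 1 0x5431)) (or (emb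
  1 0x5340) end))))

c1-pentagon : Clique
c1-pentagon = clique (0 ∷ 2 ∷ []) (4 ∷ 5 ∷ 6 ∷ []) (((emb 1 0x6452) ∷ (emb 4 0x431056) ∷ (emb 1 0x6452) ∷ []) ∷
  ((emb 1 0x6150) ∷ (emb 1 0x6150) ∷ []) ∷ ((emb 1 0x6150) ∷ []) ∷ [])

c2-pentagon : Clique
c2-pentagon = clique (1 ∷ 2 ∷ []) (2 ∷ 5 ∷ 6 ∷ []) (((emb 1 0x6352) ∷ (emb 4 0x253064) ∷ (emb 1 0x6352) ∷ []) ∷
  ((emb 1 0x6150) ∷ (emb 1 0x6150) ∷ []) ∷ ((emb 1 0x6150) ∷ []) ∷ [])

c3-pentagon : Clique
c3-pentagon = clique (3 ∷ 4 ∷ []) (1 ∷ 3 ∷ []) (((emb 1 0x6451) ∷ (emb 4 0x451062) ∷ []) ∷ ((emb 1 0x6350) ∷ []) ∷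
  [])

-- Dirac's argument for chordal graphs: the region consists of the non-neighbours of vertex 0. Two
-- non-adjacent neighbours of one of its components would close, through vertex 0 and a path with
-- one, two or three interior vertices, a C4, a pentagon or a hexagon.
A-two-points : Pat
A-two-points = graph (0 ∷ [])

r-two-points : Row
r-two-points = bits 1 0

two-points : Pat
two-points = r-two-points ∷ A-two-points

t1-two-points : Prf
t1-two-points = or end end

ts1-two-points : List (List Prf)
ts1-two-points = ((emb 1 0x3120) ∷ []) ∷ []

t2-two-points : Prf
t2-two-points = or end end

u2-two-points : Prf
u2-two-points = or end end

ts2-two-points : List (List Prf)
ts2-two-points = ((emb 3 0x32140) ∷ []) ∷ []

t3-two-points : Prf
t3-two-points = or end end

u3-two-points : Prf
u3-two-points = or end end

ts3-two-points : List (List Prf)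
ts3-two-points = ((emb 2 0x342150) ∷ []) ∷ []

point : Pat
point = graph (0 ∷ [])

t-point : Prf
t-point = or (emb 2 0x10) end

-- The exclusions in order of dependence

module Exclusions {n : ℕ} (G : Graph n) (w : ℕ) (bound : Bound G w) (free : Free G) (IH : Smaller n) where

  open Rules G w bound free IH

  no-theta-hub-pendant : Excluded theta-hub-pendant
  no-theta-hub-pendant = pair-excludes (no-path₆ ∷ no-square ∷ []) theta-hub-pendant t-theta-hub-pendant
    c1-theta-hub-pendant c2-theta-hub-pendant c3-theta-hub-pendant refl

  no-cap-pendant : Excluded cap-pendant
  no-cap-pendant = region-excludes (no-path₆ ∷ no-square ∷ []) A-cap-pendant r-cap-pendant 0 refl t1-cap-pendant
    ts1-cap-pendant refl t2-cap-pendant u2-cap-pendant ts2-cap-pendant refl t3-cap-pendant u3-cap-pendant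
    ts3-cap-pendant refl

  no-theta-point : Excluded theta-point
  no-theta-point = region-excludes (no-path₆ ∷ no-square ∷ []) A-theta-point r-theta-point 0 refl t1-theta-point
    ts1-theta-point refl t2-theta-point u2-theta-point ts2-theta-point refl t3-theta-point u3-theta-point
    ts3-theta-point refl

  no-cap-point : Excluded cap-point
  no-cap-point = region-excludes (no-path₆ ∷ no-square ∷ []) A-cap-point r-cap-point 0 refl t1-cap-point ts1-cap-point
    refl t2-cap-point u2-cap-point ts2-cap-point refl t3-cap-point u3-cap-point ts3-cap-point refl

  no-clones : Excluded clones
  no-clones = pair-excludes-ext (no-path₆ ∷ no-square ∷ []) clones true t-clones c1-clones c2-clones c3-clones refl

  no-theta-hub : Excluded theta-hub
  no-theta-hub = uni-excludes (no-path₆ ∷ no-square ∷ no-theta-hub-pendant ∷ no-theta-point ∷ []) theta-hub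
    t-theta-hub refl

  no-cap-hub : Excluded cap-hub
  no-cap-hub = uni-excludes (no-path₆ ∷ no-square ∷ no-cap-pendant ∷ no-cap-point ∷ []) cap-hub t-cap-hub refl

  no-petersen : Excluded petersen
  -- The colouring alternates 0 and 1 around the hexagon, gives 2 to the connecting vertices 6, 7, 9
  -- and 0 to 8.
  no-petersen = blowup-excludes (no-path₆ ∷ no-square ∷ no-theta-point ∷ no-theta-hub ∷ []) petersen t-petersen (8 ∷ 5
    ∷ 4 ∷ 6 ∷ 7 ∷ 2 ∷ 9 ∷ 3 ∷ 0 ∷ 1 ∷ []) 0x2022011010 0x612320101 ts-petersen refl

  no-quartic : Excluded quartic
  -- The colouring alternates 0 and 1 around the hexagon and gives 2 to the independent vertices 6,
  -- 7, 8.
  no-quartic = blowup-excludes (no-path₆ ∷ no-square ∷ no-cap-point ∷ no-cap-hub ∷ []) quartic t-quartic (5 ∷ 4 ∷ 2 ∷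
    8 ∷ 3 ∷ 7 ∷ 0 ∷ 1 ∷ 6 ∷ []) 0x222011010 0x100320101 ts-quartic refl

  -- The Petersen graph is taken apart from above: once it is excluded, no vertex completes `pet-1`,
  -- and the remaining rows fit three cliques. The same step leads on to `pet-2` and `theta`.
  no-pet-1 : Excluded pet-1
  no-pet-1 = pair-excludes (no-path₆ ∷ no-square ∷ no-petersen ∷ []) pet-1 t-pet-1 c1-pet-1
    c2-pet-1 c3-pet-1 refl

  no-cap : Excluded cap
  no-cap = pair-excludes (no-path₆ ∷ no-square ∷ no-clones ∷ no-quartic ∷ []) cap t-cap c1-cap c2-cap c3-cap refl

  no-pet-2 : Excluded pet-2
  no-pet-2 = pair-excludes (no-path₆ ∷ no-square ∷ no-pet-1 ∷ []) pet-2 t-pet-2 c1-pet-2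
    c2-pet-2 c3-pet-2 refl

  no-theta : Excluded theta
  no-theta = pair-excludes (no-path₆ ∷ no-square ∷ no-pet-2 ∷ []) theta t-theta c1-theta c2-theta c3-theta refl

  no-hexagon : Excluded hexagon
  no-hexagon = pair-excludes (no-path₆ ∷ no-square ∷ no-cap ∷ no-theta ∷ []) hexagon t-hexagon c1-hexagon c2-hexagon
    c3-hexagon refl

  no-boiler : Excluded boiler
  no-boiler = pair-excludes (no-path₆ ∷ no-square ∷ no-hexagon ∷ []) boiler t-boiler c1-boiler c2-boiler c3-boiler
    refl

  no-C5-pendants : Excluded C5-pendants
  no-C5-pendants = region-excludes (no-path₆ ∷ no-square ∷ no-hexagon ∷ []) A-C5-pendants
    r-C5-pendants 1 refl t1-C5-pendants ts1-C5-pendants refl t2-C5-pendants u2-C5-pendants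
    ts2-C5-pendants refl t3-C5-pendants u3-C5-pendants ts3-C5-pendants refl

  no-C5-pendant-ear : Excluded C5-pendant-ear
  no-C5-pendant-ear = region-excludes (no-path₆ ∷ no-square ∷ no-hexagon ∷ no-boiler ∷ [])
    A-C5-pendant-ear r-C5-pendant-ear 1 refl t1-C5-pendant-ear ts1-C5-pendant-ear refl
    t2-C5-pendant-ear u2-C5-pendant-ear ts2-C5-pendant-ear refl t3-C5-pendant-ear
    u3-C5-pendant-ear ts3-C5-pendant-ear refl

  no-C5-pendant : Excluded C5-pendant
  no-C5-pendant = pair-excludes (no-path₆ ∷ no-square ∷ no-hexagon ∷ no-C5-pendants ∷
    no-C5-pendant-ear ∷ []) C5-pendant t-C5-pendant c1-C5-pendant c2-C5-pendant
    c3-C5-pendant refl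

  no-C5-ears : Excluded C5-ears
  no-C5-ears = sep-excludes (no-path₆ ∷ no-square ∷ no-hexagon ∷ no-C5-pendant ∷ []) C5-ears false 5
    (bits 5 24) 0 t-C5-ears c-C5-ears ts-C5-ears refl

  no-C5-ear : Excluded C5-ear
  no-C5-ear = pair-excludes-ext (no-path₆ ∷ no-square ∷ no-hexagon ∷ no-C5-pendant ∷ no-C5-ears ∷
    []) C5-ear true t-C5-ear c1-C5-ear c2-C5-ear c3-C5-ear refl

  no-pentagon : Excluded pentagon
  no-pentagon = pair-excludes (no-path₆ ∷ no-square ∷ no-hexagon ∷ no-C5-pendant ∷ no-C5-ear ∷ [])
    pentagon t-pentagon c1-pentagon c2-pentagon c3-pentagon refl

  no-two-points : Excluded two-points
  no-two-points = region-excludes (no-path₆ ∷ no-square ∷ no-hexagon ∷ no-pentagon ∷ []) A-two-points r-two-points 0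
    refl t1-two-points ts1-two-points refl t2-two-points u2-two-points ts2-two-points refl t3-two-points u3-two-points
    ts3-two-points refl

  no-point : Excluded point
  no-point = uni-excludes (no-path₆ ∷ no-square ∷ no-two-points ∷ []) point t-point refl

-- Induction on the number of vertices

colourable : ∀ n → Acc _<_ n → (G : Graph n) → Free G → ∀ w → Bound G w → Colorable G (half3 w)
colourable zero _ G free w bound = (λ ()) , λ ()
-- Any vertex is an occurrence of `point`, so its exclusion delivers the colouring.
colourable (suc n) (acc rec) G free w bound = finish (proj₂ no-point (λ _ → zero) (z≤n , tt , tt))
  where
  open Exclusions G w bound free (λ H k<n → colourable _ (rec k<n) H)
  finish : Critical.Goal G w bound free (λ H k<n → colourable _ (rec k<n) H) → Colorable G (half3 w)
  finish (c , c<m , c-proper) = (λ v → fromℕ< (c<m v refl)) , λ u v u~v e →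
    c-proper u v refl refl (T⇒≡true u~v) (trans (sym (toℕ-fromℕ< (c<m u refl))) (trans (cong toℕ e) (toℕ-fromℕ< (c<m v refl))))

theorem2 : ∀ {n} (G : Graph n) (w : ℕ) →
    ¬ IsInducedSubgraph P6 G → ¬ IsInducedSubgraph C4 G →
    CliqueNumber G w →
    Σ ℕ λ m → (2 * m ≤ 3 * w) × Colorable G m
theorem2 {n} G w noP6 noC4 (_ , bound) = half3 w ,
  subst (λ k → half3 w + k ≤ 3 * w) (sym (ℕₚ.+-identityʳ (half3 w))) (half-lower (3 * w)) ,
  colourable n (<-wellFounded n) G (noP6 , noC4) w bound
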